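{- Let $q=2^n$ with $n\ge3$ and $q\equiv1\pmod 3$, and let $\mathcal Q(4,q)$, $\mathcal Y$, $\mathcal L_0$, $\mathcal L_3$, $\mathcal Z_1,\mathcal Z_2,\mathcal Z_3$ be as defined in the context (the case $h=1$). Then every line of $\mathcal L_3$ has $3$ points in common with $\mathcal Y$, $\bigl(q-(-1)^{n/2}2\sqrt q-2\bigr)/3$ points in common with $\mathcal Z_1$, and $\bigl(q+(-1)^{n/2}\sqrt q-2\bigr)/3$ points in common with each of $\mathcal Z_2$ and $\mathcal Z_3$. Every line of $\mathcal L_0$ has $\bigl(q-(-1)^{n/2}2\sqrt q+1\bigr)/3$ points in common with $\mathcal Z_1$ and $\bigl(q+(-1)^{n/2}\sqrt q+1\bigr)/3$ points in common with each of $\mathcal Z_2$ and $\mathcal Z_3$.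
   Context: $\mathrm{PG}(5,q)$ has homogeneous coordinates $(X_1,\dots,X_6)$, written as column vectors when acted on by matrices; $U_i$ is the point with $1$ in position $i$ and $0$ elsewhere. $\Pi$ is the hyperplane $X_3+X_4=0$; $\mathcal Q^+(5,q):X_1X_6+X_2X_5+X_3X_4=0$; $\mathcal Q(4,q)=\mathcal Q^+(5,q)\cap\Pi$ is a parabolic quadric. $\tilde G_1\simeq\mathrm{PGL}(2,q)$ is the group of projectivities represented by the matrices, with $a,b,c,d\in\mathbb F_q$, $ad+bc=1$, $$\tilde M_{a,b,c,d}=\begin{pmatrix} a^{4}&0&a^{2}b^{2}&a^{2}b^{2}&0&b^{4}\\ 0&a^2&ab&ab&b^2&0\\ a^{2}c^{2}&ac&b^{2}c^{2}+bc+1&b^{2}c^{2}+bc&bd&b^{2}d^{2}\\ a^{2}c^{2}&ac&b^{2}c^{2}+bc&b^{2}c^{2}+bc+1&bd&b^{2}d^{2}\\ 0&c^2&cd&cd&d^2&0\\ c^{4}&0&c^{2}d^{2}&c^{2}d^{2}&0&d^{4}\end{pmatrix}.$$ $\mathcal Y$ is the set of points of $\Pi$ with $X_1X_5^{2}+X_2^{2}X_6=0$. For $i\in\{0,3\}$, $\mathcal L_i$ is the set of lines of $\mathcal Q(4,q)$ meeting $\mathcal Y$ in exactly $i$ points. Fix a primitive element $\omega$ of $\mathbb F_q$; for $i=1,2,3$, $\mathcal Z_i$ is the $\tilde G_1$-orbit of the point $R_i=U_1+\omega^{i-1}U_5$. Since $q\equiv1\pmod3$, $n$ is even. -}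

module Defs where

open import Algebra.Bundles using (CommutativeRing; Semiring)
open import Algebra.Structures using (IsCommutativeRing)
import Algebra.Definitions.RawSemiring as RawSemiringDefinitions
open import Data.Fin.Base using (Fin)
open import Data.Integer.Base using (+_)
open import Data.Nat.Base as ℕ using (ℕ; ⌊_/2⌋)
open import Data.Nat.DivMod using ([m+kn]%n≡m%n)
open import Data.Nat.Tactic.RingSolver using (solve-∀)
open import Data.Product.Base using (Σ; _×_; _,_; proj₁; proj₂; ∃; ∃-syntax)
open import Data.Rational.Base as ℚ using (ℚ)
open import Data.Vec.Base using (Vec; []; _∷_; map; zipWith; replicate; foldr′)
open import Data.Vec.Properties using (map-id; map-cong; map-∘)
open import Function.Bundles using (Bijection; _↔_)
open import Level using (Level; suc)
open import Relation.Binary.Bundles using (Setoid)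
import Relation.Binary.Construct.On as On
open import Relation.Binary.PropositionalEquality
  using (_≡_; _≢_; refl; sym; trans; cong; setoid; module ≡-Reasoning)
open import Relation.Nullary.Negation using (¬_)
open import Relation.Unary using (Pred; _∈_; _⊆_; _∩_)

-- For q = 2 ^ n ≡ 1 (mod 3) the exponent n is even, so √q = 2 ^ ⌊ n /2⌋.
√q*√q≡q : ∀ n → 2 ℕ.^ n ℕ.% 3 ≡ 1 → 2 ℕ.^ ⌊ n /2⌋ ℕ.* 2 ℕ.^ ⌊ n /2⌋ ≡ 2 ℕ.^ n
√q*√q≡q 0 _ = refl
√q*√q≡q 1 ()
√q*√q≡q (ℕ.suc (ℕ.suc n)) q%3≡1 =
  trans (quadruple (2 ℕ.^ ⌊ n /2⌋)) (cong (λ x → 2 ℕ.* (2 ℕ.* x)) (√q*√q≡q n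
    (trans (sym (trans (cong (ℕ._% 3) (split (2 ℕ.^ n))) ([m+kn]%n≡m%n (2 ℕ.^ n) (2 ℕ.^ n) 3))) q%3≡1)))
  where
  quadruple : ∀ x → (2 ℕ.* x) ℕ.* (2 ℕ.* x) ≡ 2 ℕ.* (2 ℕ.* (x ℕ.* x))
  quadruple = solve-∀
  split : ∀ x → 2 ℕ.* (2 ℕ.* x) ≡ x ℕ.+ x ℕ.* 3
  split = solve-∀

record FiniteField (c : Level) (q : ℕ) : Set (suc c) where
  infixl 7 _*_
  infixl 6 _+_
  infix  8 -_
  field
    Carrier           : Set c
    _+_ _*_           : Carrier → Carrier → Carrier
    -_                : Carrier → Carrier
    0# 1#             : Carrier
    isCommutativeRing : IsCommutativeRing _≡_ _+_ _*_ -_ 0# 1#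
    0≢1               : 0# ≢ 1#
    inverse           : ∀ x → x ≢ 0# → ∃[ y ] y * x ≡ 1#
    finite            : Carrier ↔ Fin q

  commutativeRing : CommutativeRing c c
  commutativeRing = record { isCommutativeRing = isCommutativeRing }

module Geometry {c : Level} {q : ℕ} (𝔽 : FiniteField c q) where

  open FiniteField 𝔽 using (Carrier; 0≢1; inverse; commutativeRing)
  open CommutativeRing commutativeRing
    using (_+_; _*_; 0#; 1#; semiring; *-assoc; *-comm; *-identityˡ; zeroˡ; zeroʳ)
  open RawSemiringDefinitions (Semiring.rawSemiring semiring) using (_^_)

  IsPrimitive : Carrier → Set c
  IsPrimitive ω = ω ≢ 0# × (∀ x → x ≢ 0# → ∃[ k ] x ≡ ω ^ k)

  infixr 7 _·_
  infixl 6 _⊕_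

  _·_ : ∀ {m} → Carrier → Vec Carrier m → Vec Carrier m
  s · v = map (s *_) v

  _⊕_ : ∀ {m} → Vec Carrier m → Vec Carrier m → Vec Carrier m
  _⊕_ = zipWith _+_

  𝟎 : ∀ {m} → Vec Carrier m
  𝟎 = replicate _ 0#

  Matrix : ℕ → ℕ → Set c
  Matrix k m = Vec (Vec Carrier m) k

  _*ᵥ_ : ∀ {k m} → Matrix k m → Vec Carrier m → Vec Carrier k
  M *ᵥ v = map (λ row → foldr′ _+_ 0# (zipWith _*_ row v)) M

  infix 4 _∼_

  -- Homogeneous coordinate vectors representing the same projective point.
  _∼_ : ∀ {m} → Vec Carrier m → Vec Carrier m → Set c
  u ∼ v = ∃[ s ] (s ≢ 0# × u ≡ s · v)

  private
    1·v≡v : ∀ {m} (v : Vec Carrier m) → 1# · v ≡ v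
    1·v≡v v = trans (map-cong *-identityˡ v) (map-id v)

    ·-assoc : ∀ {m} s t (v : Vec Carrier m) → s · t · v ≡ (s * t) · v
    ·-assoc s t v =
      trans (sym (map-∘ (s *_) (t *_) v)) (map-cong (λ x → sym (*-assoc s t x)) v)

    *≢0 : ∀ {s t} → s ≢ 0# → t ≢ 0# → s * t ≢ 0#
    *≢0 {s} {t} s≢0 t≢0 st≡0 with r , rs≡1 ← inverse s s≢0 = t≢0 (begin
      t            ≡⟨ *-identityˡ t ⟨
      1# * t       ≡⟨ cong (_* t) rs≡1 ⟨
      (r * s) * t  ≡⟨ *-assoc r s t ⟩
      r * (s * t)  ≡⟨ cong (r *_) st≡0 ⟩
      r * 0#       ≡⟨ zeroʳ r ⟩
      0#           ∎)
      where open ≡-Reasoning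

    inverse≢0 : ∀ {r s} → r * s ≡ 1# → r ≢ 0#
    inverse≢0 {s = s} rs≡1 refl = 0≢1 (trans (sym (zeroˡ s)) rs≡1)

  ∼-refl : ∀ {m} {u : Vec Carrier m} → u ∼ u
  ∼-refl {u = u} = 1# , (λ 1≡0 → 0≢1 (sym 1≡0)) , sym (1·v≡v u)

  ∼-sym : ∀ {m} {u v : Vec Carrier m} → u ∼ v → v ∼ u
  ∼-sym {v = v} (s , s≢0 , refl) with r , rs≡1 ← inverse s s≢0 =
    r , inverse≢0 rs≡1 ,
    sym (trans (·-assoc r s v) (trans (cong (_· v) rs≡1) (1·v≡v v)))

  ∼-trans : ∀ {m} {u v w : Vec Carrier m} → u ∼ v → v ∼ w → u ∼ w
  ∼-trans {w = w} (s , s≢0 , refl) (t , t≢0 , refl) =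
    s * t , *≢0 s≢0 t≢0 , ·-assoc s t w

  -- A point of PG(5,q), given by a representative; points are compared by _∼_.
  Point : Set c
  Point = Σ (Vec Carrier 6) λ v → v ≢ 𝟎

  coords : Point → Vec Carrier 6
  coords = proj₁

  vectorSetoid : Setoid c c
  vectorSetoid = record
    { Carrier       = Vec Carrier 6
    ; _≈_           = _∼_
    ; isEquivalence = record { refl = ∼-refl ; sym = ∼-sym ; trans = ∼-trans }
    }

  pointSetoid : Setoid c c
  pointSetoid = On.setoid vectorSetoid coords

  PointSet : Set (suc c)
  PointSet = Pred Point c

  -- Exactly k points, counted up to proportionality of representatives.
  HasSize : PointSet → ℕ → Set c
  HasSize S k = Bijection (setoid (Fin k)) (On.setoid pointSetoid (proj₁ {B = S}))

  HasSizeℚ : PointSet → ℚ → Set c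
  HasSizeℚ S r = ∃[ k ] (HasSize S k × (+ k) ℚ./ 1 ≡ r)

  record Line : Set c where
    field
      P Q : Point
      P≁Q : ¬ (coords P ∼ coords Q)

  pointsOf : Line → PointSet
  pointsOf ℓ X = ∃[ s ] ∃[ t ] coords X ≡ s · coords P ⊕ t · coords Q
    where open Line ℓ

  Π : PointSet
  Π ((_ ∷ _ ∷ X₃ ∷ X₄ ∷ _ ∷ _ ∷ []) , _) = X₃ + X₄ ≡ 0#

  𝓠⁺₅ : PointSet
  𝓠⁺₅ ((X₁ ∷ X₂ ∷ X₃ ∷ X₄ ∷ X₅ ∷ X₆ ∷ []) , _) =
    X₁ * X₆ + X₂ * X₅ + X₃ * X₄ ≡ 0#

  𝓠₄ : PointSet
  𝓠₄ = 𝓠⁺₅ ∩ Π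

  𝓨 : PointSet
  𝓨 X@((X₁ ∷ X₂ ∷ _ ∷ _ ∷ X₅ ∷ X₆ ∷ []) , _) =
    X ∈ Π × X₁ * X₅ ^ 2 + X₂ ^ 2 * X₆ ≡ 0#

  𝓛 : ℕ → Pred Line c
  𝓛 i ℓ = pointsOf ℓ ⊆ 𝓠₄ × HasSize (pointsOf ℓ ∩ 𝓨) i

  M̃ : (a b c d : Carrier) → Matrix 6 6
  M̃ a b c d =
    (a ^ 4         ∷ 0#    ∷ a ^ 2 * b ^ 2              ∷ a ^ 2 * b ^ 2              ∷ 0#    ∷ b ^ 4         ∷ []) ∷
    (0#            ∷ a ^ 2 ∷ a * b                      ∷ a * b                      ∷ b ^ 2 ∷ 0#            ∷ []) ∷
    (a ^ 2 * c ^ 2 ∷ a * c ∷ b ^ 2 * c ^ 2 + b * c + 1# ∷ b ^ 2 * c ^ 2 + b * c      ∷ b * d ∷ b ^ 2 * d ^ 2 ∷ []) ∷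
    (a ^ 2 * c ^ 2 ∷ a * c ∷ b ^ 2 * c ^ 2 + b * c      ∷ b ^ 2 * c ^ 2 + b * c + 1# ∷ b * d ∷ b ^ 2 * d ^ 2 ∷ []) ∷
    (0#            ∷ c ^ 2 ∷ c * d                      ∷ c * d                      ∷ d ^ 2 ∷ 0#            ∷ []) ∷
    (c ^ 4         ∷ 0#    ∷ c ^ 2 * d ^ 2              ∷ c ^ 2 * d ^ 2              ∷ 0#    ∷ d ^ 4         ∷ []) ∷
    []

  -- The orbit, under the projectivities M̃ a b c d with ad + bc = 1, of the
  -- point represented by a given vector.
  G̃₁-orbit : Vec Carrier 6 → PointSet
  G̃₁-orbit v X = ∃[ a ] ∃[ b ] ∃[ c ] ∃[ d ]
    (a * d + b * c ≡ 1# × coords X ∼ M̃ a b c d *ᵥ v)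

  U₁ U₅ : Vec Carrier 6
  U₁ = 1# ∷ 0# ∷ 0# ∷ 0# ∷ 0# ∷ 0# ∷ []
  U₅ = 0# ∷ 0# ∷ 0# ∷ 0# ∷ 1# ∷ 0# ∷ []

  R : Carrier → ℕ → Vec Carrier 6
  R ω i = U₁ ⊕ ω ^ (i ℕ.∸ 1) · U₅

  -- Only i = 1, 2, 3 are meaningful.
  𝓩 : Carrier → ℕ → PointSet
  𝓩 ω i = G̃₁-orbit (R ω i)

{-# OPTIONS --safe #-}
module Submission where

-- Let Φ(X) = X₁X₅² + X₂²X₆. On the quadric, Φ takes the value ω^(2(i-1)) on the orbit vectors of Rᵢ, and since every
-- element of 𝔽 is a square and a fourth power, 𝓩ᵢ consists of the points of 𝓠(4,q) for which ω^(i-1) Φ is a nonzero cube.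
-- The restriction of Φ to a line of the quadric is a binary cubic form whose discriminant is (p₁₆ p₂₅²)², where the
-- Plücker coordinates satisfy p₁₆ = p₂₅; its square root p₂₅³ is thus a cube. If such a form does not have exactly
-- one or two zeros, its Hessian splits by a counting form of Berlekamp's criterion, and the zeros of the Hessian give
-- coordinates in which the form is α s³ + β t³ with αβ a nonzero cube. There are three zeros if α is a cube, else none.
-- The points where k (α s³ + β t³) is a cube are then counted by the products S(kα) S(kβ), with S(k) = ∑ ψ(k y³) for the
-- canonical additive character ψ. One has S(k)² = 4q or q according as k is a cube or not, because y ↦ Tr(k y³) is a
-- quadratic form with a radical of order 4 or 1, and S(k) ≡ 1 mod 3 fixes the sign.

open import Defs
open import Algebra.Bundles using (CommutativeRing; RawRing)
import Algebra.Properties.CommutativeMonoid.Sum as MonoidSum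
import Algebra.Properties.Monoid.Mult as MonoidMult
import Algebra.Properties.Ring as RingProperties
import Algebra.Properties.Semiring.Exp as Exp
import Algebra.Properties.Semiring.Sum as SemiringSum
import Algebra.Solver.Ring as RingSolver
open import Algebra.Solver.Ring.AlmostCommutativeRing
  using (AlmostCommutativeRing; fromCommutativeRing; _-Raw-AlmostCommutative⟶_)
open import Data.Bool.Base using (Bool; true; false; _xor_; _∧_)
import Data.Bool.Properties as Bool
open import Data.Fin.Base as Fin using (Fin; zero; suc; toℕ)
open import Data.Fin.Permutation using (Permutation; permutation)
import Data.Fin.Properties as Fin
open import Data.Integer.Base as ℤ using (ℤ; +_; -1ℤ; 0ℤ; 1ℤ)
import Data.Integer.Properties as ℤ
import Data.Integer.Tactic.RingSolver as ℤ
open import Data.Maybe.Base using (Maybe; nothing; just)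
open import Data.Nat.Base as ℕ using (ℕ; _≤_; _^_; _%_; ⌊_/2⌋)
import Data.Nat.DivMod as ℕ
import Data.Nat.Properties as ℕ
open import Data.Product.Base using (Σ; ∃; ∃-syntax; _×_; _,_; proj₁; proj₂)
open import Data.Rational.Base as ℚ using ()
import Data.Rational.Properties as ℚ
import Data.Rational.Unnormalised.Base as ℚᵘ
open import Data.Sum.Base as Sum using (_⊎_; inj₁; inj₂)
open import Data.Vec.Base using (Vec; []; _∷_; head; tail)
open import Function.Base using (_∘_; id; case_of_)
open import Function.Bundles using (Bijection; Inverse)
open import Level using (Level)
open import Relation.Binary.PropositionalEquality
open import Relation.Nullary.Decidable using (Dec; yes; no; map′; ¬?; decidable-stable; _⊎-dec_)
open import Relation.Nullary.Negation using (¬_; contradiction)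
open import Relation.Unary using (_∈_; _∩_)

-- What turns character sums into counts is that S has only three values, one at 0, one on the
-- nonzero cubes and one elsewhere, so the indicator of the nonzero cubes is a combination of S, the
-- indicator of 0 and a constant. On a line only the single products S(kα) S(kβ) then occur, because
-- a diagonal form separates its variables; this is why a normal form is sought at all. That αβ is a
-- cube reduces the answer to whether α and k are cubes: if neither is, exactly one of kα, kβ is a
-- cube whichever nontrivial class contains k, so 𝓩₂ and 𝓩₃ meet the line equally often. The
-- condition q ≡ 1 (mod 3) gives a primitive cube root of unity ζ with ζ² + ζ = 1, so 1 has trace 0;
-- both the value of S(k)² and Berlekamp's criterion use this. The factor (-1)^(n/2) arises because
-- (-2)^(n/2) is the square root of q that is 1 modulo 3. No trace map is formed: the image of z² +
-- z takes the place of its kernel, and the index 2 of this image follows from a vanishing sum of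
-- nonnegative integers.

private
  module ℤ∑ = SemiringSum ℤ.+-*-semiring

-- Integer sums and indicators.

sum-single : ∀ {n} (t : Fin n → ℤ) j → (∀ i → i ≢ j → t i ≡ 0ℤ) → ℤ∑.sum t ≡ t j
sum-single {ℕ.suc n} t zero vanish =
  trans (cong (λ s → t zero ℤ.+ s)
          (trans (ℤ∑.sum-cong-≗ (λ i → vanish (suc i) λ ())) (ℤ∑.sum-replicate-zero n)))
        (ℤ.+-identityʳ _)
sum-single {ℕ.suc n} t (suc j) vanish =
  trans (cong₂ ℤ._+_ (vanish zero λ ())
          (sum-single (t ∘ suc) j (λ i i≢j → vanish (suc i) (i≢j ∘ Fin.suc-injective))))
        (ℤ.+-identityˡ _)

sum-nonNegative : ∀ {n} (t : Fin n → ℤ) → (∀ i → 0ℤ ℤ.≤ t i) → 0ℤ ℤ.≤ ℤ∑.sum t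
sum-nonNegative {ℕ.zero}  t 0≤t = ℤ.≤-refl
sum-nonNegative {ℕ.suc n} t 0≤t =
  ℤ.+-mono-≤ (0≤t zero) (sum-nonNegative (t ∘ suc) (0≤t ∘ suc))

+-nonNegative-≡0 : ∀ {i j} → 0ℤ ℤ.≤ i → 0ℤ ℤ.≤ j → i ℤ.+ j ≡ 0ℤ → i ≡ 0ℤ × j ≡ 0ℤ
+-nonNegative-≡0 {+ 0}        {+ 0} _ _ _ = refl , refl
+-nonNegative-≡0 {+ 0}        {+ ℕ.suc _} _ _ ()
+-nonNegative-≡0 {+ ℕ.suc _}  {+ _} _ _ ()
+-nonNegative-≡0 {ℤ.-[1+ _ ]} ()
+-nonNegative-≡0 {+ _}        {ℤ.-[1+ _ ]} _ ()

sum-nonNegative-≡0 : ∀ {n} (t : Fin n → ℤ) → (∀ i → 0ℤ ℤ.≤ t i) → ℤ∑.sum t ≡ 0ℤ → ∀ i → t i ≡ 0ℤ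
sum-nonNegative-≡0 t 0≤t ∑t≡0 zero =
  proj₁ (+-nonNegative-≡0 (0≤t zero) (sum-nonNegative (t ∘ suc) (0≤t ∘ suc)) ∑t≡0)
sum-nonNegative-≡0 t 0≤t ∑t≡0 (suc i) =
  sum-nonNegative-≡0 (t ∘ suc) (0≤t ∘ suc)
    (proj₂ (+-nonNegative-≡0 (0≤t zero) (sum-nonNegative (t ∘ suc) (0≤t ∘ suc)) ∑t≡0)) i

-- Integer-valued, so that counts of points and character sums can occur in one equation.
𝟙 : ∀ {a} {A : Set a} → Dec A → ℤ
𝟙 (yes _) = 1ℤ
𝟙 (no  _) = 0ℤ

𝟙-yes : ∀ {a} {A : Set a} (A? : Dec A) → A → 𝟙 A? ≡ 1ℤ
𝟙-yes (yes _) _ = refl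
𝟙-yes (no ¬a) a = contradiction a ¬a

𝟙-no : ∀ {a} {A : Set a} (A? : Dec A) → ¬ A → 𝟙 A? ≡ 0ℤ
𝟙-no (yes a) ¬a = contradiction a ¬a
𝟙-no (no _)  _  = refl

𝟙-cong : ∀ {a b} {A : Set a} {B : Set b} (A? : Dec A) (B? : Dec B) → (A → B) → (B → A) → 𝟙 A? ≡ 𝟙 B?
𝟙-cong (yes a) B? f g = sym (𝟙-yes B? (f a))
𝟙-cong (no ¬a) B? f g = sym (𝟙-no B? (¬a ∘ g))

-- Sums and inverses in a finite field.

module Finite {c : Level} {q : ℕ} (𝔽 : FiniteField c q) where

  open FiniteField 𝔽 using (Carrier; finite; 0≢1; inverse; commutativeRing)
  open CommutativeRing commutativeRing public
    using (_+_; _*_; 0#; 1#; ring; +-commutativeMonoid; *-assoc; *-comm; *-identityˡ; *-identityʳ; zeroˡ; zeroʳ; +-assoc; +-identityˡ; +-identityʳ)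

  idx : Carrier → Fin q
  idx = Inverse.to finite

  elt : Fin q → Carrier
  elt = Inverse.from finite

  elt-idx : ∀ x → elt (idx x) ≡ x
  elt-idx = Inverse.strictlyInverseʳ finite

  idx-elt : ∀ i → idx (elt i) ≡ i
  idx-elt = Inverse.strictlyInverseˡ finite

  idx-injective : ∀ {x y} → idx x ≡ idx y → x ≡ y
  idx-injective {x} {y} eq = trans (sym (elt-idx x)) (trans (cong elt eq) (elt-idx y))

  elt-injective : ∀ {i j} → elt i ≡ elt j → i ≡ j
  elt-injective {i} {j} eq = trans (sym (idx-elt i)) (trans (cong idx eq) (idx-elt j))

  infix 4 _≟_
  _≟_ : (x y : Carrier) → Dec (x ≡ y)
  x ≟ y = map′ idx-injective (cong idx) (idx x Fin.≟ idx y)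

  search : ∀ {p} {P : Carrier → Set p} → (∀ x → Dec (P x)) → Dec (∃ P)
  search {P = P} P? =
    map′ (λ (i , Pi) → elt i , Pi) (λ (x , Px) → idx x , subst P (sym (elt-idx x)) Px)
         (Fin.any? (P? ∘ elt))

  -- A missed value y, placed before the q values of f, would give an injection from q + 1 elements
  -- into q.
  injective⇒surjective : (f : Carrier → Carrier) → (∀ {x y} → f x ≡ f y → x ≡ y) →
                         ∀ y → ∃[ x ] f x ≡ y
  injective⇒surjective f f-injective y with search (λ x → f x ≟ y)
  ... | yes found = found
  ... | no  avoid = contradiction (Fin.injective⇒≤ g-injective) ℕ.1+n≰n
    where
    g : Fin (ℕ.suc q) → Fin q
    g zero    = idx y
    g (suc i) = idx (f (elt i))
    g-injective : ∀ {i j} → g i ≡ g j → i ≡ j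
    g-injective {zero}  {zero}  _  = refl
    g-injective {zero}  {suc j} eq = contradiction (elt j , sym (idx-injective eq)) avoid
    g-injective {suc i} {zero}  eq = contradiction (elt i , idx-injective eq) avoid
    g-injective {suc i} {suc j} eq = cong suc (elt-injective (f-injective (idx-injective eq)))

  -- A section of f is injective, hence surjective by `injective⇒surjective`; so every x is a value
  -- of the section, which makes the section a left inverse of f as well.
  surjective⇒injective : (f : Carrier → Carrier) → (∀ y → ∃[ x ] f x ≡ y) →
                         ∀ {x y} → f x ≡ f y → x ≡ y
  surjective⇒injective f f-surjective {x} {y} fx≡fy =
    trans (sym (section-f x)) (trans (cong section fx≡fy) (section-f y))
    where
    section : Carrier → Carrier
    section y = proj₁ (f-surjective y)
    f-section : ∀ y → f (section y) ≡ y
    f-section y = proj₂ (f-surjective y)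
    section-f : ∀ x → section (f x) ≡ x
    section-f x with injective⇒surjective section
      (λ {a} {b} eq → trans (sym (f-section a)) (trans (cong f eq) (f-section b))) x
    ... | a , refl = cong section (f-section a)

  reindexing : (f g : Carrier → Carrier) → (∀ x → g (f x) ≡ x) → (∀ x → f (g x) ≡ x) → Permutation q q
  reindexing f g gf fg = permutation (idx ∘ f ∘ elt) (idx ∘ g ∘ elt) (inverts f g fg) (inverts g f gf)
    where
    inverts : ∀ (f g : Carrier → Carrier) → (∀ x → f (g x) ≡ x) → ∀ i → idx (f (elt (idx (g (elt i))))) ≡ i
    inverts f g fg i = trans (cong (idx ∘ f) (elt-idx _)) (trans (cong idx (fg (elt i))) (idx-elt i))

  -- Outside this block the sum is known only through the laws proved here; `∑≡sum` leads back to
  -- indices when points of a line are enumerated.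
  opaque
    ∑ : (Carrier → ℤ) → ℤ
    ∑ g = ℤ∑.sum (g ∘ elt)

    ∑≡sum : ∀ g → ∑ g ≡ ℤ∑.sum (g ∘ elt)
    ∑≡sum g = refl

    ∑-cong : ∀ {g h : Carrier → ℤ} → (∀ x → g x ≡ h x) → ∑ g ≡ ∑ h
    ∑-cong g≗h = ℤ∑.sum-cong-≗ {q} (g≗h ∘ elt)

    ∑-distrib-+ : ∀ (g h : Carrier → ℤ) → ∑ (λ x → g x ℤ.+ h x) ≡ ∑ g ℤ.+ ∑ h
    ∑-distrib-+ g h = ℤ∑.∑-distrib-+ (g ∘ elt) (h ∘ elt)

    *-distribˡ-∑ : ∀ k (g : Carrier → ℤ) → k ℤ.* ∑ g ≡ ∑ (λ x → k ℤ.* g x)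
    *-distribˡ-∑ k g = ℤ∑.*-distribˡ-sum k (g ∘ elt)

    *-distribʳ-∑ : ∀ k (g : Carrier → ℤ) → ∑ g ℤ.* k ≡ ∑ (λ x → g x ℤ.* k)
    *-distribʳ-∑ k g = ℤ∑.*-distribʳ-sum k (g ∘ elt)

    ∑-swap : (g : Carrier → Carrier → ℤ) → ∑ (λ x → ∑ (g x)) ≡ ∑ (λ y → ∑ (λ x → g x y))
    ∑-swap g = ℤ∑.∑-comm (λ i j → g (elt i) (elt j))

    ∑-reindex : (f g : Carrier → Carrier) → (∀ x → g (f x) ≡ x) → (∀ x → f (g x) ≡ x) →
                (h : Carrier → ℤ) → ∑ h ≡ ∑ (h ∘ f)
    ∑-reindex f g gf fg h =
      trans (ℤ∑.sum-permute (h ∘ elt) (reindexing f g gf fg))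
            (ℤ∑.sum-cong-≗ {q} (λ i → cong h (elt-idx (f (elt i)))))

    ∑-single : (g : Carrier → ℤ) → ∀ a → (∀ x → x ≢ a → g x ≡ 0ℤ) → ∑ g ≡ g a
    ∑-single g a vanish =
      trans (sum-single (g ∘ elt) (idx a) (λ i i≢a → vanish (elt i)
              (λ eq → i≢a (trans (sym (idx-elt i)) (cong idx eq)))))
            (cong g (elt-idx a))

    ∑-const : ∀ k → ∑ (λ _ → k) ≡ + q ℤ.* k
    ∑-const k = go q
      where
      go : ∀ m → ℤ∑.sum {m} (λ _ → k) ≡ + m ℤ.* k
      go ℕ.zero    = refl
      go (ℕ.suc m) = trans (cong (λ s → k ℤ.+ s) (go m)) (sym (ℤ.suc-* (+ m) k))

    ∑-nonNegative-≡0 : (g : Carrier → ℤ) → (∀ x → 0ℤ ℤ.≤ g x) → ∑ g ≡ 0ℤ → ∀ x → g x ≡ 0ℤ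
    ∑-nonNegative-≡0 g 0≤g ∑g≡0 x =
      trans (cong g (sym (elt-idx x))) (sum-nonNegative-≡0 (g ∘ elt) (0≤g ∘ elt) ∑g≡0 (idx x))

  ∑-𝟙≟ : ∀ a → ∑ (λ x → 𝟙 (x ≟ a)) ≡ 1ℤ
  ∑-𝟙≟ a = trans (∑-single _ a (λ x x≢a → 𝟙-no (x ≟ a) x≢a)) (𝟙-yes (a ≟ a) refl)

  -- Made total by 0⁻¹ = 0, so that quotients such as A/r² can be written before r is known to be
  -- nonzero.
  infix 9 _⁻¹
  _⁻¹ : Carrier → Carrier
  x ⁻¹ with x ≟ 0#
  ... | yes _   = 0#
  ... | no  x≢0 = proj₁ (inverse x x≢0)

  ⁻¹-inverseʳ : ∀ {x} → x ≢ 0# → x * x ⁻¹ ≡ 1#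
  ⁻¹-inverseʳ {x} x≢0 with x ≟ 0#
  ... | yes x≡0  = contradiction x≡0 x≢0
  ... | no  x≢0′ = trans (*-comm x _) (proj₂ (inverse x x≢0′))

  a*b≡1⇒a*[b*x]≡x : ∀ {a b} → a * b ≡ 1# → ∀ x → a * (b * x) ≡ x
  a*b≡1⇒a*[b*x]≡x {a} {b} ab≡1 x = trans (sym (*-assoc a b x)) (trans (cong (_* x) ab≡1) (*-identityˡ x))

  1≢0 : 1# ≢ 0#
  1≢0 = 0≢1 ∘ sym

  unit≢0 : ∀ {x y} → x * y ≡ 1# → x ≢ 0#
  unit≢0 {y = y} xy≡1 refl = 0≢1 (trans (sym (zeroˡ y)) xy≡1)

  ⁻¹≢0 : ∀ {x} → x ≢ 0# → x ⁻¹ ≢ 0#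
  ⁻¹≢0 {x} x≢0 = unit≢0 (trans (*-comm (x ⁻¹) x) (⁻¹-inverseʳ x≢0))

  0⁻¹≡0 : 0# ⁻¹ ≡ 0#
  0⁻¹≡0 with 0# ≟ 0#
  ... | yes _   = refl
  ... | no  0≢0 = contradiction refl 0≢0

  *-cancelˡ : ∀ {x y z} → x ≢ 0# → x * y ≡ x * z → y ≡ z
  *-cancelˡ {x} {y} {z} x≢0 xy≡xz = trans (sym (undo y)) (trans (cong (_*_ (x ⁻¹)) xy≡xz) (undo z))
    where
    undo : ∀ w → x ⁻¹ * (x * w) ≡ w
    undo = a*b≡1⇒a*[b*x]≡x (trans (*-comm (x ⁻¹) x) (⁻¹-inverseʳ x≢0))

  x*y≡0⇒x≡0⊎y≡0 : ∀ {x y} → x * y ≡ 0# → x ≡ 0# ⊎ y ≡ 0#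
  x*y≡0⇒x≡0⊎y≡0 {x} {y} xy≡0 with x ≟ 0#
  ... | yes x≡0 = inj₁ x≡0
  ... | no  x≢0 = inj₂ (*-cancelˡ x≢0 (trans xy≡0 (sym (zeroʳ x))))

  *≢0 : ∀ {x y} → x ≢ 0# → y ≢ 0# → x * y ≢ 0#
  *≢0 x≢0 y≢0 xy≡0 with x*y≡0⇒x≡0⊎y≡0 xy≡0
  ... | inj₁ x≡0 = x≢0 x≡0
  ... | inj₂ y≡0 = y≢0 y≡0

-- Fields of order 2^n: characteristic and square roots.

module Characteristic₂ {c : Level} (n : ℕ) (𝔽 : FiniteField c (2 ℕ.^ n)) where

  open FiniteField 𝔽 using (Carrier; commutativeRing)
  open Finite 𝔽 public
  private
    module F∑ = MonoidSum +-commutativeMonoid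
    open MonoidMult (CommutativeRing.+-monoid commutativeRing) using (×-homo-+) renaming (_×_ to _×#_)
    open RingProperties ring using (+-cancelˡ)

  -- Translation by 1 permutes the field, so summing all elements gives q · 1 = 0.
  q×1≡0 : (2 ℕ.^ n) ×# 1# ≡ 0#
  q×1≡0 = +-cancelˡ (F∑.sum elt) _ _ (begin
    F∑.sum elt + (2 ℕ.^ n) ×# 1#           ≡⟨ cong (_+_ (F∑.sum elt)) (F∑.sum-replicate (2 ℕ.^ n)) ⟨
    F∑.sum elt + F∑.sum {2 ℕ.^ n} (λ _ → 1#) ≡⟨ F∑.∑-distrib-+ elt (λ _ → 1#) ⟨
    F∑.sum (λ i → elt i + 1#)              ≡⟨ F∑.sum-cong-≗ {2 ℕ.^ n} (λ i → elt-idx (elt i + 1#)) ⟨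
    F∑.sum (λ i → elt (idx (elt i + 1#)))  ≡⟨ F∑.sum-permute elt translation ⟨
    F∑.sum elt                             ≡⟨ +-identityʳ _ ⟨
    F∑.sum elt + 0#                        ∎)
    where
    open ≡-Reasoning
    translation : Permutation (2 ℕ.^ n) (2 ℕ.^ n)
    translation = reindexing (_+ 1#) (_+ CommutativeRing.-_ commutativeRing 1#)
      (λ x → trans (+-assoc x _ _) (trans (cong (_+_ x) (CommutativeRing.-‿inverseʳ commutativeRing 1#)) (+-identityʳ x)))
      (λ x → trans (+-assoc x _ _) (trans (cong (_+_ x) (CommutativeRing.-‿inverseˡ commutativeRing 1#)) (+-identityʳ x)))

  -- In a domain 2^k · 1 = 0 yields 1 + 1 = 0 or 2^(k-1) · 1 = 0; stripping factors must stop before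
  -- k = 0, where the equation would read 1 = 0.
  1+1≡0 : 1# + 1# ≡ 0#
  1+1≡0 = go n q×1≡0
    where
    go : ∀ k → (2 ℕ.^ k) ×# 1# ≡ 0# → 1# + 1# ≡ 0#
    go ℕ.zero    eq = contradiction (trans (sym (+-identityʳ 1#)) eq) 1≢0
    go (ℕ.suc k) eq with x*y≡0⇒x≡0⊎y≡0 (trans (sym doubling) eq)
      where
      m = 2 ℕ.^ k
      doubling : (2 ℕ.* m) ×# 1# ≡ (1# + 1#) * (m ×# 1#)
      doubling = begin
        (m ℕ.+ (m ℕ.+ 0)) ×# 1#        ≡⟨ cong (λ j → (m ℕ.+ j) ×# 1#) (ℕ.+-identityʳ m) ⟩
        (m ℕ.+ m) ×# 1#                ≡⟨ ×-homo-+ 1# m m ⟩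
        m ×# 1# + m ×# 1#              ≡⟨ cong₂ _+_ (*-identityˡ _) (*-identityˡ _) ⟨
        1# * (m ×# 1#) + 1# * (m ×# 1#) ≡⟨ CommutativeRing.distribʳ commutativeRing _ 1# 1# ⟨
        (1# + 1#) * (m ×# 1#)          ∎
        where open ≡-Reasoning
    ... | inj₁ 1+1≡0 = 1+1≡0
    ... | inj₂ m×1≡0 = go k m×1≡0

  x+x≡0 : ∀ x → x + x ≡ 0#
  x+x≡0 x = begin
    x + x            ≡⟨ cong₂ _+_ (*-identityˡ x) (*-identityˡ x) ⟨
    1# * x + 1# * x  ≡⟨ CommutativeRing.distribʳ commutativeRing x 1# 1# ⟨
    (1# + 1#) * x    ≡⟨ cong (_* x) 1+1≡0 ⟩
    0# * x           ≡⟨ zeroˡ x ⟩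
    0#               ∎
    where open ≡-Reasoning

  private
    almostRing : AlmostCommutativeRing c c
    almostRing = fromCommutativeRing commutativeRing

    𝔽₂ : RawRing _ _
    𝔽₂ = record { Carrier = Bool ; _≈_ = _≡_ ; _+_ = _xor_ ; _*_ = _∧_ ; -_ = id ; 0# = false ; 1# = true }

    bit : Bool → Carrier
    bit false = 0#
    bit true  = 1#

    prime-field : 𝔽₂ -Raw-AlmostCommutative⟶ almostRing
    prime-field = record
      { ⟦_⟧    = bit
      ; +-homo = λ { false y → sym (+-identityˡ _) ; true false → sym (+-identityʳ 1#) ; true true → sym 1+1≡0 }
      ; *-homo = λ { false y → sym (zeroˡ _) ; true y → sym (*-identityˡ _) }
      ; -‿homo = λ { false → sym (RingProperties.-0#≈0# ring) ; true → RingProperties.+-inverseˡ-unique ring 1# 1# 1+1≡0 }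
      ; 0-homo = refl
      ; 1-homo = refl
      }

    bit≟ : ∀ x y → Maybe (bit x ≡ bit y)
    bit≟ x y with x Bool.≟ y
    ... | yes x≡y = just (cong bit x≡y)
    ... | no  _   = nothing

  -- Taking coefficients in 𝔽₂ makes the ring solver normalise modulo 2.
  module Solver₂ = RingSolver 𝔽₂ almostRing prime-field bit≟

  open Solver₂ using (solve; _:=_; _:+_; _:*_; con)

  x+y≡0⇒x≡y : ∀ {x y} → x + y ≡ 0# → x ≡ y
  x+y≡0⇒x≡y {x} {y} x+y≡0 =
    trans (solve 2 (λ x y → x := (x :+ y) :+ y) refl x y) (trans (cong (_+ y) x+y≡0) (+-identityˡ y))

  square-injective : ∀ {x y} → x * x ≡ y * y → x ≡ y
  square-injective {x} {y} eq with x*y≡0⇒x≡0⊎y≡0 (trans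
      (solve 2 (λ x y → (x :+ y) :* (x :+ y) := x :* x :+ y :* y) refl x y)
      (trans (cong (_+ y * y) eq) (x+x≡0 (y * y))))
  ... | inj₁ x+y≡0 = x+y≡0⇒x≡y x+y≡0
  ... | inj₂ x+y≡0 = x+y≡0⇒x≡y x+y≡0

  -- Squaring is additive in characteristic 2 with trivial kernel, hence a permutation, and square
  -- roots exist and are unique.
  √ : Carrier → Carrier
  √ x = proj₁ (injective⇒surjective (λ y → y * y) square-injective x)

  √-square : ∀ x → √ x * √ x ≡ x
  √-square x = proj₂ (injective⇒surjective (λ y → y * y) square-injective x)

-- The order of a primitive element and the cube roots of unity.

module Primitive {c : Level} {q : ℕ} (𝔽 : FiniteField c q) (ω : FiniteField.Carrier 𝔽) (ω-primitive : Geometry.IsPrimitive 𝔽 ω) where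

  open FiniteField 𝔽 using (Carrier; commutativeRing)
  open Finite 𝔽
  open Exp (CommutativeRing.semiring commutativeRing) using (^-homo-*; ^-assocʳ) renaming (_^_ to _↑_)

  ω^k≢0 : ∀ k → ω ↑ k ≢ 0#
  ω^k≢0 ℕ.zero    = 1≢0
  ω^k≢0 (ℕ.suc k) = *≢0 (proj₁ ω-primitive) (ω^k≢0 k)

  1^k≡1 : ∀ k → 1# ↑ k ≡ 1#
  1^k≡1 ℕ.zero    = refl
  1^k≡1 (ℕ.suc k) = trans (*-identityˡ _) (1^k≡1 k)

  -- If ω^e = 1, then 0 and the powers with exponent below e already exhaust the field.
  q≤1+exponent : ∀ e .{{_ : ℕ.NonZero e}} → ω ↑ e ≡ 1# → q ℕ.≤ ℕ.suc e
  q≤1+exponent e ω^e≡1 = Fin.injective⇒≤ {f = encode ∘ elt}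
    λ eq → elt-injective (trans (sym (decode-encode _)) (trans (cong decode eq) (decode-encode _)))
    where
    encode : Carrier → Fin (ℕ.suc e)
    encode x with x ≟ 0#
    ... | yes _   = zero
    ... | no  x≢0 = suc (proj₁ (proj₂ ω-primitive x x≢0) ℕ.mod e)

    decode : Fin (ℕ.suc e) → Carrier
    decode zero    = 0#
    decode (suc i) = ω ↑ toℕ i

    ω^[k%e]≡ω^k : ∀ k → ω ↑ (k ℕ.% e) ≡ ω ↑ k
    ω^[k%e]≡ω^k k = sym (begin
      ω ↑ k                                        ≡⟨ cong (_↑_ ω) (ℕ.m≡m%n+[m/n]*n k e) ⟩
      ω ↑ (k ℕ.% e ℕ.+ k ℕ./ e ℕ.* e)              ≡⟨ ^-homo-* ω (k ℕ.% e) _ ⟩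
      ω ↑ (k ℕ.% e) * ω ↑ (k ℕ./ e ℕ.* e)          ≡⟨ cong (λ j → ω ↑ (k ℕ.% e) * ω ↑ j) (ℕ.*-comm (k ℕ./ e) e) ⟩
      ω ↑ (k ℕ.% e) * ω ↑ (e ℕ.* (k ℕ./ e))        ≡⟨ cong (_*_ (ω ↑ (k ℕ.% e))) (^-assocʳ ω e (k ℕ./ e)) ⟨
      ω ↑ (k ℕ.% e) * (ω ↑ e) ↑ (k ℕ./ e)          ≡⟨ cong (λ y → ω ↑ (k ℕ.% e) * y ↑ (k ℕ./ e)) ω^e≡1 ⟩
      ω ↑ (k ℕ.% e) * 1# ↑ (k ℕ./ e)               ≡⟨ cong (_*_ (ω ↑ (k ℕ.% e))) (1^k≡1 (k ℕ./ e)) ⟩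
      ω ↑ (k ℕ.% e) * 1#                           ≡⟨ *-identityʳ _ ⟩
      ω ↑ (k ℕ.% e)                                ∎)
      where open ≡-Reasoning

    decode-encode : ∀ x → decode (encode x) ≡ x
    decode-encode x with x ≟ 0#
    ... | yes x≡0 = sym x≡0
    ... | no  x≢0 with k , x≡ω^k ← proj₂ ω-primitive x x≢0 =
      trans (cong (_↑_ ω) (Fin.toℕ-fromℕ< (ℕ.m%n<n k e))) (trans (ω^[k%e]≡ω^k k) (sym x≡ω^k))

  -- Among the q + 1 entries 0, ω^0, ..., ω^(q-1) two coincide, and 0 is not one of them. Listing 0
  -- as well lets the exponents stop at q - 1, which gives the sharp bound e ≤ q - 1.
  ω^j≡1 : ∃[ e ] (ℕ.NonZero e × ℕ.suc e ℕ.≤ q × ω ↑ e ≡ 1#)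
  ω^j≡1 with Fin.pigeonhole (ℕ.n<1+n q) h
    where
    h : Fin (ℕ.suc q) → Fin q
    h zero    = idx 0#
    h (suc i) = idx (ω ↑ toℕ i)
  ... | zero  , suc j , _   , eq = contradiction (sym (idx-injective eq)) (ω^k≢0 (toℕ j))
  ... | suc i , suc j , ℕ.s<s i<j , eq =
      toℕ j ℕ.∸ toℕ i , ℕ.>-nonZero (ℕ.m<n⇒0<n∸m i<j) ,
      ℕ.≤-trans (ℕ.s≤s (ℕ.m∸n≤m (toℕ j) (toℕ i))) (Fin.toℕ<n j) ,
      *-cancelˡ (ω^k≢0 (toℕ i)) (begin
        ω ↑ toℕ i * ω ↑ (toℕ j ℕ.∸ toℕ i)  ≡⟨ ^-homo-* ω (toℕ i) _ ⟨
        ω ↑ (toℕ i ℕ.+ (toℕ j ℕ.∸ toℕ i))  ≡⟨ cong (_↑_ ω) (ℕ.m+[n∸m]≡n (ℕ.<⇒≤ i<j)) ⟩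
        ω ↑ toℕ j                          ≡⟨ idx-injective eq ⟨
        ω ↑ toℕ i                          ≡⟨ *-identityʳ _ ⟨
        ω ↑ toℕ i * 1#                     ∎)
    where open ≡-Reasoning

  -- The bounds of `ω^j≡1` and `q≤1+exponent` force e = q - 1 = 3m, and ω^m serves as z. If ω^m were
  -- 1, the second bound at the exponent m would give 3m + 1 ≤ m + 1.
  cubeRootOfUnity : q ℕ.% 3 ≡ 1 → ∃[ z ] (z ≢ 1# × z * (z * z) ≡ 1#)
  cubeRootOfUnity q%3≡1 with e , e≢0 , e<q , ω^e≡1 ← ω^j≡1 =
    ω ↑ m , ω^m≢1 , (begin
      ω ↑ m * (ω ↑ m * ω ↑ m)         ≡⟨ cong (λ y → ω ↑ m * (ω ↑ m * y)) (*-identityʳ _) ⟨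
      (ω ↑ m) ↑ 3                     ≡⟨ ^-assocʳ ω m 3 ⟩
      ω ↑ (m ℕ.* 3)                   ≡⟨ cong (_↑_ ω) e≡m*3 ⟨
      ω ↑ e                           ≡⟨ ω^e≡1 ⟩
      1#                              ∎)
    where
    open ≡-Reasoning
    m = q ℕ./ 3
    q≡1+m*3 : q ≡ ℕ.suc (m ℕ.* 3)
    q≡1+m*3 = trans (ℕ.m≡m%n+[m/n]*n q 3) (cong (ℕ._+ m ℕ.* 3) q%3≡1)
    e≡m*3 : e ≡ m ℕ.* 3
    e≡m*3 = ℕ.suc-injective (trans (ℕ.≤-antisym e<q (q≤1+exponent e {{e≢0}} ω^e≡1)) q≡1+m*3)
    ω^m≢1 : ω ↑ m ≢ 1#
    ω^m≢1 ω^m≡1 with m | e≡m*3 | q≡1+m*3 | q≤1+exponent m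
    ... | ℕ.zero  | e≡0 | _ | _ = contradiction e≡0 (ℕ.≢-nonZero⁻¹ e {{e≢0}})
    ... | ℕ.suc k | _ | q≡ | bound =
      ℕ.<⇒≱ (ℕ.m<m*n (ℕ.suc k) 3 (ℕ.s≤s (ℕ.s≤s ℕ.z≤n)))
            (ℕ.≤-pred (subst (ℕ._≤ _) q≡ (bound ω^m≡1)))

-- The additive character and the nonzero cubes.

module Character {c : Level} (n : ℕ) (𝔽 : FiniteField c (2 ℕ.^ n)) where

  open FiniteField 𝔽 using (Carrier; commutativeRing)
  open Characteristic₂ n 𝔽 public
  open Solver₂ using (solve; _:=_; _:+_; _:*_; con)

  private
    q : ℕ
    q = 2 ℕ.^ n

  -- Splits one element y off a set; iterated, it counts the fibres of z² + z and of cubing, which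
  -- have explicit elements.
  ∑-𝟙-insert : ∀ {a b} {A : Carrier → Set a} {B : Carrier → Set b}
               (A? : ∀ x → Dec (A x)) (B? : ∀ x → Dec (B x)) (y : Carrier) →
               (∀ {x} → A x → x ≡ y ⊎ B x) → A y → (∀ {x} → B x → A x) → ¬ B y →
               ∑ (λ x → 𝟙 (A? x)) ≡ 1ℤ ℤ.+ ∑ (λ x → 𝟙 (B? x))
  ∑-𝟙-insert {A = A} A? B? y split Ay B⇒A ¬By = trans (∑-cong pointwise)
    (trans (∑-distrib-+ _ _) (cong (λ s → s ℤ.+ ∑ (λ x → 𝟙 (B? x))) (∑-𝟙≟ y)))
    where
    pointwise : ∀ x → 𝟙 (A? x) ≡ 𝟙 (x ≟ y) ℤ.+ 𝟙 (B? x)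
    pointwise x with x ≟ y
    ... | yes refl = trans (𝟙-yes (A? x) Ay) (cong (λ s → 1ℤ ℤ.+ s) (sym (𝟙-no (B? x) ¬By)))
    ... | no  x≢y  = trans (𝟙-cong (A? x) (B? x)
      (λ Ax → case split Ax of λ { (inj₁ x≡y) → contradiction x≡y x≢y ; (inj₂ Bx) → Bx }) B⇒A)
      (sym (ℤ.+-identityˡ _))

  ∑-zero : ∀ {g : Carrier → ℤ} → (∀ x → g x ≡ 0ℤ) → ∑ g ≡ 0ℤ
  ∑-zero g≗0 = trans (∑-cong g≗0) (trans (∑-const 0ℤ) (ℤ.*-zeroʳ (ℤ.+ q)))

  ℘ : Carrier → Carrier
  ℘ z = z * z + z

  ℘-+ : ∀ x y → ℘ (x + y) ≡ ℘ x + ℘ y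
  ℘-+ = solve 2 (λ x y → (x :+ y) :* (x :+ y) :+ (x :+ y) := (x :* x :+ x) :+ (y :* y :+ y)) refl

  Image℘ : Carrier → Set c
  Image℘ x = ∃[ z ] ℘ z ≡ x

  image℘? : ∀ x → Dec (Image℘ x)
  image℘? x = search (λ z → ℘ z ≟ x)

  Image℘-+ : ∀ {x y} → Image℘ x → Image℘ y → Image℘ (x + y)
  Image℘-+ (u , ℘u≡x) (v , ℘v≡y) = u + v , trans (℘-+ u v) (cong₂ _+_ ℘u≡x ℘v≡y)

  -- From z³ + 1 = (z + 1)(z² + z + 1). The conclusion says that 1 has trace 0.
  cubeRoot⇒℘≡1 : ∀ {z} → z ≢ 1# → z * (z * z) ≡ 1# → ℘ z ≡ 1#
  cubeRoot⇒℘≡1 {z} z≢1 z³≡1 with x*y≡0⇒x≡0⊎y≡0 {z + 1#} {℘ z + 1#} (trans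
      (solve 1 (λ z → (z :+ con true) :* (z :* z :+ z :+ con true) := z :* (z :* z) :+ con true) refl z)
      (trans (cong (_+ 1#) z³≡1) 1+1≡0))
  ... | inj₁ z+1≡0  = contradiction (x+y≡0⇒x≡y z+1≡0) z≢1
  ... | inj₂ ℘z+1≡0 = x+y≡0⇒x≡y ℘z+1≡0

  x+[x+y]≡y : ∀ x y → x + (x + y) ≡ y
  x+[x+y]≡y = solve 2 (λ x y → x :+ (x :+ y) := y) refl

  [x+y]+y≡x : ∀ x y → (x + y) + y ≡ x
  [x+y]+y≡x = solve 2 (λ x y → (x :+ y) :+ y := x) refl

  -- ℘ is additive with kernel 0, 1: its value at u + v factors as (u + v)(u + v + 1).
  ℘-fibre : ∀ {u v} → ℘ u ≡ ℘ v → u ≡ v ⊎ u ≡ v + 1#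
  ℘-fibre {u} {v} ℘u≡℘v with x*y≡0⇒x≡0⊎y≡0 (begin
      (u + v) * (u + v + 1#)
        ≡⟨ solve 2 (λ u v → (u :+ v) :* (u :+ v :+ con true) := (u :* u :+ u) :+ (v :* v :+ v)) refl u v ⟩
      ℘ u + ℘ v  ≡⟨ cong (_+ ℘ v) ℘u≡℘v ⟩
      ℘ v + ℘ v  ≡⟨ x+x≡0 (℘ v) ⟩
      0#         ∎)
    where open ≡-Reasoning
  ... | inj₁ u+v≡0   = inj₁ (x+y≡0⇒x≡y u+v≡0)
  ... | inj₂ u+v+1≡0 = inj₂ (x+y≡0⇒x≡y (trans (sym (+-assoc u v 1#)) u+v+1≡0))

  x≢x+1 : ∀ x → x ≢ x + 1#
  x≢x+1 x x≡x+1 = 1≢0 (trans (sym (x+[x+y]≡y x 1#)) (trans (cong (_+_ x) (sym x≡x+1)) (x+x≡0 x)))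

  -- The canonical additive character (-1)^Tr(x): by Artin–Schreier, Tr x = 0 iff x ∈ Image℘.
  ψ : Carrier → ℤ
  ψ x with image℘? x
  ... | yes _ = 1ℤ
  ... | no  _ = -1ℤ

  ψ-image : ∀ {x} → Image℘ x → ψ x ≡ 1ℤ
  ψ-image {x} x∈ with image℘? x
  ... | yes _  = refl
  ... | no  x∉ = contradiction x∈ x∉

  ψ-nonimage : ∀ {x} → ¬ Image℘ x → ψ x ≡ -1ℤ
  ψ-nonimage {x} x∉ with image℘? x
  ... | yes x∈ = contradiction x∈ x∉
  ... | no  _  = refl

  fibreSize : Carrier → ℤ
  fibreSize x = ∑ (λ z → 𝟙 (℘ z ≟ x))

  fibreSize≡1+ψ : ∀ x → fibreSize x ≡ 1ℤ ℤ.+ ψ x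
  fibreSize≡1+ψ x with image℘? x
  ... | no  x∉ = ∑-zero (λ z → 𝟙-no (℘ z ≟ x) (λ ℘z≡x → x∉ (z , ℘z≡x)))
  ... | yes (u , ℘u≡x) = trans
    (∑-𝟙-insert (λ z → ℘ z ≟ x) (_≟ u + 1#) u (λ ℘z≡x → ℘-fibre (trans ℘z≡x (sym ℘u≡x))) ℘u≡x
      (λ { refl → trans (solve 1 (λ u → (u :+ con true) :* (u :+ con true) :+ (u :+ con true) := u :* u :+ u) refl u) ℘u≡x })
      (x≢x+1 u))
    (cong (λ s → 1ℤ ℤ.+ s) (∑-𝟙≟ (u + 1#)))

  ∑-fibreSize : ∑ fibreSize ≡ ℤ.+ q
  ∑-fibreSize = trans (∑-swap (λ x z → 𝟙 (℘ z ≟ x)))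
    (trans (∑-cong (λ z → trans (∑-cong (λ x → 𝟙-cong (℘ z ≟ x) (x ≟ ℘ z) sym sym)) (∑-𝟙≟ (℘ z))))
    (trans (∑-const 1ℤ) (ℤ.*-identityʳ (ℤ.+ q))))

  -- Counting the field by the fibres of ℘ gives q = ∑ (1 + ψ x) = q + ∑ ψ.
  ∑-ψ : ∑ ψ ≡ 0ℤ
  ∑-ψ = ℤ-+-cancelˡ (ℤ.+ q) _ _ (begin
    ℤ.+ q ℤ.+ ∑ ψ              ≡⟨ cong (ℤ._+ ∑ ψ) (trans (∑-const 1ℤ) (ℤ.*-identityʳ (ℤ.+ q))) ⟨
    ∑ (λ _ → 1ℤ) ℤ.+ ∑ ψ       ≡⟨ ∑-distrib-+ (λ _ → 1ℤ) ψ ⟨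
    ∑ (λ x → 1ℤ ℤ.+ ψ x)       ≡⟨ ∑-cong fibreSize≡1+ψ ⟨
    ∑ fibreSize                ≡⟨ ∑-fibreSize ⟩
    ℤ.+ q                      ≡⟨ ℤ.+-identityʳ (ℤ.+ q) ⟨
    ℤ.+ q ℤ.+ 0ℤ               ∎)
    where
    open ≡-Reasoning
    open RingProperties ℤ.+-*-ring using () renaming (+-cancelˡ to ℤ-+-cancelˡ)

  ψ-image-+ : ∀ x {y} → Image℘ y → ψ (x + y) ≡ ψ x
  ψ-image-+ x {y} y∈ with image℘? x
  ... | yes x∈ = ψ-image (Image℘-+ x∈ y∈)
  ... | no  x∉ = ψ-nonimage λ x+y∈ → x∉ (subst Image℘ ([x+y]+y≡x x y) (Image℘-+ x+y∈ y∈))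

  -- Image℘ has index 2: for y outside it, -(ψ x + ψ (x + y)) is nonnegative and sums to zero.
  ψ-nonimage-+ : ∀ x {y} → ¬ Image℘ y → ψ (x + y) ≡ ℤ.- ψ x
  ψ-nonimage-+ x {y} y∉ = sym (trans (solveℤ (ψ x) (ψ (x + y))) (trans
      (cong (λ s → s ℤ.+ ψ (x + y)) (∑-nonNegative-≡0 defect 0≤defect ∑-defect x)) (ℤ.+-identityˡ _)))
    where
    open ≡-Reasoning
    defect : Carrier → ℤ
    defect x = ℤ.- (ψ x ℤ.+ ψ (x + y))
    solveℤ : ∀ i j → ℤ.- i ≡ ℤ.- (i ℤ.+ j) ℤ.+ j
    solveℤ = ℤ.solve-∀
    0≤defect : ∀ x → 0ℤ ℤ.≤ defect x
    0≤defect x with image℘? x | image℘? (x + y)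
    ... | no  _  | no  _    = ℤ.+≤+ ℕ.z≤n
    ... | no  _  | yes _    = ℤ.+≤+ ℕ.z≤n
    ... | yes _  | no  _    = ℤ.+≤+ ℕ.z≤n
    ... | yes x∈ | yes x+y∈ = contradiction (subst Image℘ (x+[x+y]≡y x y) (Image℘-+ x∈ x+y∈)) y∉
    ∑-defect : ∑ defect ≡ 0ℤ
    ∑-defect = begin
      ∑ defect
        ≡⟨ ∑-cong (λ x → sym (ℤ.-1*i≡-i (ψ x ℤ.+ ψ (x + y)))) ⟩
      ∑ (λ x → -1ℤ ℤ.* (ψ x ℤ.+ ψ (x + y)))
        ≡⟨ *-distribˡ-∑ -1ℤ (λ x → ψ x ℤ.+ ψ (x + y)) ⟨
      -1ℤ ℤ.* ∑ (λ x → ψ x ℤ.+ ψ (x + y))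
        ≡⟨ cong (λ s → -1ℤ ℤ.* s) (∑-distrib-+ ψ (λ x → ψ (x + y))) ⟩
      -1ℤ ℤ.* (∑ ψ ℤ.+ ∑ (λ x → ψ (x + y)))
        ≡⟨ cong (λ s → -1ℤ ℤ.* (∑ ψ ℤ.+ s))
             (∑-reindex (_+ y) (_+ y) (λ x → [x+y]+y≡x x y) (λ x → [x+y]+y≡x x y) ψ) ⟨
      -1ℤ ℤ.* (∑ ψ ℤ.+ ∑ ψ)
        ≡⟨ cong₂ (λ s t → -1ℤ ℤ.* (s ℤ.+ t)) ∑-ψ ∑-ψ ⟩
      0ℤ ∎

  ψ-+ : ∀ x y → ψ (x + y) ≡ ψ x ℤ.* ψ y
  ψ-+ x y with image℘? y
  ... | yes y∈ = trans (ψ-image-+ x y∈) (sym (ℤ.*-identityʳ (ψ x)))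
  ... | no  y∉ = trans (ψ-nonimage-+ x y∉) (sym (trans (ℤ.*-comm (ψ x) -1ℤ) (ℤ.-1*i≡-i (ψ x))))

  -- Since x² = x + ℘ x. This allows a linear term under ψ to be replaced by its square and merged
  -- with a quadratic term.
  ψ-square : ∀ x → ψ (x * x) ≡ ψ x
  ψ-square x = trans (cong ψ (solve 1 (λ x → x :* x := x :+ (x :* x :+ x)) refl x))
    (ψ-image-+ x (x , refl))

  ψ0≡1 : ψ 0# ≡ 1ℤ
  ψ0≡1 = ψ-image (0# , trans (+-identityʳ _) (zeroˡ 0#))

  ∑-ψ-* : ∀ {d} → d ≢ 0# → ∑ (λ x → ψ (d * x)) ≡ 0ℤ
  ∑-ψ-* {d} d≢0 = trans (sym (∑-reindex (_*_ d) (_*_ (d ⁻¹))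
      (a*b≡1⇒a*[b*x]≡x (trans (*-comm _ d) (⁻¹-inverseʳ d≢0))) (a*b≡1⇒a*[b*x]≡x (⁻¹-inverseʳ d≢0)) ψ)) ∑-ψ

  -- Squaring permutes the field, so this is the orthogonality relation for x ↦ ψ (d x).
  ∑-ψ-*square : ∀ d → ∑ (λ x → ψ (d * (x * x))) ≡ ℤ.+ q ℤ.* 𝟙 (d ≟ 0#)
  ∑-ψ-*square d = trans
    (sym (∑-reindex (λ x → x * x) √ (λ x → square-injective (√-square (x * x))) √-square (λ x → ψ (d * x))))
    orthogonality
    where
    orthogonality : ∑ (λ x → ψ (d * x)) ≡ ℤ.+ q ℤ.* 𝟙 (d ≟ 0#)
    orthogonality with d ≟ 0#
    ... | yes refl = trans (∑-cong (λ x → trans (cong ψ (zeroˡ x)) ψ0≡1)) (∑-const 1ℤ)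
    ... | no  d≢0  = trans (∑-ψ-* d≢0) (sym (ℤ.*-zeroʳ (ℤ.+ q)))

  cube : Carrier → Carrier
  cube x = x * (x * x)

  cube-* : ∀ x y → cube (x * y) ≡ cube x * cube y
  cube-* = solve 2 (λ x y → (x :* y) :* ((x :* y) :* (x :* y)) := (x :* (x :* x)) :* (y :* (y :* y))) refl

  cube≡0 : ∀ {x} → cube x ≡ 0# → x ≡ 0#
  cube≡0 {x} x³≡0 with x ≟ 0#
  ... | yes x≡0 = x≡0
  ... | no  x≢0 = contradiction x³≡0 (*≢0 x≢0 (*≢0 x≢0 x≢0))

  -- The nonzero cubes, described through their inverses.
  Cubic : Carrier → Set c
  Cubic k = ∃[ w ] k * cube w ≡ 1#

  cubic? : ∀ k → Dec (Cubic k)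
  cubic? k = search (λ w → k * cube w ≟ 1#)

  Cubic≢0 : ∀ {k} → Cubic k → k ≢ 0#
  Cubic≢0 (w , kw³≡1) = unit≢0 kw³≡1

  Cubic-root≢0 : ∀ {k w} → k * cube w ≡ 1# → w ≢ 0#
  Cubic-root≢0 {k} {w} kw³≡1 refl =
    1≢0 (trans (sym kw³≡1) (trans (cong (_*_ k) (zeroˡ _)) (zeroʳ k)))

  Cubic-* : ∀ {j k} → Cubic j → Cubic k → Cubic (j * k)
  Cubic-* {j} {k} (v , jv³≡1) (w , kw³≡1) = v * w , (begin
    (j * k) * cube (v * w)
      ≡⟨ solve 4 (λ j k v w → (j :* k) :* ((v :* w) :* ((v :* w) :* (v :* w)))
                           := (j :* (v :* (v :* v))) :* (k :* (w :* (w :* w)))) refl j k v w ⟩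
    (j * cube v) * (k * cube w)  ≡⟨ cong₂ _*_ jv³≡1 kw³≡1 ⟩
    1# * 1#                      ≡⟨ *-identityˡ 1# ⟩
    1#                           ∎)
    where open ≡-Reasoning

  cube-Cubic : ∀ {x} → x ≢ 0# → Cubic (cube x)
  cube-Cubic {x} x≢0 = x ⁻¹ , trans (sym (cube-* x (x ⁻¹)))
    (trans (cong cube (⁻¹-inverseʳ x≢0)) (trans (*-identityˡ _) (*-identityˡ 1#)))

  -- k = k⁴ / k³, and k⁴ is a cube when k² is.
  square-Cubic : ∀ {k} → Cubic (k * k) → Cubic k
  square-Cubic {k} (w , kkw³≡1) = k * (w * w) , trans
    (solve 2 (λ k w → k :* ((k :* (w :* w)) :* ((k :* (w :* w)) :* (k :* (w :* w))))
      := ((k :* k) :* (w :* (w :* w))) :* ((k :* k) :* (w :* (w :* w)))) refl k w)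
    (trans (cong₂ _*_ kkw³≡1 kkw³≡1) (*-identityˡ 1#))

  Cubic-cancelˡ : ∀ {j k} → Cubic j → Cubic (j * k) → Cubic k
  -- The witness j v² w comes from k (j v² w)³ = (j k w³)(j v³)².
  Cubic-cancelˡ {j} {k} (v , jv³≡1) (w , jkw³≡1) = j * (v * (v * w)) , (begin
    k * cube (j * (v * (v * w)))
      ≡⟨ solve 4 (λ j k v w → k :* ((j :* (v :* (v :* w))) :* ((j :* (v :* (v :* w))) :* (j :* (v :* (v :* w)))))
           := ((j :* k) :* (w :* (w :* w))) :* ((j :* (v :* (v :* v))) :* (j :* (v :* (v :* v))))) refl j k v w ⟩
    ((j * k) * cube w) * ((j * cube v) * (j * cube v))
      ≡⟨ cong₂ _*_ jkw³≡1 (cong₂ _*_ jv³≡1 jv³≡1) ⟩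
    1# * (1# * 1#) ≡⟨ trans (*-identityˡ _) (*-identityˡ 1#) ⟩
    1# ∎)
    where open ≡-Reasoning

  -- The cubic character sums S and their squares.

  module Cubes (ζ : Carrier) (ζ²+ζ≡1 : ζ * ζ + ζ ≡ 1#) where

    ψ1≡1 : ψ 1# ≡ 1ℤ
    ψ1≡1 = ψ-image (ζ , ζ²+ζ≡1)

    -- x³ + y³ splits over the cube roots of unity 1, ζ and ζ + 1 = ζ².
    cube-fibre : ∀ {x y} → cube x ≡ cube y → x ≡ y ⊎ (x ≡ ζ * y ⊎ x ≡ (ζ + 1#) * y)
    cube-fibre {x} {y} x³≡y³ with x*y≡0⇒x≡0⊎y≡0 (begin
        (x + y) * ((x + ζ * y) * (x + (ζ + 1#) * y))
          ≡⟨ solve 3 (λ x y z → (x :+ y) :* ((x :+ z :* y) :* (x :+ (z :+ con true) :* y))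
               := (x :* (x :* x) :+ y :* (y :* y)) :+ ((z :* z :+ z) :+ con true) :* (x :* (y :* y) :+ y :* (y :* y)))
               refl x y ζ ⟩
        (cube x + cube y) + ((ζ * ζ + ζ) + 1#) * (x * (y * y) + cube y)
          ≡⟨ cong₂ (λ s t → (s + cube y) + (t + 1#) * (x * (y * y) + cube y)) x³≡y³ ζ²+ζ≡1 ⟩
        (cube y + cube y) + (1# + 1#) * (x * (y * y) + cube y)
          ≡⟨ solve 2 (λ s t → (s :+ s) :+ (con true :+ con true) :* t := con false) refl (cube y) _ ⟩
        0# ∎)
      where open ≡-Reasoning
    ... | inj₁ x+y≡0 = inj₁ (x+y≡0⇒x≡y x+y≡0)
    ... | inj₂ eq with x*y≡0⇒x≡0⊎y≡0 eq
    ... | inj₁ x+ζy≡0 = inj₂ (inj₁ (x+y≡0⇒x≡y x+ζy≡0))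
    ... | inj₂ x+ζ²y≡0 = inj₂ (inj₂ (x+y≡0⇒x≡y x+ζ²y≡0))

    ζ≢0 : ζ ≢ 0#
    ζ≢0 refl = 1≢0 (trans (sym ζ²+ζ≡1) (trans (+-identityʳ _) (zeroˡ 0#)))

    ζ+1≢0 : ζ + 1# ≢ 0#
    ζ+1≢0 ζ+1≡0 = 1≢0 (trans (sym ζ²+ζ≡1)
      (trans (solve 1 (λ z → z :* z :+ z := (z :+ con true) :* z) refl ζ) (trans (cong (_* ζ) ζ+1≡0) (zeroˡ ζ))))

    ζ≢1 : ζ ≢ 1#
    ζ≢1 refl = ζ+1≢0 1+1≡0

    cube-ζ* : ∀ y → cube (ζ * y) ≡ cube y
    cube-ζ* y = begin
      cube (ζ * y)
        ≡⟨ solve 2 (λ z y → (z :* y) :* ((z :* y) :* (z :* y))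
             := ((z :+ con true) :* (z :* z :+ z) :+ z) :* (y :* (y :* y))) refl ζ y ⟩
      ((ζ + 1#) * (ζ * ζ + ζ) + ζ) * cube y
        ≡⟨ cong (λ e → ((ζ + 1#) * e + ζ) * cube y) ζ²+ζ≡1 ⟩
      ((ζ + 1#) * 1# + ζ) * cube y
        ≡⟨ solve 2 (λ z t → ((z :+ con true) :* con true :+ z) :* t := t) refl ζ (cube y) ⟩
      cube y ∎
      where open ≡-Reasoning

    cube-[ζ+1]* : ∀ y → cube ((ζ + 1#) * y) ≡ cube y
    cube-[ζ+1]* y = begin
      cube ((ζ + 1#) * y)
        ≡⟨ solve 2 (λ z y → ((z :+ con true) :* y) :* (((z :+ con true) :* y) :* ((z :+ con true) :* y))
             := (z :* (z :* z :+ z) :+ (z :+ con true)) :* (y :* (y :* y))) refl ζ y ⟩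
      (ζ * (ζ * ζ + ζ) + (ζ + 1#)) * cube y
        ≡⟨ cong (λ e → (ζ * e + (ζ + 1#)) * cube y) ζ²+ζ≡1 ⟩
      (ζ * 1# + (ζ + 1#)) * cube y
        ≡⟨ solve 2 (λ z t → (z :* con true :+ (z :+ con true)) :* t := t) refl ζ (cube y) ⟩
      cube y ∎
      where open ≡-Reasoning

    ∑-cube≡ : ∀ {y} → y ≢ 0# → ∑ (λ x → 𝟙 (cube x ≟ cube y)) ≡ + 3
    ∑-cube≡ {y} y≢0 = begin
      ∑ (λ x → 𝟙 (cube x ≟ cube y))
        ≡⟨ ∑-𝟙-insert (λ x → cube x ≟ cube y) (λ x → (x ≟ ζ * y) ⊎-dec (x ≟ (ζ + 1#) * y)) y
             cube-fibre refl
             (λ { (inj₁ refl) → cube-ζ* y ; (inj₂ refl) → cube-[ζ+1]* y })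
             (λ { (inj₁ y≡ζy) → ζ≢1 (sym (cancel (trans (*-comm y 1#) (trans (*-identityˡ y) y≡ζy))))
                ; (inj₂ y≡ζ²y) → ζ≢0 (x+y≡1⇒y≡0 (cancel (trans (*-comm y 1#) (trans (*-identityˡ y) y≡ζ²y)))) }) ⟩
      1ℤ ℤ.+ ∑ (λ x → 𝟙 ((x ≟ ζ * y) ⊎-dec (x ≟ (ζ + 1#) * y)))
        ≡⟨ cong (λ s → 1ℤ ℤ.+ s) (∑-𝟙-insert (λ x → (x ≟ ζ * y) ⊎-dec (x ≟ (ζ + 1#) * y)) (_≟ (ζ + 1#) * y) (ζ * y)
             id (inj₁ refl) inj₂
             (λ ζy≡ζ²y → x≢x+1 ζ (cancel (trans (*-comm y ζ) ζy≡ζ²y)))) ⟩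
      1ℤ ℤ.+ (1ℤ ℤ.+ ∑ (λ x → 𝟙 (x ≟ (ζ + 1#) * y)))
        ≡⟨ cong (λ s → 1ℤ ℤ.+ (1ℤ ℤ.+ s)) (∑-𝟙≟ ((ζ + 1#) * y)) ⟩
      + 3 ∎
      where
      open ≡-Reasoning
      cancel : ∀ {u v} → y * u ≡ v * y → u ≡ v
      cancel {u} {v} yu≡vy = *-cancelˡ y≢0 (trans yu≡vy (*-comm v y))
      x+y≡1⇒y≡0 : ∀ {x} → 1# ≡ x + 1# → x ≡ 0#
      x+y≡1⇒y≡0 {x} 1≡x+1 = trans (sym ([x+y]+y≡x x 1#)) (trans (cong (_+ 1#) (sym 1≡x+1)) 1+1≡0)

    cube-fibre-size : ∀ z → ∃[ k ] ∑ (λ y → 𝟙 (z ≟ cube y)) ≡ 𝟙 (z ≟ 0#) ℤ.+ + 3 ℤ.* k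
    cube-fibre-size z with z ≟ 0#
    ... | yes refl = 0ℤ , trans
          (∑-cong (λ y → 𝟙-cong (0# ≟ cube y) (y ≟ 0#) (cube≡0 ∘ sym) (λ { refl → sym (zeroˡ _) })))
          (∑-𝟙≟ 0#)
    ... | no z≢0 with search (λ y → z ≟ cube y)
    ...   | yes (y , refl) = 1ℤ , trans (∑-cong (λ x → 𝟙-cong (cube y ≟ cube x) (cube x ≟ cube y) sym sym))
                               (∑-cube≡ (λ { refl → z≢0 (zeroˡ _) }))
    ...   | no  z∉ = 0ℤ , ∑-zero (λ y → 𝟙-no (z ≟ cube y) (λ eq → z∉ (y , eq)))

    S : Carrier → ℤ
    S k = ∑ (λ y → ψ (k * cube y))

    -- Grouping the terms by z = y³, the fibre over a nonzero z has 0 or 3 elements and contributes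
    -- a multiple of 3, while z = 0 contributes ψ 0 = 1.
    S≡1mod3 : ∀ k → ∃[ j ] S k ≡ 1ℤ ℤ.+ + 3 ℤ.* j
    S≡1mod3 k = ∑ (λ z → g z ℤ.* ψ (k * z)) , (begin
      ∑ (λ y → ψ (k * cube y))
        ≡⟨ ∑-cong (λ y → sym (trans (∑-single (λ z → 𝟙 (z ≟ cube y) ℤ.* ψ (k * z)) (cube y)
             (λ z z≢y³ → trans (cong (ℤ._* ψ (k * z)) (𝟙-no (z ≟ cube y) z≢y³)) (ℤ.*-zeroˡ (ψ (k * z)))))
             (trans (cong (ℤ._* ψ (k * cube y)) (𝟙-yes (cube y ≟ cube y) refl)) (ℤ.*-identityˡ _)))) ⟩
      ∑ (λ y → ∑ (λ z → 𝟙 (z ≟ cube y) ℤ.* ψ (k * z)))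
        ≡⟨ ∑-swap (λ y z → 𝟙 (z ≟ cube y) ℤ.* ψ (k * z)) ⟩
      ∑ (λ z → ∑ (λ y → 𝟙 (z ≟ cube y) ℤ.* ψ (k * z)))
        ≡⟨ ∑-cong (λ z → trans (sym (*-distribʳ-∑ (ψ (k * z)) (λ y → 𝟙 (z ≟ cube y))))
             (trans (cong (ℤ._* ψ (k * z)) (proj₂ (cube-fibre-size z))) (expand (𝟙 (z ≟ 0#)) (g z) (ψ (k * z))))) ⟩
      ∑ (λ z → 𝟙 (z ≟ 0#) ℤ.* ψ (k * z) ℤ.+ + 3 ℤ.* (g z ℤ.* ψ (k * z)))
        ≡⟨ ∑-distrib-+ (λ z → 𝟙 (z ≟ 0#) ℤ.* ψ (k * z)) _ ⟩
      ∑ (λ z → 𝟙 (z ≟ 0#) ℤ.* ψ (k * z)) ℤ.+ ∑ (λ z → + 3 ℤ.* (g z ℤ.* ψ (k * z)))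
        ≡⟨ cong₂ ℤ._+_
             (trans (∑-single (λ z → 𝟙 (z ≟ 0#) ℤ.* ψ (k * z)) 0#
               (λ z z≢0 → trans (cong (ℤ._* ψ (k * z)) (𝟙-no (z ≟ 0#) z≢0)) (ℤ.*-zeroˡ (ψ (k * z)))))
               (trans (cong₂ ℤ._*_ (𝟙-yes (0# ≟ 0#) refl) (trans (cong ψ (zeroʳ k)) ψ0≡1)) (ℤ.*-identityˡ 1ℤ)))
             (sym (*-distribˡ-∑ (+ 3) (λ z → g z ℤ.* ψ (k * z)))) ⟩
      1ℤ ℤ.+ + 3 ℤ.* ∑ (λ z → g z ℤ.* ψ (k * z)) ∎)
      where
      open ≡-Reasoning
      g : Carrier → ℤ
      g z = proj₁ (cube-fibre-size z)
      expand : ∀ i j l → (i ℤ.+ + 3 ℤ.* j) ℤ.* l ≡ i ℤ.* l ℤ.+ + 3 ℤ.* (j ℤ.* l)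
      expand = ℤ.solve-∀

    ∑-*cube≡1 : ∀ k → ∑ (λ w → 𝟙 (k * cube w ≟ 1#)) ≡ + 3 ℤ.* 𝟙 (cubic? k)
    ∑-*cube≡1 k with cubic? k
    ... | no  k∉ = ∑-zero (λ w → 𝟙-no (k * cube w ≟ 1#) (λ eq → k∉ (w , eq)))
    ... | yes (v , kv³≡1) = trans
      (∑-cong (λ w → 𝟙-cong (k * cube w ≟ 1#) (cube w ≟ cube v)
        (λ kw³≡1 → *-cancelˡ (unit≢0 kv³≡1) (trans kw³≡1 (sym kv³≡1)))
        (λ w³≡v³ → trans (cong (_*_ k) w³≡v³) kv³≡1)))
      (∑-cube≡ (Cubic-root≢0 kv³≡1))

    -- Substituting y + w for the second variable turns the exponent into k w³ + k w y² + k w² y. By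
    -- `ψ-square` the term linear in y may be squared, so the sum over y has the exponent `D w` y²
    -- and survives only where `D w` = 0. These w are 0 and the roots of k w³ = 1, all with weight
    -- 1.
    S-square : ∀ {k} → k ≢ 0# → S k ℤ.* S k ≡ ℤ.+ q ℤ.* (1ℤ ℤ.+ + 3 ℤ.* 𝟙 (cubic? k))
    S-square {k} k≢0 = begin
      S k ℤ.* S k
        ≡⟨ *-distribʳ-∑ (S k) _ ⟩
      ∑ (λ y → ψ (k * cube y) ℤ.* S k)
        ≡⟨ ∑-cong (λ y → trans
             (cong (λ s → ψ (k * cube y) ℤ.* s) (∑-reindex (_+_ y) (_+_ y) (x+[x+y]≡y y) (x+[x+y]≡y y) (λ z → ψ (k * cube z))))
             (*-distribˡ-∑ (ψ (k * cube y)) (λ w → ψ (k * cube (y + w))))) ⟩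
      ∑ (λ y → ∑ (λ w → ψ (k * cube y) ℤ.* ψ (k * cube (y + w))))
        ≡⟨ ∑-cong (λ y → ∑-cong (λ w → polarize y w)) ⟩
      ∑ (λ y → ∑ (λ w → ψ (k * cube w) ℤ.* ψ (D w * (y * y))))
        ≡⟨ ∑-swap (λ y w → ψ (k * cube w) ℤ.* ψ (D w * (y * y))) ⟩
      ∑ (λ w → ∑ (λ y → ψ (k * cube w) ℤ.* ψ (D w * (y * y))))
        ≡⟨ ∑-cong (λ w → trans (sym (*-distribˡ-∑ (ψ (k * cube w)) (λ y → ψ (D w * (y * y)))))
             (trans (cong (λ s → ψ (k * cube w) ℤ.* s) (∑-ψ-*square (D w))) (radical w))) ⟩
      ∑ (λ w → ℤ.+ q ℤ.* (𝟙 (w ≟ 0#) ℤ.+ 𝟙 (k * cube w ≟ 1#)))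
        ≡⟨ *-distribˡ-∑ (ℤ.+ q) (λ w → 𝟙 (w ≟ 0#) ℤ.+ 𝟙 (k * cube w ≟ 1#)) ⟨
      ℤ.+ q ℤ.* ∑ (λ w → 𝟙 (w ≟ 0#) ℤ.+ 𝟙 (k * cube w ≟ 1#))
        ≡⟨ cong (λ s → ℤ.+ q ℤ.* s) (trans (∑-distrib-+ (λ w → 𝟙 (w ≟ 0#)) _) (cong₂ ℤ._+_ (∑-𝟙≟ 0#) (∑-*cube≡1 k))) ⟩
      ℤ.+ q ℤ.* (1ℤ ℤ.+ + 3 ℤ.* 𝟙 (cubic? k)) ∎
      where
      open ≡-Reasoning

      D : Carrier → Carrier
      D w = k * w + (k * (w * w)) * (k * (w * w))

      polarize : ∀ y w → ψ (k * cube y) ℤ.* ψ (k * cube (y + w)) ≡ ψ (k * cube w) ℤ.* ψ (D w * (y * y))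
      polarize y w = begin
        ψ (k * cube y) ℤ.* ψ (k * cube (y + w))
          ≡⟨ ψ-+ (k * cube y) _ ⟨
        ψ (k * cube y + k * cube (y + w))
          ≡⟨ cong ψ (solve 3 (λ k y w → k :* (y :* (y :* y)) :+ k :* ((y :+ w) :* ((y :+ w) :* (y :+ w)))
               := k :* (w :* (w :* w)) :+ ((k :* w) :* (y :* y) :+ (k :* (w :* w)) :* y)) refl k y w) ⟩
        ψ (k * cube w + ((k * w) * (y * y) + (k * (w * w)) * y))
          ≡⟨ trans (ψ-+ (k * cube w) _) (cong (λ s → ψ (k * cube w) ℤ.* s) (begin
               ψ ((k * w) * (y * y) + (k * (w * w)) * y)
                 ≡⟨ ψ-+ ((k * w) * (y * y)) _ ⟩
               ψ ((k * w) * (y * y)) ℤ.* ψ ((k * (w * w)) * y)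
                 ≡⟨ cong (λ s → ψ ((k * w) * (y * y)) ℤ.* s) (ψ-square ((k * (w * w)) * y)) ⟨
               ψ ((k * w) * (y * y)) ℤ.* ψ (((k * (w * w)) * y) * ((k * (w * w)) * y))
                 ≡⟨ ψ-+ ((k * w) * (y * y)) _ ⟨
               ψ ((k * w) * (y * y) + ((k * (w * w)) * y) * ((k * (w * w)) * y))
                 ≡⟨ cong ψ (solve 3 (λ a b y → a :* (y :* y) :+ (b :* y) :* (b :* y) := (a :+ b :* b) :* (y :* y))
                      refl (k * w) (k * (w * w)) y) ⟩
               ψ (D w * (y * y)) ∎)) ⟩
        ψ (k * cube w) ℤ.* ψ (D w * (y * y)) ∎

      D-factor : ∀ w → D w ≡ (k * w) * (k * cube w + 1#)
      D-factor w = solve 2 (λ k w → k :* w :+ (k :* (w :* w)) :* (k :* (w :* w))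
        := (k :* w) :* (k :* (w :* (w :* w)) :+ con true)) refl k w

      radical : ∀ w → ψ (k * cube w) ℤ.* (ℤ.+ q ℤ.* 𝟙 (D w ≟ 0#)) ≡ ℤ.+ q ℤ.* (𝟙 (w ≟ 0#) ℤ.+ 𝟙 (k * cube w ≟ 1#))
      radical w with w ≟ 0# | k * cube w ≟ 1#
      ... | yes refl | yes k0≡1 = contradiction refl (Cubic-root≢0 k0≡1)
      ... | yes refl | no _ = trans (cong₂ (λ i j → i ℤ.* (ℤ.+ q ℤ.* j))
              (trans (cong ψ (trans (cong (_*_ k) (zeroˡ _)) (zeroʳ k))) ψ0≡1)
              (𝟙-yes (D 0# ≟ 0#) (trans (D-factor 0#) (trans (cong (_* (k * cube 0# + 1#)) (zeroʳ k)) (zeroˡ _)))))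
            (ℤ.*-identityˡ _)
      -- The weight of such a w is ψ 1, which is 1 because 1 has trace 0.
      ... | no _ | yes kw³≡1 = trans (cong₂ (λ i j → i ℤ.* (ℤ.+ q ℤ.* j))
              (trans (cong ψ kw³≡1) ψ1≡1)
              (𝟙-yes (D w ≟ 0#) (trans (D-factor w) (trans (cong (λ e → (k * w) * (e + 1#)) kw³≡1)
                (trans (cong (_*_ (k * w)) 1+1≡0) (zeroʳ _))))))
            (ℤ.*-identityˡ _)
      ... | no w≢0 | no kw³≢1 = trans (cong (λ j → ψ (k * cube w) ℤ.* (ℤ.+ q ℤ.* j))
              (𝟙-no (D w ≟ 0#) (λ Dw≡0 → case x*y≡0⇒x≡0⊎y≡0 (trans (sym (D-factor w)) Dw≡0) of λ
                { (inj₁ kw≡0) → *≢0 k≢0 w≢0 kw≡0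
                ; (inj₂ kw³+1≡0) → kw³≢1 (x+y≡0⇒x≡y kw³+1≡0) })))
            (annihilate (ψ (k * cube w)) (ℤ.+ q))
        where
        annihilate : ∀ i j → i ℤ.* (j ℤ.* 0ℤ) ≡ j ℤ.* 0ℤ
        annihilate = ℤ.solve-∀

-- Integer identities and the choice of signs by residues modulo 3.

private
  module Identity where
    quadruple : ∀ i → (i ℤ.* i) ℤ.* + 4 ≡ (+ 2 ℤ.* i) ℤ.* (+ 2 ℤ.* i)
    quadruple = ℤ.solve-∀

    difference₁ : ∀ l j → + 3 ℤ.* (l ℤ.- + 2 ℤ.* j) ≡ (1ℤ ℤ.+ + 3 ℤ.* l) ℤ.- (+ 2 ℤ.* (1ℤ ℤ.+ + 3 ℤ.* j)) ℤ.+ 1ℤ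
    difference₁ = ℤ.solve-∀

    difference₂ : ∀ l j → + 3 ℤ.* (1ℤ ℤ.+ l ℤ.+ j) ≡ (1ℤ ℤ.+ + 3 ℤ.* l) ℤ.- (ℤ.- (1ℤ ℤ.+ + 3 ℤ.* j)) ℤ.+ 1ℤ
    difference₂ = ℤ.solve-∀

    at-zero : ∀ i j → j ≡ i ℤ.+ (ℤ.- (+ 3 ℤ.* i)) ℤ.* 0ℤ ℤ.+ (j ℤ.- i) ℤ.* 1ℤ
    at-zero = ℤ.solve-∀

    at-cube : ∀ i j → ℤ.- (+ 2 ℤ.* i) ≡ i ℤ.+ (ℤ.- (+ 3 ℤ.* i)) ℤ.* 1ℤ ℤ.+ (j ℤ.- i) ℤ.* 0ℤ
    at-cube = ℤ.solve-∀

    at-noncube : ∀ i j → i ≡ i ℤ.+ (ℤ.- (+ 3 ℤ.* i)) ℤ.* 0ℤ ℤ.+ (j ℤ.- i) ℤ.* 0ℤ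
    at-noncube = ℤ.solve-∀

    rearrange : ∀ i j → 1ℤ ℤ.* i ≡ j ℤ.* 1ℤ ℤ.+ 1ℤ ℤ.* (i ℤ.- j)
    rearrange = ℤ.solve-∀

    collect : ∀ p s u v z →
      p ℤ.* s ℤ.+ (ℤ.- (+ 3 ℤ.* s)) ℤ.* u ℤ.+ (p ℤ.- s) ℤ.* z ℤ.+ (s ℤ.+ (ℤ.- (+ 3 ℤ.* s)) ℤ.* v ℤ.+ (p ℤ.- s) ℤ.* 0ℤ ℤ.- p)
      ≡ p ℤ.* s ℤ.+ s ℤ.- p ℤ.- (+ 3 ℤ.* s) ℤ.* (v ℤ.+ u) ℤ.+ (p ℤ.- s) ℤ.* z
    collect = ℤ.solve-∀

    isolate : ∀ p s x z → s ℤ.* (+ 3 ℤ.* x) ≡ p ℤ.* s ℤ.+ s ℤ.- p ℤ.+ (p ℤ.- s) ℤ.* z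
      ℤ.- (p ℤ.* s ℤ.+ s ℤ.- p ℤ.- (+ 3 ℤ.* s) ℤ.* x ℤ.+ (p ℤ.- s) ℤ.* z)
    isolate = ℤ.solve-∀

    extract : ∀ s y z → (s ℤ.* s) ℤ.* s ℤ.+ s ℤ.- s ℤ.* s ℤ.+ (s ℤ.* s ℤ.- s) ℤ.* (+ 3 ℤ.* z) ℤ.- y ℤ.* (s ℤ.* s)
      ≡ s ℤ.* (s ℤ.* s ℤ.+ 1ℤ ℤ.- s ℤ.+ + 3 ℤ.* z ℤ.* (s ℤ.- 1ℤ) ℤ.- y ℤ.* s)
    extract = ℤ.solve-∀

    square : ∀ s → (ℤ.- (+ 2 ℤ.* s)) ℤ.* (ℤ.- (+ 2 ℤ.* s)) ≡ + 4 ℤ.* (s ℤ.* s)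
    square = ℤ.solve-∀

    simplify₁ : ∀ p s → p ℤ.+ 1ℤ ℤ.- s ℤ.+ + 3 ℤ.* 1ℤ ℤ.* (s ℤ.- 1ℤ) ℤ.- + 4 ℤ.* s ≡ p ℤ.- + 2 ℤ.* s ℤ.- + 2
    simplify₁ = ℤ.solve-∀

    simplify₂ : ∀ p s → p ℤ.+ 1ℤ ℤ.- s ℤ.+ + 3 ℤ.* 1ℤ ℤ.* (s ℤ.- 1ℤ) ℤ.- 1ℤ ℤ.* s ≡ p ℤ.+ s ℤ.- + 2
    simplify₂ = ℤ.solve-∀

    simplify₃ : ∀ p s → p ℤ.+ 1ℤ ℤ.- s ℤ.+ + 3 ℤ.* 0ℤ ℤ.* (s ℤ.- 1ℤ) ℤ.- 1ℤ ℤ.* s ≡ p ℤ.- + 2 ℤ.* s ℤ.+ 1ℤ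
    simplify₃ = ℤ.solve-∀

    left : ∀ s → (ℤ.- (+ 2 ℤ.* s)) ℤ.* s ≡ ℤ.- + 2 ℤ.* (s ℤ.* s)
    left = ℤ.solve-∀

    right : ∀ s → s ℤ.* (ℤ.- (+ 2 ℤ.* s)) ≡ ℤ.- + 2 ℤ.* (s ℤ.* s)
    right = ℤ.solve-∀

    simplify₄ : ∀ p s → p ℤ.+ 1ℤ ℤ.- s ℤ.+ + 3 ℤ.* 0ℤ ℤ.* (s ℤ.- 1ℤ) ℤ.- (ℤ.- + 2) ℤ.* s ≡ p ℤ.+ s ℤ.+ 1ℤ
    simplify₄ = ℤ.solve-∀

3*i≢1 : ∀ i → + 3 ℤ.* i ≢ 1ℤ
3*i≢1 i 3i≡1 with ℕ.m*n≡1⇒m≡1 3 ℤ.∣ i ∣ (trans (sym (ℤ.abs-* (+ 3) i)) (cong ℤ.∣_∣ 3i≡1))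
... | ()

i*i≡j*j⇒i≡±j : ∀ {i j} → i ℤ.* i ≡ j ℤ.* j → i ≡ j ⊎ i ≡ ℤ.- j
i*i≡j*j⇒i≡±j {i} {j} i²≡j² with ℤ.i*j≡0⇒i≡0∨j≡0 (i ℤ.- j) (trans (factor i j) (ℤ.i≡j⇒i-j≡0 i²≡j²))
  where
  factor : ∀ i j → (i ℤ.- j) ℤ.* (i ℤ.+ j) ≡ i ℤ.* i ℤ.- j ℤ.* j
  factor = ℤ.solve-∀
... | inj₁ i-j≡0 = inj₁ (ℤ.i-j≡0⇒i≡j i j i-j≡0)
... | inj₂ i+j≡0 = inj₂ (ℤ.i-j≡0⇒i≡j i (ℤ.- j) (trans (cong (λ k → i ℤ.+ k) (ℤ.neg-involutive j)) i+j≡0))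

-- Modulo 3 both s and x are 1, whereas 2 x is 2 and -2 x is 1; this excludes s = 2 x.
root-4x² : ∀ {s x} → (∃[ j ] x ≡ 1ℤ ℤ.+ + 3 ℤ.* j) → (∃[ l ] s ≡ 1ℤ ℤ.+ + 3 ℤ.* l) →
           s ℤ.* s ≡ (x ℤ.* x) ℤ.* + 4 → s ≡ ℤ.- (+ 2 ℤ.* x)
root-4x² {s} {x} (j , x≡) (l , s≡) s²≡4x²
  with i*i≡j*j⇒i≡±j {s} {+ 2 ℤ.* x} (trans s²≡4x² (Identity.quadruple x))
... | inj₂ s≡-2x = s≡-2x
... | inj₁ s≡2x  = contradiction (begin
    + 3 ℤ.* (l ℤ.- + 2 ℤ.* j)
      ≡⟨ Identity.difference₁ l j ⟩
    (1ℤ ℤ.+ + 3 ℤ.* l) ℤ.- (+ 2 ℤ.* (1ℤ ℤ.+ + 3 ℤ.* j)) ℤ.+ 1ℤ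
      ≡⟨ cong₂ (λ a b → a ℤ.- (+ 2 ℤ.* b) ℤ.+ 1ℤ) s≡ x≡ ⟨
    s ℤ.- (+ 2 ℤ.* x) ℤ.+ 1ℤ  ≡⟨ cong (ℤ._+ 1ℤ) (ℤ.i≡j⇒i-j≡0 s≡2x) ⟩
    1ℤ                        ∎) (3*i≢1 (l ℤ.- + 2 ℤ.* j))
  where open ≡-Reasoning

-- Here -x is 2 modulo 3, so the negative root is excluded.
root-x² : ∀ {s x} → (∃[ j ] x ≡ 1ℤ ℤ.+ + 3 ℤ.* j) → (∃[ l ] s ≡ 1ℤ ℤ.+ + 3 ℤ.* l) →
          s ℤ.* s ≡ x ℤ.* x → s ≡ x
root-x² {s} {x} (j , x≡) (l , s≡) s²≡x² with i*i≡j*j⇒i≡±j {s} {x} s²≡x²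
... | inj₁ s≡x  = s≡x
... | inj₂ s≡-x = contradiction (begin
    + 3 ℤ.* (1ℤ ℤ.+ l ℤ.+ j)
      ≡⟨ Identity.difference₂ l j ⟩
    (1ℤ ℤ.+ + 3 ℤ.* l) ℤ.- (ℤ.- (1ℤ ℤ.+ + 3 ℤ.* j)) ℤ.+ 1ℤ
      ≡⟨ cong₂ (λ a b → a ℤ.- (ℤ.- b) ℤ.+ 1ℤ) s≡ x≡ ⟨
    s ℤ.- (ℤ.- x) ℤ.+ 1ℤ  ≡⟨ cong (ℤ._+ 1ℤ) (ℤ.i≡j⇒i-j≡0 s≡-x) ⟩
    1ℤ                    ∎) (3*i≢1 (1ℤ ℤ.+ l ℤ.+ j))
  where open ≡-Reasoning

-- Classes modulo cubes and the cube values of a diagonal form.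

module Counting {c : Level} (n : ℕ) (𝔽 : FiniteField c (2 ℕ.^ n))
  (ω : FiniteField.Carrier 𝔽) (ω-primitive : Geometry.IsPrimitive 𝔽 ω)
  (ζ : FiniteField.Carrier 𝔽) (ζ²+ζ≡1 : Character.℘ n 𝔽 ζ ≡ FiniteField.1# 𝔽)
  (σ : ℤ) (σ²≡q : σ ℤ.* σ ≡ + (2 ℕ.^ n)) (σ≡1mod3 : ∃ λ j → σ ≡ 1ℤ ℤ.+ + 3 ℤ.* j)
  where

  open FiniteField 𝔽 using (Carrier; commutativeRing)
  open Character n 𝔽 public
  open Cubes ζ ζ²+ζ≡1 public
  open Solver₂ using (solve; _:=_; _:+_; _:*_; con)
  open Exp (CommutativeRing.semiring commutativeRing) using () renaming (_^_ to _↑_)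

  private
    q : ℕ
    q = 2 ℕ.^ n

  1-Cubic : Cubic 1#
  1-Cubic = 1# , trans (*-identityˡ _) (trans (*-identityˡ _) (*-identityˡ 1#))

  ω≢0 : ω ≢ 0#
  ω≢0 = proj₁ ω-primitive

  -- Multiplication by ω moves the three classes modulo cubes in a cycle, which closes because ω³ is
  -- a cube.
  classes : ∀ {x} → x ≢ 0# → Cubic x ⊎ (Cubic (ω * x) ⊎ Cubic (ω * (ω * x)))
  classes {x} x≢0 with k , refl ← proj₂ ω-primitive x x≢0 = go k
    where
    go : ∀ k → Cubic (ω ↑ k) ⊎ (Cubic (ω * ω ↑ k) ⊎ Cubic (ω * (ω * ω ↑ k)))
    go ℕ.zero = inj₁ 1-Cubic
    go (ℕ.suc k) with go k
    ... | inj₁ y         = inj₂ (inj₂ (subst Cubic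
          (solve 2 (λ w y → (w :* (w :* w)) :* y := w :* (w :* (w :* y))) refl ω (ω ↑ k))
          (Cubic-* (cube-Cubic ω≢0) y)))
    ... | inj₂ (inj₁ ωy) = inj₁ ωy
    ... | inj₂ (inj₂ ωωy) = inj₂ (inj₁ ωωy)

  -- If ω were a cube then every element would be one, so that cubing would be injective, although ζ³ = 1³.
  ω-nonCubic : ¬ Cubic ω
  ω-nonCubic ω-Cubic = ζ≢1 (surjective⇒injective cube cube-surjective
      (trans (cong cube (sym (*-identityʳ ζ))) (cube-ζ* 1#)))
    where
    powers : ∀ k → Cubic (ω ↑ k)
    powers ℕ.zero    = 1-Cubic
    powers (ℕ.suc k) = Cubic-* ω-Cubic (powers k)
    cube-surjective : ∀ y → ∃[ x ] cube x ≡ y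
    cube-surjective y with y ≟ 0#
    ... | yes refl = 0# , zeroˡ _
    ... | no  y≢0 with k , refl ← proj₂ ω-primitive y y≢0 with w , yw³≡1 ← powers k =
      ω ↑ k * (w * w) , (begin
        cube (ω ↑ k * (w * w))
          ≡⟨ solve 2 (λ y w → (y :* (w :* w)) :* ((y :* (w :* w)) :* (y :* (w :* w)))
               := y :* ((y :* (w :* (w :* w))) :* (y :* (w :* (w :* w))))) refl (ω ↑ k) w ⟩
        ω ↑ k * ((ω ↑ k * cube w) * (ω ↑ k * cube w))  ≡⟨ cong (λ e → ω ↑ k * (e * e)) yw³≡1 ⟩
        ω ↑ k * (1# * 1#)  ≡⟨ trans (cong (_*_ (ω ↑ k)) (*-identityˡ 1#)) (*-identityʳ _) ⟩
        ω ↑ k ∎)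
      where open ≡-Reasoning

  -- The group modulo cubes has order 3, so two nontrivial classes are inverse to each other, and x
  -- y is a cube, or equal, and x y² is one.
  nonCubic-product : ∀ {x y} → x ≢ 0# → y ≢ 0# → ¬ Cubic x → ¬ Cubic y → Cubic (x * y) ⊎ Cubic (x * (y * y))
  nonCubic-product {x} {y} x≢0 y≢0 x∉ y∉ with classes x≢0 | classes y≢0
  ... | inj₁ x∈ | _ = contradiction x∈ x∉
  ... | _ | inj₁ y∈ = contradiction y∈ y∉
  ... | inj₂ (inj₁ ωx) | inj₂ (inj₁ ωy) = inj₂ (Cubic-cancelˡ (cube-Cubic ω≢0) (subst Cubic
        (solve 3 (λ w x y → (w :* x) :* ((w :* y) :* (w :* y)) := (w :* (w :* w)) :* (x :* (y :* y))) refl ω x y)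
        (Cubic-* ωx (Cubic-* ωy ωy))))
  ... | inj₂ (inj₁ ωx) | inj₂ (inj₂ ωωy) = inj₁ (Cubic-cancelˡ (cube-Cubic ω≢0) (subst Cubic
        (solve 3 (λ w x y → (w :* x) :* (w :* (w :* y)) := (w :* (w :* w)) :* (x :* y)) refl ω x y)
        (Cubic-* ωx ωωy)))
  ... | inj₂ (inj₂ ωωx) | inj₂ (inj₁ ωy) = inj₁ (Cubic-cancelˡ (cube-Cubic ω≢0) (subst Cubic
        (solve 3 (λ w x y → (w :* (w :* x)) :* (w :* y) := (w :* (w :* w)) :* (x :* y)) refl ω x y)
        (Cubic-* ωωx ωy)))
  ... | inj₂ (inj₂ ωωx) | inj₂ (inj₂ ωωy) = inj₂ (Cubic-cancelˡ (cube-Cubic (*≢0 ω≢0 ω≢0)) (subst Cubic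
        (solve 3 (λ w x y → (w :* (w :* x)) :* ((w :* (w :* y)) :* (w :* (w :* y)))
          := ((w :* w) :* ((w :* w) :* (w :* w))) :* (x :* (y :* y))) refl ω x y)
        (Cubic-* ωωx (Cubic-* ωωy ωωy))))

  S-Cubic : ∀ {k} → Cubic k → S k ≡ ℤ.- (+ 2 ℤ.* σ)
  S-Cubic {k} k∈ = root-4x² σ≡1mod3 (S≡1mod3 k) (trans (S-square (Cubic≢0 k∈))
    (cong₂ (λ i j → i ℤ.* (1ℤ ℤ.+ + 3 ℤ.* j)) (sym σ²≡q) (𝟙-yes (cubic? k) k∈)))

  S-nonCubic : ∀ {k} → k ≢ 0# → ¬ Cubic k → S k ≡ σ
  S-nonCubic {k} k≢0 k∉ = root-x² σ≡1mod3 (S≡1mod3 k) (trans (S-square k≢0)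
    (trans (cong₂ (λ i j → i ℤ.* (1ℤ ℤ.+ + 3 ℤ.* j)) (sym σ²≡q) (𝟙-no (cubic? k) k∉)) (ℤ.*-identityʳ _)))

  S0≡q : S 0# ≡ + q
  S0≡q = trans (∑-cong (λ y → trans (cong ψ (zeroˡ (cube y))) ψ0≡1)) (trans (∑-const 1ℤ) (ℤ.*-identityʳ (+ q)))

  -- This form of the three values of S is affine in the two indicators, so a sum of values of S
  -- over a line can be read as a count of cubes and zeros.
  S-value : ∀ k → S k ≡ σ ℤ.+ (ℤ.- (+ 3 ℤ.* σ)) ℤ.* 𝟙 (cubic? k) ℤ.+ (+ q ℤ.- σ) ℤ.* 𝟙 (k ≟ 0#)
  S-value k with k ≟ 0# | cubic? k
  ... | yes refl | yes 0∈ = contradiction refl (Cubic≢0 0∈)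
  ... | yes refl | no  _  = trans S0≡q (Identity.at-zero σ (+ q))
  ... | no  k≢0 | yes k∈ = trans (S-Cubic k∈) (Identity.at-cube σ (+ q))
  ... | no  k≢0 | no  k∉ = trans (S-nonCubic k≢0 k∉) (Identity.at-noncube σ (+ q))

  module Diagonal (α β : Carrier) (αβ-Cubic : Cubic (α * β)) where

    α≢0 : α ≢ 0#
    α≢0 refl = Cubic≢0 αβ-Cubic (zeroˡ β)

    β≢0 : β ≢ 0#
    β≢0 refl = Cubic≢0 αβ-Cubic (zeroʳ α)

    -- Only the points (1 : t) are counted; at (0 : 1) the form has the nonzero value β.
    zeros : ℤ
    zeros = ∑ (λ t → 𝟙 (α + β * cube t ≟ 0#))

    -- The separate first term belongs to the point (0 : 1), the sum to the points (1 : t).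
    cubics : Carrier → ℤ
    cubics k = 𝟙 (cubic? (k * β)) ℤ.+ ∑ (λ t → 𝟙 (cubic? (k * (α + β * cube t))))

    -- A zero solves (β/α) t³ = 1, and β/α = αβ/α² is a cube exactly when α is.
    zeros≡3𝟙 : zeros ≡ + 3 ℤ.* 𝟙 (cubic? α)
    zeros≡3𝟙 = begin
      zeros
        ≡⟨ ∑-cong (λ t → 𝟙-cong (α + β * cube t ≟ 0#) ((α ⁻¹ * β) * cube t ≟ 1#) (forwards t) (backwards t)) ⟩
      ∑ (λ t → 𝟙 ((α ⁻¹ * β) * cube t ≟ 1#))  ≡⟨ ∑-*cube≡1 (α ⁻¹ * β) ⟩
      + 3 ℤ.* 𝟙 (cubic? (α ⁻¹ * β))
        ≡⟨ cong (λ i → + 3 ℤ.* i) (𝟙-cong (cubic? (α ⁻¹ * β)) (cubic? α)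
             (λ β/α∈ → square-Cubic (Cubic-cancelˡ β/α∈ (subst Cubic αβ≡ αβ-Cubic)))
             (λ α∈ → Cubic-cancelˡ (Cubic-* α∈ α∈) (subst Cubic (trans αβ≡ (*-comm _ _)) αβ-Cubic))) ⟩
      + 3 ℤ.* 𝟙 (cubic? α) ∎
      where
      open ≡-Reasoning
      α⁻¹α : ∀ x → α * (α ⁻¹ * x) ≡ x
      α⁻¹α = a*b≡1⇒a*[b*x]≡x (⁻¹-inverseʳ α≢0)
      αβ≡ : α * β ≡ (α ⁻¹ * β) * (α * α)
      αβ≡ = trans (cong (_*_ α) (sym (α⁻¹α β)))
        (solve 3 (λ a b i → a :* (a :* (i :* b)) := (i :* b) :* (a :* a)) refl α β (α ⁻¹))
      forwards : ∀ t → α + β * cube t ≡ 0# → (α ⁻¹ * β) * cube t ≡ 1#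
      forwards t eq = *-cancelˡ α≢0 (trans (trans (cong (_*_ α) (*-assoc _ β (cube t))) (α⁻¹α _))
        (trans (sym (x+y≡0⇒x≡y eq)) (sym (*-identityʳ α))))
      backwards : ∀ t → (α ⁻¹ * β) * cube t ≡ 1# → α + β * cube t ≡ 0#
      backwards t eq = trans (cong (_+_ α) (begin
        β * cube t                ≡⟨ α⁻¹α _ ⟨
        α * (α ⁻¹ * (β * cube t)) ≡⟨ cong (_*_ α) (*-assoc _ β (cube t)) ⟨
        α * (α ⁻¹ * β * cube t)   ≡⟨ cong (_*_ α) eq ⟩
        α * 1#                    ≡⟨ *-identityʳ α ⟩
        α                         ∎)) (x+x≡0 α)

    private
      3σ : ℤ
      3σ = + 3 ℤ.* σ

    -- Both sides are ∑ₛ ∑ₜ ψ (k (α s³ + β t³)), up to the terms with s = 0; for s ≠ 0 replace t by s t.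
    S*S≡∑S : ∀ k → S (k * α) ℤ.* S (k * β) ≡ ∑ (λ t → S (k * (α + β * cube t))) ℤ.+ (S (k * β) ℤ.- + q)
    S*S≡∑S k = begin
      S (k * α) ℤ.* S (k * β)
        ≡⟨ *-distribʳ-∑ (S (k * β)) _ ⟩
      ∑ (λ s → ψ (k * α * cube s) ℤ.* S (k * β))
        ≡⟨ ∑-cong slice ⟩
      ∑ (λ s → ∑ (λ t → ψ (k * (α + β * cube t) * cube s)) ℤ.+ 𝟙 (s ≟ 0#) ℤ.* (S (k * β) ℤ.- + q))
        ≡⟨ ∑-distrib-+ _ _ ⟩
      ∑ (λ s → ∑ (λ t → ψ (k * (α + β * cube t) * cube s))) ℤ.+ ∑ (λ s → 𝟙 (s ≟ 0#) ℤ.* (S (k * β) ℤ.- + q))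
        ≡⟨ cong₂ ℤ._+_ (∑-swap (λ s t → ψ (k * (α + β * cube t) * cube s)))
             (trans (sym (*-distribʳ-∑ _ (λ s → 𝟙 (s ≟ 0#)))) (trans (cong (ℤ._* (S (k * β) ℤ.- + q)) (∑-𝟙≟ 0#)) (ℤ.*-identityˡ _))) ⟩
      ∑ (λ t → S (k * (α + β * cube t))) ℤ.+ (S (k * β) ℤ.- + q) ∎
      where
      open ≡-Reasoning
      slice : ∀ s → ψ (k * α * cube s) ℤ.* S (k * β) ≡
                    ∑ (λ t → ψ (k * (α + β * cube t) * cube s)) ℤ.+ 𝟙 (s ≟ 0#) ℤ.* (S (k * β) ℤ.- + q)
      slice s with s ≟ 0#
      ... | yes refl = begin
        ψ (k * α * cube 0#) ℤ.* S (k * β)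
          ≡⟨ cong (ℤ._* S (k * β)) (ψ-*cube0 (k * α)) ⟩
        1ℤ ℤ.* S (k * β)
          ≡⟨ Identity.rearrange (S (k * β)) (+ q) ⟩
        + q ℤ.* 1ℤ ℤ.+ 1ℤ ℤ.* (S (k * β) ℤ.- + q)
          ≡⟨ cong (ℤ._+ 1ℤ ℤ.* (S (k * β) ℤ.- + q)) (trans (∑-cong (λ t → ψ-*cube0 (k * (α + β * cube t)))) (∑-const 1ℤ)) ⟨
        ∑ (λ t → ψ (k * (α + β * cube t) * cube 0#)) ℤ.+ 1ℤ ℤ.* (S (k * β) ℤ.- + q) ∎
        where
        ψ-*cube0 : ∀ x → ψ (x * cube 0#) ≡ 1ℤ
        ψ-*cube0 x = trans (cong ψ (trans (cong (_*_ x) (zeroˡ _)) (zeroʳ x))) ψ0≡1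
      ... | no s≢0 = begin
        ψ (k * α * cube s) ℤ.* S (k * β)
          ≡⟨ cong (λ i → ψ (k * α * cube s) ℤ.* i) (∑-reindex (_*_ s) (_*_ (s ⁻¹))
               (a*b≡1⇒a*[b*x]≡x (trans (*-comm _ s) (⁻¹-inverseʳ s≢0))) (a*b≡1⇒a*[b*x]≡x (⁻¹-inverseʳ s≢0)) (λ t → ψ (k * β * cube t))) ⟩
        ψ (k * α * cube s) ℤ.* ∑ (λ t → ψ (k * β * cube (s * t)))
          ≡⟨ *-distribˡ-∑ (ψ (k * α * cube s)) (λ t → ψ (k * β * cube (s * t))) ⟩
        ∑ (λ t → ψ (k * α * cube s) ℤ.* ψ (k * β * cube (s * t)))
          ≡⟨ ∑-cong (λ t → trans (sym (ψ-+ (k * α * cube s) _)) (cong ψ (solve 5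
               (λ k a b s t → k :* a :* (s :* (s :* s)) :+ k :* b :* ((s :* t) :* ((s :* t) :* (s :* t)))
                 := k :* (a :+ b :* (t :* (t :* t))) :* (s :* (s :* s))) refl k α β s t))) ⟩
        ∑ (λ t → ψ (k * (α + β * cube t) * cube s))
          ≡⟨ ℤ.+-identityʳ _ ⟨
        ∑ (λ t → ψ (k * (α + β * cube t) * cube s)) ℤ.+ 0ℤ
          ≡⟨ cong (λ i → ∑ (λ t → ψ (k * (α + β * cube t) * cube s)) ℤ.+ i) (ℤ.*-zeroˡ (S (k * β) ℤ.- + q)) ⟨
        ∑ (λ t → ψ (k * (α + β * cube t) * cube s)) ℤ.+ 0ℤ ℤ.* (S (k * β) ℤ.- + q) ∎

    -- Inserting `S-value` for every point into `S*S≡∑S` leaves the two counts. As k ≠ 0, the zeros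
    -- of k times the form are those of the form itself.
    S*S≡cubics : ∀ {k} → k ≢ 0# → S (k * α) ℤ.* S (k * β) ≡
      + q ℤ.* σ ℤ.+ σ ℤ.- + q ℤ.- 3σ ℤ.* cubics k ℤ.+ (+ q ℤ.- σ) ℤ.* zeros
    S*S≡cubics {k} k≢0 = begin
      S (k * α) ℤ.* S (k * β)
        ≡⟨ S*S≡∑S k ⟩
      ∑ (λ t → S (k * (α + β * cube t))) ℤ.+ (S (k * β) ℤ.- + q)
        ≡⟨ cong₂ (λ i j → i ℤ.+ (j ℤ.- + q)) (begin
             ∑ (λ t → S (k * (α + β * cube t)))
               ≡⟨ ∑-cong (λ t → trans (S-value (k * (α + β * cube t)))
                    (cong (λ i → σ ℤ.+ (ℤ.- 3σ) ℤ.* 𝟙 (cubic? (k * (α + β * cube t))) ℤ.+ (+ q ℤ.- σ) ℤ.* i)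
                      (𝟙-cong (k * (α + β * cube t) ≟ 0#) (α + β * cube t ≟ 0#)
                        (λ eq → case x*y≡0⇒x≡0⊎y≡0 eq of λ { (inj₁ k≡0) → contradiction k≡0 k≢0 ; (inj₂ f≡0) → f≡0 })
                        (λ f≡0 → trans (cong (_*_ k) f≡0) (zeroʳ k))))) ⟩
             ∑ (λ t → σ ℤ.+ (ℤ.- 3σ) ℤ.* 𝟙 (cubic? (k * (α + β * cube t))) ℤ.+ (+ q ℤ.- σ) ℤ.* 𝟙 (α + β * cube t ≟ 0#))
               ≡⟨ ∑-distrib-+ _ _ ⟩
             ∑ (λ t → σ ℤ.+ (ℤ.- 3σ) ℤ.* 𝟙 (cubic? (k * (α + β * cube t)))) ℤ.+ ∑ (λ t → (+ q ℤ.- σ) ℤ.* 𝟙 (α + β * cube t ≟ 0#))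
               ≡⟨ cong₂ ℤ._+_ (trans (∑-distrib-+ (λ _ → σ) _)
                    (cong₂ ℤ._+_ (∑-const σ) (sym (*-distribˡ-∑ (ℤ.- 3σ) (λ t → 𝟙 (cubic? (k * (α + β * cube t))))))))
                    (sym (*-distribˡ-∑ (+ q ℤ.- σ) (λ t → 𝟙 (α + β * cube t ≟ 0#)))) ⟩
             + q ℤ.* σ ℤ.+ (ℤ.- 3σ) ℤ.* ∑ (λ t → 𝟙 (cubic? (k * (α + β * cube t)))) ℤ.+ (+ q ℤ.- σ) ℤ.* zeros ∎)
             (trans (S-value (k * β)) (cong (λ i → σ ℤ.+ (ℤ.- 3σ) ℤ.* 𝟙 (cubic? (k * β)) ℤ.+ (+ q ℤ.- σ) ℤ.* i)
               (𝟙-no (k * β ≟ 0#) (*≢0 k≢0 β≢0)))) ⟩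
      + q ℤ.* σ ℤ.+ (ℤ.- 3σ) ℤ.* ∑ (λ t → 𝟙 (cubic? (k * (α + β * cube t)))) ℤ.+ (+ q ℤ.- σ) ℤ.* zeros
        ℤ.+ (σ ℤ.+ (ℤ.- 3σ) ℤ.* 𝟙 (cubic? (k * β)) ℤ.+ (+ q ℤ.- σ) ℤ.* 0ℤ ℤ.- + q)
        ≡⟨ Identity.collect (+ q) σ (∑ (λ t → 𝟙 (cubic? (k * (α + β * cube t))))) (𝟙 (cubic? (k * β))) zeros ⟩
      + q ℤ.* σ ℤ.+ σ ℤ.- + q ℤ.- 3σ ℤ.* cubics k ℤ.+ (+ q ℤ.- σ) ℤ.* zeros ∎
      where
      open ≡-Reasoning

    private
      σ≢0 : ℤ.NonZero σ
      σ≢0 = ℤ.≢-nonZero {σ} (λ σ≡0 → ℕ.≢-nonZero⁻¹ q {{ℕ.m^n≢0 2 n}} (ℤ.+-injective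
        (trans (sym σ²≡q) (cong (λ i → i ℤ.* i) σ≡0))))

      -- y is the product of the two sums in units of q = σ², and 3 z is the number of zeros. With q
      -- written as σ², one factor σ cancels from `S*S≡cubics`.
      cubics-from : ∀ {k} → k ≢ 0# → ∀ y z → S (k * α) ℤ.* S (k * β) ≡ y ℤ.* (σ ℤ.* σ) → zeros ≡ + 3 ℤ.* z →
                    + 3 ℤ.* cubics k ≡ + q ℤ.+ 1ℤ ℤ.- σ ℤ.+ + 3 ℤ.* z ℤ.* (σ ℤ.- 1ℤ) ℤ.- y ℤ.* σ
      cubics-from {k} k≢0 y z SS≡ zeros≡ = ℤ.*-cancelˡ-≡ σ _ _ {{σ≢0}} (begin
        σ ℤ.* (+ 3 ℤ.* cubics k)
          ≡⟨ Identity.isolate (+ q) σ (cubics k) zeros ⟩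
        + q ℤ.* σ ℤ.+ σ ℤ.- + q ℤ.+ (+ q ℤ.- σ) ℤ.* zeros
          ℤ.- (+ q ℤ.* σ ℤ.+ σ ℤ.- + q ℤ.- 3σ ℤ.* cubics k ℤ.+ (+ q ℤ.- σ) ℤ.* zeros)
          ≡⟨ cong (λ i → + q ℤ.* σ ℤ.+ σ ℤ.- + q ℤ.+ (+ q ℤ.- σ) ℤ.* zeros ℤ.- i) (trans (sym (S*S≡cubics k≢0)) SS≡) ⟩
        + q ℤ.* σ ℤ.+ σ ℤ.- + q ℤ.+ (+ q ℤ.- σ) ℤ.* zeros ℤ.- y ℤ.* (σ ℤ.* σ)
          ≡⟨ cong₂ (λ p x → p ℤ.* σ ℤ.+ σ ℤ.- p ℤ.+ (p ℤ.- σ) ℤ.* x ℤ.- y ℤ.* (σ ℤ.* σ)) (sym σ²≡q) zeros≡ ⟩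
        (σ ℤ.* σ) ℤ.* σ ℤ.+ σ ℤ.- σ ℤ.* σ ℤ.+ (σ ℤ.* σ ℤ.- σ) ℤ.* (+ 3 ℤ.* z) ℤ.- y ℤ.* (σ ℤ.* σ)
          ≡⟨ Identity.extract σ y z ⟩
        σ ℤ.* (σ ℤ.* σ ℤ.+ 1ℤ ℤ.- σ ℤ.+ + 3 ℤ.* z ℤ.* (σ ℤ.- 1ℤ) ℤ.- y ℤ.* σ)
          ≡⟨ cong (λ p → σ ℤ.* (p ℤ.+ 1ℤ ℤ.- σ ℤ.+ + 3 ℤ.* z ℤ.* (σ ℤ.- 1ℤ) ℤ.- y ℤ.* σ)) σ²≡q ⟩
        σ ℤ.* (+ q ℤ.+ 1ℤ ℤ.- σ ℤ.+ + 3 ℤ.* z ℤ.* (σ ℤ.- 1ℤ) ℤ.- y ℤ.* σ) ∎)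
        where
        open ≡-Reasoning

    β-Cubic : Cubic α → Cubic β
    β-Cubic α∈ = Cubic-cancelˡ α∈ αβ-Cubic

    α-Cubic : Cubic β → Cubic α
    α-Cubic β∈ = Cubic-cancelˡ β∈ (subst Cubic (*-comm α β) αβ-Cubic)

    nonCubic-* : ∀ {x y} → Cubic x → ¬ Cubic y → ¬ Cubic (y * x)
    nonCubic-* {x} {y} x∈ y∉ yx∈ = y∉ (Cubic-cancelˡ x∈ (subst Cubic (*-comm y x) yx∈))

    zeros-split : Cubic α → zeros ≡ + 3 ℤ.* 1ℤ
    zeros-split α∈ = trans zeros≡3𝟙 (cong (λ i → + 3 ℤ.* i) (𝟙-yes (cubic? α) α∈))

    zeros-irreducible : ¬ Cubic α → zeros ≡ + 3 ℤ.* 0ℤ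
    zeros-irreducible α∉ = trans zeros≡3𝟙 (cong (λ i → + 3 ℤ.* i) (𝟙-no (cubic? α) α∉))

    cubics-split-Cubic : ∀ {k} → Cubic α → Cubic k → + 3 ℤ.* cubics k ≡ + q ℤ.- + 2 ℤ.* σ ℤ.- + 2
    cubics-split-Cubic {k} α∈ k∈ = trans
      (cubics-from (Cubic≢0 k∈) (+ 4) 1ℤ
        (trans (cong₂ ℤ._*_ (S-Cubic (Cubic-* k∈ α∈)) (S-Cubic (Cubic-* k∈ (β-Cubic α∈)))) (Identity.square σ)) (zeros-split α∈))
      (Identity.simplify₁ (+ q) σ)

    cubics-split-nonCubic : ∀ {k} → Cubic α → k ≢ 0# → ¬ Cubic k → + 3 ℤ.* cubics k ≡ + q ℤ.+ σ ℤ.- + 2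
    cubics-split-nonCubic {k} α∈ k≢0 k∉ = trans
      (cubics-from k≢0 1ℤ 1ℤ
        (trans (cong₂ ℤ._*_ (S-nonCubic (*≢0 k≢0 α≢0) (nonCubic-* α∈ k∉)) (S-nonCubic (*≢0 k≢0 β≢0) (nonCubic-* (β-Cubic α∈) k∉)))
          (sym (ℤ.*-identityˡ _))) (zeros-split α∈))
      (Identity.simplify₂ (+ q) σ)

    -- Neither kα nor kβ is a cube: k being one, α would be a cube in the first case and β, hence α,
    -- in the second.
    cubics-irreducible-Cubic : ∀ {k} → ¬ Cubic α → Cubic k → + 3 ℤ.* cubics k ≡ + q ℤ.- + 2 ℤ.* σ ℤ.+ 1ℤ
    cubics-irreducible-Cubic {k} α∉ k∈ = trans
      (cubics-from k≢0 1ℤ 0ℤ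
        (trans (cong₂ ℤ._*_ (S-nonCubic (*≢0 k≢0 α≢0) (α∉ ∘ Cubic-cancelˡ k∈))
                            (S-nonCubic (*≢0 k≢0 β≢0) (α∉ ∘ α-Cubic ∘ Cubic-cancelˡ k∈)))
          (sym (ℤ.*-identityˡ _))) (zeros-irreducible α∉))
      (Identity.simplify₃ (+ q) σ)
      where
      k≢0 = Cubic≢0 k∈

    -- k, α and β lie in the two nontrivial classes and α, β in different ones, so exactly one of kα, kβ is a cube.
    S*S-irreducible : ∀ {k} → ¬ Cubic α → k ≢ 0# → ¬ Cubic k → S (k * α) ℤ.* S (k * β) ≡ ℤ.- + 2 ℤ.* (σ ℤ.* σ)
    S*S-irreducible {k} α∉ k≢0 k∉ with nonCubic-product k≢0 α≢0 k∉ α∉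
    ... | inj₁ kα∈ = trans (cong₂ ℤ._*_ (S-Cubic kα∈) (S-nonCubic (*≢0 k≢0 β≢0) (not-both kα∈))) (Identity.left σ)
      where
      not-both : Cubic (k * α) → ¬ Cubic (k * β)
      not-both kα∈ kβ∈ = k∉ (square-Cubic (Cubic-cancelˡ αβ-Cubic (subst Cubic
        (solve 3 (λ k a b → (k :* a) :* (k :* b) := (a :* b) :* (k :* k)) refl k α β) (Cubic-* kα∈ kβ∈))))
    ... | inj₂ kαα∈ = trans (cong₂ ℤ._*_ (S-nonCubic (*≢0 k≢0 α≢0) kα∉) (S-Cubic kβ∈)) (Identity.right σ)
      where
      kα∉ : ¬ Cubic (k * α)
      kα∉ kα∈ = α∉ (Cubic-cancelˡ kα∈ (subst Cubic (sym (*-assoc k α α)) kαα∈))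
      kβ∈ : Cubic (k * β)
      kβ∈ = Cubic-cancelˡ (cube-Cubic α≢0) (subst Cubic
        (solve 3 (λ k a b → (k :* (a :* a)) :* (a :* b) := (a :* (a :* a)) :* (k :* b)) refl k α β) (Cubic-* kαα∈ αβ-Cubic))

    cubics-irreducible-nonCubic : ∀ {k} → ¬ Cubic α → k ≢ 0# → ¬ Cubic k → + 3 ℤ.* cubics k ≡ + q ℤ.+ σ ℤ.+ 1ℤ
    cubics-irreducible-nonCubic {k} α∉ k≢0 k∉ = trans
      (cubics-from k≢0 (ℤ.- + 2) 0ℤ (S*S-irreducible α∉ k≢0 k∉) (zeros-irreducible α∉))
      (Identity.simplify₄ (+ q) σ)

-- Binary cubic forms, substitutions, and cubics with a unique root.

module BinaryCubic {c : Level} (n : ℕ) (𝔽 : FiniteField c (2 ℕ.^ n))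
  (ζ : FiniteField.Carrier 𝔽) (ζ²+ζ≡1 : Character.℘ n 𝔽 ζ ≡ FiniteField.1# 𝔽)
  where

  open FiniteField 𝔽 using (Carrier)
  open Character n 𝔽
  open Solver₂ using (solve; _:=_; _:+_; _:*_; con)

  Form : Set c
  Form = Carrier → Carrier → Carrier

  cubicForm : (a b c d : Carrier) → Form
  cubicForm a b c d s t = a * cube s + b * (s * s * t) + c * (s * (t * t)) + d * cube t

  diagonal : (α β : Carrier) → Form
  diagonal α β s t = α * cube s + β * cube t

  infix 4 _≅_
  -- The new basis vectors are (x, y) and (z, w), and g is f in the new coordinates.
  record _≅_ (f g : Form) : Set c where
    field
      x y z w     : Carrier
      det≢0       : x * w + y * z ≢ 0#
      substitutes : ∀ s t → f (s * x + t * z) (s * y + t * w) ≡ g s t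

    det = x * w + y * z

    -- Cramer's rule for the substitution, with the signs gone in characteristic 2.
    solve-x : ∀ s t → ((s * w + t * z) * det ⁻¹) * x + ((s * y + t * x) * det ⁻¹) * z ≡ s
    solve-x s t = trans
      (solve 7 (λ x y z w s t i → ((s :* w :+ t :* z) :* i) :* x :+ ((s :* y :+ t :* x) :* i) :* z
        := s :* ((x :* w :+ y :* z) :* i)) refl x y z w s t (det ⁻¹))
      (trans (cong (_*_ s) (⁻¹-inverseʳ det≢0)) (*-identityʳ s))

    solve-y : ∀ s t → ((s * w + t * z) * det ⁻¹) * y + ((s * y + t * x) * det ⁻¹) * w ≡ t
    solve-y s t = trans
      (solve 7 (λ x y z w s t i → ((s :* w :+ t :* z) :* i) :* y :+ ((s :* y :+ t :* x) :* i) :* w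
        := t :* ((x :* w :+ y :* z) :* i)) refl x y z w s t (det ⁻¹))
      (trans (cong (_*_ t) (⁻¹-inverseʳ det≢0)) (*-identityʳ t))

    substitution-injective : ∀ {s t s′ t′} → s * x + t * z ≡ s′ * x + t′ * z → s * y + t * w ≡ s′ * y + t′ * w →
                             s ≡ s′ × t ≡ t′
    substitution-injective {s} {t} {s′} {t′} eq₁ eq₂ =
      *-cancelˡ det≢0 (trans (sym (first s t)) (trans (cong₂ (λ u v → w * u + z * v) eq₁ eq₂) (first s′ t′))) ,
      *-cancelˡ det≢0 (trans (sym (second s t)) (trans (cong₂ (λ u v → y * u + x * v) eq₁ eq₂) (second s′ t′)))
      where
      first : ∀ s t → w * (s * x + t * z) + z * (s * y + t * w) ≡ det * s
      first s t = solve 6 (λ x y z w s t → w :* (s :* x :+ t :* z) :+ z :* (s :* y :+ t :* w)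
        := (x :* w :+ y :* z) :* s) refl x y z w s t
      second : ∀ s t → y * (s * x + t * z) + x * (s * y + t * w) ≡ det * t
      second s t = solve 6 (λ x y z w s t → y :* (s :* x :+ t :* z) :+ x :* (s :* y :+ t :* w)
        := (x :* w :+ y :* z) :* t) refl x y z w s t

    substitution-nonzero : ∀ {s t} → ¬ (s ≡ 0# × t ≡ 0#) → ¬ (s * x + t * z ≡ 0# × s * y + t * w ≡ 0#)
    substitution-nonzero nonzero (eq₁ , eq₂) =
      nonzero (substitution-injective (trans eq₁ (sym (null x z))) (trans eq₂ (sym (null y w))))
      where
      null : ∀ u v → 0# * u + 0# * v ≡ 0#
      null u v = trans (cong₂ _+_ (zeroˡ u) (zeroˡ v)) (+-identityˡ 0#)

  ≅-pointwise : ∀ {f g : Form} → (∀ s t → f s t ≡ g s t) → f ≅ g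
  ≅-pointwise {f} f≗g = record
    { x = 1# ; y = 0# ; z = 0# ; w = 1#
    ; det≢0 = λ det≡0 → 1≢0 (trans (solve 0 (con true := con true :* con true :+ con false :* con false) refl) det≡0)
    ; substitutes = λ s t → trans (cong₂ f
        (solve 2 (λ s t → s :* con true :+ t :* con false := s) refl s t)
        (solve 2 (λ s t → s :* con false :+ t :* con true := t) refl s t)) (f≗g s t)
    }

  ≅-trans : ∀ {f g h} → f ≅ g → g ≅ h → f ≅ h
  ≅-trans {f} f≅g g≅h = record
    { x = H.x * G.x + H.y * G.z
    ; y = H.x * G.y + H.y * G.w
    ; z = H.z * G.x + H.w * G.z
    ; w = H.z * G.y + H.w * G.w
    ; det≢0 = λ det≡0 → *≢0 G.det≢0 H.det≢0 (trans
        (solve 8 (λ x y z w x′ y′ z′ w′ → (x :* w :+ y :* z) :* (x′ :* w′ :+ y′ :* z′)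
          := (x′ :* x :+ y′ :* z) :* (z′ :* y :+ w′ :* w) :+ (x′ :* y :+ y′ :* w) :* (z′ :* x :+ w′ :* z))
          refl G.x G.y G.z G.w H.x H.y H.z H.w) det≡0)
    ; substitutes = λ s t → trans
        (cong₂ f (compose s t H.x H.y H.z H.w G.x G.z) (compose s t H.x H.y H.z H.w G.y G.w))
        (trans (G.substitutes (s * H.x + t * H.z) (s * H.y + t * H.w)) (H.substitutes s t))
    }
    where
    module G = _≅_ f≅g
    module H = _≅_ g≅h
    compose : ∀ s t x′ y′ z′ w′ x z → s * (x′ * x + y′ * z) + t * (z′ * x + w′ * z) ≡
                                      (s * x′ + t * z′) * x + (s * y′ + t * w′) * z
    compose = solve 8 (λ s t x′ y′ z′ w′ x z → s :* (x′ :* x :+ y′ :* z) :+ t :* (z′ :* x :+ w′ :* z)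
      := (s :* x′ :+ t :* z′) :* x :+ (s :* y′ :+ t :* w′) :* z) refl

  -- Projectively, f has one or two zeros.
  record FewZeros (f : Form) : Set c where
    field
      s₁ t₁ s₂ t₂ : Carrier
      nonzero     : ¬ (s₁ ≡ 0# × t₁ ≡ 0#)
      isZero      : f s₁ t₁ ≡ 0#
      covers      : ∀ s t → f s t ≡ 0# →
                    (∃[ k ] (s ≡ k * s₁ × t ≡ k * t₁)) ⊎ (∃[ k ] (s ≡ k * s₂ × t ≡ k * t₂))

  FewZeros-≅ : ∀ {f g} → f ≅ g → FewZeros g → FewZeros f
  FewZeros-≅ {f} {g} f≅g few = record
    { s₁ = s₁ * x + t₁ * z
    ; t₁ = s₁ * y + t₁ * w
    ; s₂ = s₂ * x + t₂ * z
    ; t₂ = s₂ * y + t₂ * w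
    ; nonzero = substitution-nonzero nonzero
    ; isZero = trans (substitutes s₁ t₁) isZero
    ; covers = covers′
    }
    where
    open _≅_ f≅g
    open FewZeros few
    scale : ∀ {s t} k s′ t′ u v → s ≡ k * s′ → t ≡ k * t′ → s * u + t * v ≡ k * (s′ * u + t′ * v)
    scale k s′ t′ u v refl refl =
      solve 5 (λ s t k u v → (k :* s) :* u :+ (k :* t) :* v := k :* (s :* u :+ t :* v)) refl s′ t′ k u v

    covers′ : ∀ s t → f s t ≡ 0# →
      (∃[ k ] (s ≡ k * (s₁ * x + t₁ * z) × t ≡ k * (s₁ * y + t₁ * w))) ⊎
      (∃[ k ] (s ≡ k * (s₂ * x + t₂ * z) × t ≡ k * (s₂ * y + t₂ * w)))
    covers′ s t fst≡0 = Sum.map (image s₁ t₁) (image s₂ t₂)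
      (covers s° t° (trans (sym (substitutes s° t°)) (trans (cong₂ f (solve-x s t) (solve-y s t)) fst≡0)))
      where
      s° t° : Carrier
      s° = (s * w + t * z) * det ⁻¹
      t° = (s * y + t * x) * det ⁻¹
      image : ∀ s′ t′ → ∃[ k ] (s° ≡ k * s′ × t° ≡ k * t′) →
              ∃[ k ] (s ≡ k * (s′ * x + t′ * z) × t ≡ k * (s′ * y + t′ * w))
      image s′ t′ (k , eq₁ , eq₂) = k , trans (sym (solve-x s t)) (scale k s′ t′ x z eq₁ eq₂) ,
                                        trans (sym (solve-y s t)) (scale k s′ t′ y w eq₁ eq₂)

  -- As Tr 1 = 0, the equation r³ + A r = B has exactly one root if (and only if) Tr(A³/B²) = 1.
  module Berlekamp (A : Carrier) (A≢0 : A ≢ 0#) where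

    g : Carrier → Carrier
    g r = r * (r * r + A)

    resolvent : Carrier → Carrier
    resolvent B = cube A * (B ⁻¹ * B ⁻¹)

    A/_² : Carrier → Carrier
    A/ r ² = A * (r ⁻¹ * r ⁻¹)

    1∈Image℘ : Image℘ 1#
    1∈Image℘ = ζ , ζ²+ζ≡1

    -- By the convention 0⁻¹ = 0, the quotient at r = 0 is 0 = ℘ 0, which puts r = 0 into the other
    -- class.
    ∉⇒≢0 : ∀ {r} → ¬ Image℘ (A/ r ²) → r ≢ 0#
    ∉⇒≢0 r∉ refl = r∉ (0# , sym (trans (cong (λ i → A * (i * i)) 0⁻¹≡0)
      (solve 1 (λ a → a :* (con false :* con false) := con false :* con false :+ con false) refl A)))

    -- A nonzero root r of g has r² = A, so A/r² = 1, an element of the image of ℘.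
    g≢0 : ∀ {r} → ¬ Image℘ (A/ r ²) → g r ≢ 0#
    g≢0 {r} r∉ gr≡0 with x*y≡0⇒x≡0⊎y≡0 gr≡0
    ... | inj₁ r≡0 = ∉⇒≢0 r∉ r≡0
    ... | inj₂ r²+A≡0 = r∉ (subst Image℘ (sym (begin
        A * (r ⁻¹ * r ⁻¹)        ≡⟨ cong (_* (r ⁻¹ * r ⁻¹)) (x+y≡0⇒x≡y r²+A≡0) ⟨
        r * r * (r ⁻¹ * r ⁻¹)    ≡⟨ solve 2 (λ r i → r :* r :* (i :* i) := (r :* i) :* (r :* i)) refl r (r ⁻¹) ⟩
        (r * r ⁻¹) * (r * r ⁻¹)  ≡⟨ cong (λ e → e * e) (⁻¹-inverseʳ (∉⇒≢0 r∉)) ⟩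
        1# * 1#                  ≡⟨ *-identityˡ 1# ⟩
        1#                       ∎)) 1∈Image℘)
      where open ≡-Reasoning

    -- With u = A/r² the two elements differ by u/(1 + u)² = ℘(1/(1 + u)), and 1/(1 + u) = r³/g(r).
    resolvent-g : ∀ {r} → r ≢ 0# → g r ≢ 0# → ℘ (cube r * g r ⁻¹) ≡ resolvent (g r) + A/ r ²
    resolvent-g {r} r≢0 gr≢0 = begin
      ℘ (cube r * j)
        ≡⟨ solve 2 (λ x j → (x :* j) :* (x :* j) :+ x :* j := (j :* x) :* (j :* x :+ con true)) refl (cube r) j ⟩
      (j * cube r) * (j * cube r + 1#)
        ≡⟨ cong (λ e → (j * cube r) * (j * cube r + e)) (⁻¹-inverseʳ gr≢0) ⟨
      (j * cube r) * (j * cube r + g r * j)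
        ≡⟨ solve 3 (λ r j a → (j :* (r :* (r :* r))) :* (j :* (r :* (r :* r)) :+ r :* (r :* r :+ a) :* j)
             := a :* (j :* j) :* (a :* a :+ (r :* r :+ a) :* (r :* r :+ a) )) refl r j A ⟩
      A * (j * j) * (A * A + (r * r + A) * (r * r + A))
        ≡⟨ cong (λ e → A * (j * j) * (A * A + e * e)) g*i ⟨
      A * (j * j) * (A * A + (g r * i) * (g r * i))
        ≡⟨ solve 4 (λ g i j a → a :* (j :* j) :* (a :* a :+ (g :* i) :* (g :* i))
             := a :* (a :* a) :* (j :* j) :+ a :* ((i :* (g :* j)) :* (i :* (g :* j)))) refl (g r) i j A ⟩
      cube A * (j * j) + A * ((i * (g r * j)) * (i * (g r * j)))
        ≡⟨ cong (λ e → cube A * (j * j) + A * (e * e)) (trans (cong (_*_ i) (⁻¹-inverseʳ gr≢0)) (*-identityʳ i)) ⟩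
      resolvent (g r) + A/ r ² ∎
      where
      open ≡-Reasoning
      i = r ⁻¹
      j = g r ⁻¹
      g*i : g r * i ≡ r * r + A
      g*i = trans (solve 3 (λ r i e → r :* e :* i := (r :* i) :* e) refl r i (r * r + A))
        (trans (cong (_* (r * r + A)) (⁻¹-inverseʳ r≢0)) (*-identityˡ _))

    resolvent-g∉ : ∀ {r} → ¬ Image℘ (A/ r ²) → ¬ Image℘ (resolvent (g r))
    resolvent-g∉ {r} r∉ gr∈ = r∉ (subst Image℘ (x+[x+y]≡y (resolvent (g r)) (A/ r ²))
      (Image℘-+ gr∈ (cube r * g r ⁻¹ , resolvent-g (∉⇒≢0 r∉) (g≢0 r∉))))

    -- So r ↦ A r translates the condition on A/r² into the same condition on the resolvent of the
    -- value; the convention 0⁻¹ = 0 extends this to r = 0.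
    resolvent-A* : ∀ r → resolvent (A * r) ≡ A/ r ²
    resolvent-A* r = go (r ≟ 0#)
      where
      go : Dec (r ≡ 0#) → resolvent (A * r) ≡ A/ r ²
      go (yes refl) = begin
        cube A * ((A * 0#) ⁻¹ * (A * 0#) ⁻¹)  ≡⟨ cong (λ e → cube A * (e * e)) (trans (cong _⁻¹ (zeroʳ A)) 0⁻¹≡0) ⟩
        cube A * (0# * 0#)                    ≡⟨ solve 1 (λ a → a :* (a :* a) :* (con false :* con false) := a :* (con false :* con false)) refl A ⟩
        A * (0# * 0#)                         ≡⟨ cong (λ e → A * (e * e)) 0⁻¹≡0 ⟨
        A * (0# ⁻¹ * 0# ⁻¹)                   ∎
        where open ≡-Reasoning
      go (no r≢0) = begin
        cube A * (k * k)
          ≡⟨ solve 2 (λ a k → a :* (a :* a) :* (k :* k) := a :* ((a :* k) :* (a :* k))) refl A k ⟩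
        A * ((A * k) * (A * k))
          ≡⟨ cong (λ e → A * (e * e)) (*-cancelˡ r≢0 (trans
               (solve 3 (λ a r k → r :* (a :* k) := (a :* r) :* k) refl A r k)
               (trans (⁻¹-inverseʳ (*≢0 A≢0 r≢0)) (sym (⁻¹-inverseʳ r≢0))))) ⟩
        A * (r ⁻¹ * r ⁻¹) ∎
        where
        open ≡-Reasoning
        k = (A * r) ⁻¹

    -- Two distinct r, r′ with the same value satisfy r² + r r′ + r′² + A = 0. Dividing by r² gives
    -- A/r² = ℘ (r′/r) + 1, which is in the image of ℘ because 1 is.
    g-injective : ∀ {r r′} → ¬ Image℘ (A/ r ²) → g r ≡ g r′ → r ≡ r′
    g-injective {r} {r′} r∉ gr≡gr′ with x*y≡0⇒x≡0⊎y≡0 (begin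
        (r + r′) * (r * r + r * r′ + r′ * r′ + A)
          ≡⟨ solve 3 (λ r s a → (r :+ s) :* (r :* r :+ r :* s :+ s :* s :+ a)
               := r :* (r :* r :+ a) :+ s :* (s :* s :+ a)) refl r r′ A ⟩
        g r + g r′   ≡⟨ cong (_+ g r′) gr≡gr′ ⟩
        g r′ + g r′  ≡⟨ x+x≡0 (g r′) ⟩
        0#           ∎)
      where open ≡-Reasoning
    ... | inj₁ r+r′≡0 = x+y≡0⇒x≡y r+r′≡0
    ... | inj₂ quadratic≡0 = contradiction (subst Image℘ (begin
        ℘ (r′ * i) + 1#
          ≡⟨ cong₂ _+_ (cong (_+_ (r′ * i * (r′ * i))) (*-identityʳ (r′ * i))) (*-identityˡ 1#) ⟨
        (r′ * i * (r′ * i) + r′ * i * 1#) + 1# * 1#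
          ≡⟨ cong (λ e → (r′ * i * (r′ * i) + r′ * i * e) + e * e) (⁻¹-inverseʳ (∉⇒≢0 r∉)) ⟨
        (r′ * i * (r′ * i) + r′ * i * (r * i)) + (r * i) * (r * i)
          ≡⟨ solve 4 (λ r s a i → (s :* i :* (s :* i) :+ s :* i :* (r :* i)) :+ (r :* i) :* (r :* i)
               := a :* (i :* i) :+ (r :* r :+ r :* s :+ s :* s :+ a) :* (i :* i)) refl r r′ A i ⟩
        A/ r ² + (r * r + r * r′ + r′ * r′ + A) * (i * i)
          ≡⟨ cong (λ e → A/ r ² + e * (i * i)) quadratic≡0 ⟩
        A/ r ² + 0# * (i * i)
          ≡⟨ trans (cong (_+_ (A/ r ²)) (zeroˡ _)) (+-identityʳ _) ⟩
        A/ r ² ∎) (Image℘-+ (r′ * i , refl) 1∈Image℘)) r∉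
      where
      open ≡-Reasoning
      i = r ⁻¹

    -- g and r ↦ A r map the two classes of r injectively to complementary sets; hence together they are onto.
    h : Carrier → Carrier
    h r with image℘? (A/ r ²)
    ... | yes _ = A * r
    ... | no  _ = g r

    h-injective : ∀ {r r′} → h r ≡ h r′ → r ≡ r′
    h-injective {r} {r′} eq with image℘? (A/ r ²) | image℘? (A/ r′ ²)
    ... | yes _  | yes _   = *-cancelˡ A≢0 eq
    ... | yes r∈ | no  r′∉ = contradiction
          (subst Image℘ (trans (sym (resolvent-A* r)) (cong resolvent eq)) r∈) (resolvent-g∉ r′∉)
    ... | no  r∉ | yes r′∈ = contradiction
          (subst Image℘ (trans (sym (resolvent-A* r′)) (cong resolvent (sym eq))) r′∈) (resolvent-g∉ r∉)
    ... | no  r∉ | no  _   = g-injective r∉ eq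

    -- The preimage of B under the permutation h cannot come from the branch A r, since there the
    -- resolvent of B would lie in the image of ℘; so it is a root of g r = B, unique by
    -- `g-injective`.
    uniqueRoot : ∀ {B} → ¬ Image℘ (resolvent B) → ∃[ r ] (g r ≡ B × ∀ r′ → g r′ ≡ B → r′ ≡ r)
    uniqueRoot {B} B∉ with r , hr≡B ← injective⇒surjective h h-injective B with image℘? (A/ r ²)
    ... | yes r∈ = contradiction (subst Image℘ (trans (sym (resolvent-A* r)) (cong resolvent hr≡B)) r∈) B∉
    ... | no  r∉ = r , hr≡B , λ r′ gr′≡B → sym (g-injective r∉ (trans hr≡B (sym gr′≡B)))

-- Diagonalization of binary cubic forms.

module NormalForm {c : Level} (n : ℕ) (𝔽 : FiniteField c (2 ℕ.^ n))
  (ζ : FiniteField.Carrier 𝔽) (ζ²+ζ≡1 : Character.℘ n 𝔽 ζ ≡ FiniteField.1# 𝔽)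
  where

  open FiniteField 𝔽 using (Carrier)
  open Character n 𝔽
  open Solver₂ using (solve; _:=_; _:+_; _:*_; con)
  open BinaryCubic n 𝔽 ζ ζ²+ζ≡1

  Diagonalizable : Form → Set c
  Diagonalizable f = ∃[ α ] ∃[ β ] (Cubic (α * β) × f ≅ diagonal α β)

  depressed : (a A B : Carrier) → Form
  depressed a A B s t = a * (cube s + A * (s * (t * t)) + B * cube t)

  -- The form factors as a s (s + √A t)², so its zeros are (0 : 1) and (√A : 1).
  depressed-0 : ∀ {a} A → a ≢ 0# → FewZeros (depressed a A 0#)
  depressed-0 {a} A a≢0 = record
    { s₁ = √ A ; t₁ = 1# ; s₂ = 0# ; t₂ = 1#
    ; nonzero = 1≢0 ∘ proj₂
    ; isZero  = trans
        (solve 3 (λ a x k → a :* (x :* (x :* x) :+ k :* (x :* (con true :* con true)) :+ con false :* (con true :* (con true :* con true)))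
          := a :* (x :* (x :* x :+ k))) refl a (√ A) A)
        (trans (cong (λ e → a * (√ A * (e + A))) (√-square A))
          (solve 3 (λ a x k → a :* (x :* (k :+ k)) := con false) refl a (√ A) A))
    ; covers  = λ s t eq → fromFactor s t (x*y≡0⇒x≡0⊎y≡0 (*-cancelˡ a≢0 (trans (factor s t) (trans eq (sym (zeroʳ a))))))
    }
    where
    open ≡-Reasoning
    factor : ∀ s t → a * (s * ((s + t * √ A) * (s + t * √ A))) ≡ depressed a A 0# s t
    factor s t = begin
      a * (s * ((s + t * √ A) * (s + t * √ A)))
        ≡⟨ solve 4 (λ a s t x → a :* (s :* ((s :+ t :* x) :* (s :+ t :* x))) := a :* (s :* (s :* s) :+ (x :* x) :* (s :* (t :* t))))
             refl a s t (√ A) ⟩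
      a * (cube s + (√ A * √ A) * (s * (t * t)))
        ≡⟨ cong (λ e → a * (cube s + e * (s * (t * t)))) (√-square A) ⟩
      a * (cube s + A * (s * (t * t)))
        ≡⟨ solve 3 (λ a x y → a :* x := a :* (x :+ con false :* y)) refl a _ (cube t) ⟩
      depressed a A 0# s t ∎
    fromFactor : ∀ s t → s ≡ 0# ⊎ (s + t * √ A) * (s + t * √ A) ≡ 0# →
                 (∃[ k ] (s ≡ k * √ A × t ≡ k * 1#)) ⊎ (∃[ k ] (s ≡ k * 0# × t ≡ k * 1#))
    fromFactor s t (inj₁ s≡0) = inj₂ (t , trans s≡0 (sym (zeroʳ t)) , sym (*-identityʳ t))
    fromFactor s t (inj₂ eq)  = inj₁ (t , x+y≡0⇒x≡y (square-injective (trans eq (sym (zeroˡ 0#)))) , sym (*-identityʳ t))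

  -- There is no zero with t = 0 as a ≠ 0, so zeros correspond to roots s/t of r³ + A r = B, and
  -- Berlekamp's criterion leaves exactly one.
  depressed-B : ∀ {a A B} → A ≢ 0# → B ≢ 0# → a ≢ 0# → ¬ Image℘ (cube A * (B ⁻¹ * B ⁻¹)) → FewZeros (depressed a A B)
  depressed-B {a} {A} {B} A≢0 B≢0 a≢0 ∉ = fromRoot (uniqueRoot ∉)
    where
    open Berlekamp A A≢0
    fromRoot : ∃[ r ] (g r ≡ B × ∀ r′ → g r′ ≡ B → r′ ≡ r) → FewZeros (depressed a A B)
    fromRoot (r , gr≡B , unique) = record
      -- The single zero is entered twice.
      { s₁ = r ; t₁ = 1# ; s₂ = r ; t₂ = 1#
      ; nonzero = 1≢0 ∘ proj₂
      ; isZero  = trans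
          (solve 4 (λ a r k b → a :* (r :* (r :* r) :+ k :* (r :* (con true :* con true)) :+ b :* (con true :* (con true :* con true)))
            := a :* (r :* (r :* r :+ k) :+ b)) refl a r A B)
          (trans (cong (λ e → a * (e + B)) gr≡B) (trans (cong (_*_ a) (x+x≡0 B)) (zeroʳ a)))
      ; covers  = λ s t eq → inj₁ (t , covers s t eq (t ≟ 0#))
      }
      where
      covers : ∀ s t → depressed a A B s t ≡ 0# → Dec (t ≡ 0#) → s ≡ t * r × t ≡ t * 1#
      -- For t = 0 the form is a s³, which forces s = 0: the zero vector, covered with the factor t
      -- = 0.
      covers s t eq (yes refl) = trans (cube≡0 (cancel-a (trans
          (solve 4 (λ a s k b → a :* (s :* (s :* s)) := a :* (s :* (s :* s) :+ k :* (s :* (con false :* con false)) :+ b :* (con false :* (con false :* con false))))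
            refl a s A B) eq))) (sym (zeroˡ r)) , sym (*-identityʳ 0#)
        where
        cancel-a : ∀ {x} → a * x ≡ 0# → x ≡ 0#
        cancel-a ax≡0 = *-cancelˡ a≢0 (trans ax≡0 (sym (zeroʳ a)))
      covers s t eq (no t≢0) = trans (sym s′t≡s) (cong (_*_ t) (unique s′ (x+y≡0⇒x≡y gs′+B≡0))) , sym (*-identityʳ t)
        where
        s′ = s * t ⁻¹
        s′t≡s : t * s′ ≡ s
        s′t≡s = trans (solve 3 (λ s t i → t :* (s :* i) := s :* (t :* i)) refl s t (t ⁻¹))
          (trans (cong (_*_ s) (⁻¹-inverseʳ t≢0)) (*-identityʳ s))
        gs′+B≡0 : g s′ + B ≡ 0#
        gs′+B≡0 = *-cancelˡ (*≢0 a≢0 (*≢0 t≢0 (*≢0 t≢0 t≢0))) (begin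
          a * cube t * (g s′ + B)
            ≡⟨ solve 5 (λ a t s k b → a :* (t :* (t :* t)) :* (s :* (s :* s :+ k) :+ b)
                 := a :* ((t :* s) :* ((t :* s) :* (t :* s)) :+ k :* ((t :* s) :* (t :* t)) :+ b :* (t :* (t :* t))))
                 refl a t s′ A B ⟩
          depressed a A B (t * s′) t ≡⟨ cong (λ e → depressed a A B e t) s′t≡s ⟩
          depressed a A B s t        ≡⟨ eq ⟩
          0#                         ≡⟨ zeroʳ _ ⟨
          a * cube t * 0#            ∎)
          where open ≡-Reasoning

  depressed-A≡0 : ∀ {a B} → Cubic (a * (a * B)) → Diagonalizable (depressed a 0# B)
  depressed-A≡0 {a} {B} δ∈ = a , a * B , δ∈ , ≅-pointwise expand
    where
    expand : ∀ s t → depressed a 0# B s t ≡ diagonal a (a * B) s t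
    expand s t = solve 4 (λ a b s t → a :* (s :* (s :* s) :+ con false :* (s :* (t :* t)) :+ b :* (t :* (t :* t)))
      := a :* (s :* (s :* s)) :+ (a :* b) :* (t :* (t :* t))) refl a B s t

  -- The new basis consists of the two zeros of the Hessian A s² + B s t + A² t².
  depressed-℘ : ∀ {a A B z} → A ≢ 0# → B ≢ 0# → Cubic (a * (a * B)) → cube A ≡ ℘ z * (B * B) →
                Diagonalizable (depressed a A B)
  depressed-℘ {a} {A} {B} {z} A≢0 B≢0 δ∈ A³≡ = α , β ,
    subst Cubic (sym αβ≡) (Cubic-* δ∈ (cube-Cubic (*≢0 A≢0 B≢0))) , record
    { x = B * z ; y = A ; z = B * (z + 1#) ; w = A
    ; det≢0 = λ det≡0 → *≢0 A≢0 B≢0 (trans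
        (solve 3 (λ a b z → a :* b := (b :* z) :* a :+ a :* (b :* (z :+ con true))) refl A B z) det≡0)
    ; substitutes = λ s t → begin
        depressed a A B (s * (B * z) + t * (B * (z + 1#))) (s * A + t * A)
          ≡⟨ solve 6 (λ a A B z s t →
               a :* ((s :* (B :* z) :+ t :* (B :* (z :+ con true))) :* ((s :* (B :* z) :+ t :* (B :* (z :+ con true))) :* (s :* (B :* z) :+ t :* (B :* (z :+ con true))))
                 :+ A :* ((s :* (B :* z) :+ t :* (B :* (z :+ con true))) :* ((s :* A :+ t :* A) :* (s :* A :+ t :* A)))
                 :+ B :* ((s :* A :+ t :* A) :* ((s :* A :+ t :* A) :* (s :* A :+ t :* A))))
               := a :* (B :* (B :* B)) :* (((s :+ t) :* z :+ t) :* (((s :+ t) :* z :+ t) :* ((s :+ t) :* z :+ t)))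
                 :+ a :* (A :* (A :* A)) :* (B :* ((s :+ t) :* (s :+ t) :* ((s :+ t) :* z :+ t :+ (s :+ t)))))
               refl a A B z s t ⟩
        a * cube B * cube ((s + t) * z + t) + a * cube A * (B * ((s + t) * (s + t) * ((s + t) * z + t + (s + t))))
          ≡⟨ cong (λ e → a * cube B * cube ((s + t) * z + t) + a * e * (B * ((s + t) * (s + t) * ((s + t) * z + t + (s + t))))) A³≡ ⟩
        a * cube B * cube ((s + t) * z + t) + a * (℘ z * (B * B)) * (B * ((s + t) * (s + t) * ((s + t) * z + t + (s + t))))
          ≡⟨ solve 5 (λ a B z s t →
               a :* (B :* (B :* B)) :* (((s :+ t) :* z :+ t) :* (((s :+ t) :* z :+ t) :* ((s :+ t) :* z :+ t)))
                 :+ a :* ((z :* z :+ z) :* (B :* B)) :* (B :* ((s :+ t) :* (s :+ t) :* ((s :+ t) :* z :+ t :+ (s :+ t))))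
               := a :* (B :* (B :* B)) :* z :* (s :* (s :* s)) :+ a :* (B :* (B :* B)) :* (z :+ con true) :* (t :* (t :* t)))
               refl a B z s t ⟩
        diagonal α β s t ∎
    }
    where
    open ≡-Reasoning
    α = a * cube B * z
    β = a * cube B * (z + 1#)
    αβ≡ : α * β ≡ a * (a * B) * cube (A * B)
    αβ≡ = begin
      α * β
        ≡⟨ solve 3 (λ a B z → (a :* (B :* (B :* B)) :* z) :* (a :* (B :* (B :* B)) :* (z :+ con true))
             := a :* (a :* B) :* (((z :* z :+ z) :* (B :* B)) :* (B :* (B :* B)))) refl a B z ⟩
      a * (a * B) * ((℘ z * (B * B)) * cube B)  ≡⟨ cong (λ e → a * (a * B) * (e * cube B)) A³≡ ⟨
      a * (a * B) * (cube A * cube B)           ≡⟨ cong (_*_ (a * (a * B))) (cube-* A B) ⟨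
      a * (a * B) * cube (A * B)                ∎

  -- a (a B) is the expression a d + b c for a depressed form. The form has few zeros if B = 0 or if
  -- the resolvent is outside the image of ℘; in the remaining cases it is already diagonal or its
  -- Hessian splits.
  diagonalize-depressed : ∀ {a A B p} → a ≢ 0# → a * (a * B) ≡ cube p → ¬ FewZeros (depressed a A B) →
                          Diagonalizable (depressed a A B)
  diagonalize-depressed {a} {A} {B} {p} a≢0 δ≡p³ many = cases (B ≟ 0#) (A ≟ 0#)
    where
    p≢0 : B ≢ 0# → p ≢ 0#
    p≢0 B≢0 refl = *≢0 a≢0 (*≢0 a≢0 B≢0) (trans δ≡p³ (zeroˡ _))
    δ∈ : B ≢ 0# → Cubic (a * (a * B))
    δ∈ B≢0 = subst Cubic (sym δ≡p³) (cube-Cubic (p≢0 B≢0))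
    cases : Dec (B ≡ 0#) → Dec (A ≡ 0#) → Diagonalizable (depressed a A B)
    cases (yes refl) _          = contradiction (depressed-0 A a≢0) many
    cases (no B≢0)   (yes refl) = depressed-A≡0 (δ∈ B≢0)
    cases (no B≢0)   (no A≢0)   = split (image℘? (cube A * (B ⁻¹ * B ⁻¹)))
      where
      split : Dec (Image℘ (cube A * (B ⁻¹ * B ⁻¹))) → Diagonalizable (depressed a A B)
      split (no ∉)           = contradiction (depressed-B A≢0 B≢0 a≢0 ∉) many
      split (yes (z , ℘z≡)) = depressed-℘ A≢0 B≢0 (δ∈ B≢0) (begin
        cube A                                ≡⟨ *-identityʳ _ ⟨
        cube A * 1#                           ≡⟨ cong (_*_ (cube A)) (*-identityʳ 1#) ⟨
        cube A * (1# * 1#)                    ≡⟨ cong (λ e → cube A * (e * e)) (⁻¹-inverseʳ B≢0) ⟨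
        cube A * ((B * B ⁻¹) * (B * B ⁻¹))
          ≡⟨ solve 3 (λ x b i → x :* ((b :* i) :* (b :* i)) := x :* (i :* i) :* (b :* b)) refl (cube A) B (B ⁻¹) ⟩
        cube A * (B ⁻¹ * B ⁻¹) * (B * B)      ≡⟨ cong (_* (B * B)) ℘z≡ ⟨
        ℘ z * (B * B)                         ∎)
        where open ≡-Reasoning

  Diagonalizable-≅ : ∀ {f g} → f ≅ g → Diagonalizable g → Diagonalizable f
  Diagonalizable-≅ f≅g (α , β , αβ∈ , g≅) = α , β , αβ∈ , ≅-trans f≅g g≅

  -- The substitution s + (b/a) t removes the s² t term because 3 b + b = 0 in characteristic 2; the
  -- two contributions b³/a² to t³ also cancel.
  depress : ∀ {a b c d} → a ≢ 0# →
            cubicForm a b c d ≅ depressed a (a ⁻¹ * (a ⁻¹ * (b * b) + c)) (a ⁻¹ * (a ⁻¹ * (b * c) + d))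
  depress {a} {b} {c} {d} a≢0 = record
    { x = 1# ; y = 0# ; z = i * b ; w = 1#
    ; det≢0 = λ det≡0 → 1≢0 (trans (solve 1 (λ z → con true := con true :* con true :+ con false :* z) refl (i * b)) det≡0)
    ; substitutes = λ s t → begin
        cubicForm a b c d (s * 1# + t * (i * b)) (s * 0# + t * 1#)
          ≡⟨ solve 7 (λ a b c d i s t →
               a :* ((s :* con true :+ t :* (i :* b)) :* ((s :* con true :+ t :* (i :* b)) :* (s :* con true :+ t :* (i :* b))))
               :+ b :* ((s :* con true :+ t :* (i :* b)) :* (s :* con true :+ t :* (i :* b)) :* (s :* con false :+ t :* con true))
               :+ c :* ((s :* con true :+ t :* (i :* b)) :* ((s :* con false :+ t :* con true) :* (s :* con false :+ t :* con true)))
               :+ d :* ((s :* con false :+ t :* con true) :* ((s :* con false :+ t :* con true) :* (s :* con false :+ t :* con true)))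
               := a :* (s :* (s :* s)) :+ (a :* i :+ con true) :* (b :* s :* s :* t :+ i :* i :* b :* b :* b :* t :* t :* t)
                  :+ a :* i :* (i :* b :* b :* s :* t :* t) :+ (c :* s :* t :* t :+ (i :* b :* c :+ d) :* t :* t :* t))
               refl a b c d i s t ⟩
        a * cube s + (a * i + 1#) * (b * s * s * t + i * i * b * b * b * t * t * t)
          + a * i * (i * b * b * s * t * t) + (c * s * t * t + (i * b * c + d) * t * t * t)
          ≡⟨ cong (λ e → a * cube s + (e + 1#) * (b * s * s * t + i * i * b * b * b * t * t * t)
               + e * (i * b * b * s * t * t) + (c * s * t * t + (i * b * c + d) * t * t * t)) (⁻¹-inverseʳ a≢0) ⟩
        a * cube s + (1# + 1#) * (b * s * s * t + i * i * b * b * b * t * t * t)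
          + 1# * (i * b * b * s * t * t) + (c * s * t * t + (i * b * c + d) * t * t * t)
          ≡⟨ solve 8 (λ a b c d i s t u →
               a :* (s :* (s :* s)) :+ (con true :+ con true) :* u
               :+ con true :* (i :* b :* b :* s :* t :* t) :+ (c :* s :* t :* t :+ (i :* b :* c :+ d) :* t :* t :* t)
               := a :* (s :* (s :* s)) :+ con true :* ((i :* b :* b :+ c) :* s :* t :* t :+ (i :* b :* c :+ d) :* t :* t :* t))
               refl a b c d i s t (b * s * s * t + i * i * b * b * b * t * t * t) ⟩
        a * cube s + 1# * ((i * b * b + c) * s * t * t + (i * b * c + d) * t * t * t)
          ≡⟨ cong (λ e → a * cube s + e * ((i * b * b + c) * s * t * t + (i * b * c + d) * t * t * t)) (⁻¹-inverseʳ a≢0) ⟨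
        a * cube s + a * i * ((i * b * b + c) * s * t * t + (i * b * c + d) * t * t * t)
          ≡⟨ solve 7 (λ a b c d i s t →
               a :* (s :* (s :* s)) :+ a :* i :* ((i :* b :* b :+ c) :* s :* t :* t :+ (i :* b :* c :+ d) :* t :* t :* t)
               := a :* (s :* (s :* s) :+ i :* (i :* (b :* b) :+ c) :* (s :* (t :* t)) :+ i :* (i :* (b :* c) :+ d) :* (t :* (t :* t))))
               refl a b c d i s t ⟩
        depressed a (i * (i * (b * b) + c)) (i * (i * (b * c) + d)) s t ∎
    }
    where
    open ≡-Reasoning
    i = a ⁻¹

  diagonalize-leading : ∀ {a b c d p} → a ≢ 0# → a * d + b * c ≡ cube p → ¬ FewZeros (cubicForm a b c d) →
                        Diagonalizable (cubicForm a b c d)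
  diagonalize-leading {a} {b} {c} {d} {p} a≢0 δ≡p³ many =
    Diagonalizable-≅ (depress a≢0) (diagonalize-depressed a≢0 (trans δ≡ δ≡p³) (many ∘ FewZeros-≅ (depress a≢0)))
    where
    open ≡-Reasoning
    i = a ⁻¹
    δ≡ : a * (a * (i * (i * (b * c) + d))) ≡ a * d + b * c
    δ≡ = begin
      a * (a * (i * (i * (b * c) + d)))
        ≡⟨ solve 5 (λ a b c d i → a :* (a :* (i :* (i :* (b :* c) :+ d))) := (a :* i) :* (a :* d) :+ (a :* i) :* (a :* i) :* (b :* c))
             refl a b c d i ⟩
      (a * i) * (a * d) + (a * i) * (a * i) * (b * c)
        ≡⟨ cong (λ e → e * (a * d) + e * e * (b * c)) (⁻¹-inverseʳ a≢0) ⟩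
      1# * (a * d) + 1# * 1# * (b * c)
        ≡⟨ solve 2 (λ x y → con true :* x :+ con true :* con true :* y := x :+ y) refl (a * d) (b * c) ⟩
      a * d + b * c ∎

  module BaseChange (a b c d x y z w : Carrier) where

    -- The two middle coefficients in the basis (x, y), (z, w).
    b′ c′ : Carrier
    b′ = a * (x * x * z) + b * (x * x * w) + c * (z * (y * y)) + d * (y * y * w)
    c′ = a * (x * (z * z)) + b * (z * z * y) + c * (x * (w * w)) + d * (y * (w * w))

    baseChange : x * w + y * z ≢ 0# → cubicForm a b c d ≅ cubicForm (cubicForm a b c d x y) b′ c′ (cubicForm a b c d z w)
    baseChange det≢0 = record
      { x = x ; y = y ; z = z ; w = w ; det≢0 = det≢0
      ; substitutes = λ s t → solve 10 (λ a b c d x y z w s t →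
          let S = s :* x :+ t :* z ; T = s :* y :+ t :* w in
          a :* (S :* (S :* S)) :+ b :* (S :* S :* T) :+ c :* (S :* (T :* T)) :+ d :* (T :* (T :* T))
          := (a :* (x :* (x :* x)) :+ b :* (x :* x :* y) :+ c :* (x :* (y :* y)) :+ d :* (y :* (y :* y))) :* (s :* (s :* s))
          :+ (a :* (x :* x :* z) :+ b :* (x :* x :* w) :+ c :* (z :* (y :* y)) :+ d :* (y :* y :* w)) :* (s :* s :* t)
          :+ (a :* (x :* (z :* z)) :+ b :* (z :* z :* y) :+ c :* (x :* (w :* w)) :+ d :* (y :* (w :* w))) :* (s :* (t :* t))
          :+ (a :* (z :* (z :* z)) :+ b :* (z :* z :* w) :+ c :* (z :* (w :* w)) :+ d :* (w :* (w :* w))) :* (t :* (t :* t)))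
          refl a b c d x y z w s t
      }

    -- The square root of the discriminant of a binary cubic form in characteristic 2 is ad + bc.
    discriminant-baseChange : cubicForm a b c d x y * cubicForm a b c d z w + b′ * c′ ≡ (a * d + b * c) * cube (x * w + y * z)
    discriminant-baseChange = solve 8 (λ a b c d x y z w →
      (a :* (x :* (x :* x)) :+ b :* (x :* x :* y) :+ c :* (x :* (y :* y)) :+ d :* (y :* (y :* y)))
        :* (a :* (z :* (z :* z)) :+ b :* (z :* z :* w) :+ c :* (z :* (w :* w)) :+ d :* (w :* (w :* w)))
      :+ (a :* (x :* x :* z) :+ b :* (x :* x :* w) :+ c :* (z :* (y :* y)) :+ d :* (y :* y :* w))
        :* (a :* (x :* (z :* z)) :+ b :* (z :* z :* y) :+ c :* (x :* (w :* w)) :+ d :* (y :* (w :* w)))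
      := (a :* d :+ b :* c) :* ((x :* w :+ y :* z) :* ((x :* w :+ y :* z) :* (x :* w :+ y :* z))))
      refl a b c d x y z w

  -- A vector with nonzero value becomes the first basis vector, and its value the leading
  -- coefficient. The discriminant root acquires the factor det³ and remains a cube.
  diagonalize : ∀ {a b c d p} → a * d + b * c ≡ cube p → (∃[ s ] ∃[ t ] cubicForm a b c d s t ≢ 0#) →
                ¬ FewZeros (cubicForm a b c d) → Diagonalizable (cubicForm a b c d)
  diagonalize {a} {b} {c} {d} {p} δ≡p³ (x , y , fxy≢0) many = complete (x ≟ 0#)
    where
    withBasis : ∀ z w → x * w + y * z ≢ 0# → Diagonalizable (cubicForm a b c d)
    withBasis z w det≢0 = Diagonalizable-≅ (baseChange det≢0) (diagonalize-leading {p = p * (x * w + y * z)} fxy≢0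
        (trans discriminant-baseChange (trans (cong (_* cube (x * w + y * z)) δ≡p³) (sym (cube-* p _))))
        (many ∘ FewZeros-≅ (baseChange det≢0)))
      where open BaseChange a b c d x y z w
    -- The second basis vector is (0, 1) if x ≠ 0. Otherwise y ≠ 0, because the form vanishes at the
    -- zero vector, and (1, 0) serves.
    complete : Dec (x ≡ 0#) → Diagonalizable (cubicForm a b c d)
    complete (no x≢0)   = withBasis 0# 1# (λ det≡0 → x≢0 (trans
      (solve 2 (λ x y → x := x :* con true :+ y :* con false) refl x y) det≡0))
    complete (yes refl) = withBasis 1# 0# (λ det≡0 → fxy≢0 (trans
      (cong (cubicForm a b c d 0#) (trans (solve 1 (λ y → y := con false :* con false :+ y :* con true) refl y) det≡0))
      (solve 4 (λ a b c d → a :* (con false :* (con false :* con false)) :+ b :* (con false :* con false :* con false)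
        :+ c :* (con false :* (con false :* con false)) :+ d :* (con false :* (con false :* con false)) := con false) refl a b c d)))

-- Coordinates on lines.

module Vectors {𝕔 : Level} (n : ℕ) (𝔽 : FiniteField 𝕔 (2 ℕ.^ n)) where

  open FiniteField 𝔽 using (Carrier)
  open Geometry 𝔽
  open Characteristic₂ n 𝔽
  open Solver₂ using (Polynomial; solve; _:=_; _:+_; _:*_; _:^_; con)

  combination : ∀ {m} k s t (u v : Vec Carrier m) → k · (s · u ⊕ t · v) ≡ (k * s) · u ⊕ (k * t) · v
  combination k s t []      []      = refl
  combination k s t (x ∷ u) (y ∷ v) = cong₂ _∷_
    (solve 5 (λ k s t x y → k :* (s :* x :+ t :* y) := (k :* s) :* x :+ (k :* t) :* y) refl k s t x y)
    (combination k s t u v)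

  ⊕-combination : ∀ {m} s t s′ t′ (u v : Vec Carrier m) →
                  (s · u ⊕ t · v) ⊕ (s′ · u ⊕ t′ · v) ≡ (s + s′) · u ⊕ (t + t′) · v
  ⊕-combination s t s′ t′ []      []      = refl
  ⊕-combination s t s′ t′ (x ∷ u) (y ∷ v) = cong₂ _∷_
    (solve 6 (λ s t s′ t′ x y → (s :* x :+ t :* y) :+ (s′ :* x :+ t′ :* y) := (s :+ s′) :* x :+ (t :+ t′) :* y) refl s t s′ t′ x y)
    (⊕-combination s t s′ t′ u v)

  v⊕v≡𝟎 : ∀ {m} (v : Vec Carrier m) → v ⊕ v ≡ 𝟎
  v⊕v≡𝟎 []      = refl
  v⊕v≡𝟎 (x ∷ v) = cong₂ _∷_ (x+x≡0 x) (v⊕v≡𝟎 v)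

  ·-assoc : ∀ {m} s t (v : Vec Carrier m) → s · (t · v) ≡ (s * t) · v
  ·-assoc s t []      = refl
  ·-assoc s t (x ∷ v) = cong₂ _∷_ (sym (*-assoc s t x)) (·-assoc s t v)

  1·v≡v : ∀ {m} (v : Vec Carrier m) → 1# · v ≡ v
  1·v≡v []      = refl
  1·v≡v (x ∷ v) = cong₂ _∷_ (*-identityˡ x) (1·v≡v v)

  s·𝟎≡𝟎 : ∀ m s → s · 𝟎 {m} ≡ 𝟎
  s·𝟎≡𝟎 ℕ.zero    s = refl
  s·𝟎≡𝟎 (ℕ.suc m) s = cong₂ _∷_ (zeroʳ s) (s·𝟎≡𝟎 m s)

  0·v≡𝟎 : ∀ {m} (v : Vec Carrier m) → 0# · v ≡ 𝟎
  0·v≡𝟎 []      = refl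
  0·v≡𝟎 (x ∷ v) = cong₂ _∷_ (zeroˡ x) (0·v≡𝟎 v)

  0·u⊕t·v≡t·v : ∀ {m} t (u v : Vec Carrier m) → 0# · u ⊕ t · v ≡ t · v
  0·u⊕t·v≡t·v t []      []      = refl
  0·u⊕t·v≡t·v t (x ∷ u) (y ∷ v) = cong₂ _∷_ (trans (cong (_+ t * y) (zeroˡ x)) (+-identityˡ _)) (0·u⊕t·v≡t·v t u v)

  1·u⊕0·v≡u : ∀ {m} (u v : Vec Carrier m) → 1# · u ⊕ 0# · v ≡ u
  1·u⊕0·v≡u []      []      = refl
  1·u⊕0·v≡u (x ∷ u) (y ∷ v) = cong₂ _∷_
    (solve 2 (λ x y → con true :* x :+ con false :* y := x) refl x y) (1·u⊕0·v≡u u v)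

  ⊕≡𝟎⇒≡ : ∀ {m} {u v : Vec Carrier m} → u ⊕ v ≡ 𝟎 → u ≡ v
  ⊕≡𝟎⇒≡ {u = []}    {[]}    _  = refl
  ⊕≡𝟎⇒≡ {u = x ∷ u} {y ∷ v} eq = cong₂ _∷_ (x+y≡0⇒x≡y (cong head eq)) (⊕≡𝟎⇒≡ (cong tail eq))

  s·v≡𝟎⇒v≡𝟎 : ∀ {m s} {v : Vec Carrier m} → s ≢ 0# → s · v ≡ 𝟎 → v ≡ 𝟎
  s·v≡𝟎⇒v≡𝟎 {m} {s} {v} s≢0 sv≡𝟎 = begin
    v               ≡⟨ 1·v≡v v ⟨
    1# · v          ≡⟨ cong (_· v) (trans (*-comm (s ⁻¹) s) (⁻¹-inverseʳ s≢0)) ⟨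
    (s ⁻¹ * s) · v  ≡⟨ ·-assoc (s ⁻¹) s v ⟨
    s ⁻¹ · s · v    ≡⟨ cong (s ⁻¹ ·_) sv≡𝟎 ⟩
    s ⁻¹ · 𝟎        ≡⟨ s·𝟎≡𝟎 m (s ⁻¹) ⟩
    𝟎               ∎
    where open ≡-Reasoning

  module OnLine (ℓ : Line) where

    open Line ℓ
    p q : Vec Carrier 6
    p = coords P
    q = coords Q

    pt : Carrier → Carrier → Vec Carrier 6
    pt s t = s · p ⊕ t · q

    -- P and Q are distinct only up to scaling. A relation with both coefficients nonzero would make
    -- them proportional, and one with a single nonzero coefficient would make p or q zero.
    independent : ∀ {s t} → pt s t ≡ 𝟎 → s ≡ 0# × t ≡ 0#
    independent {s} {t} eq = cases (s ≟ 0#) (t ≟ 0#)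
      where
      open ≡-Reasoning
      cases : Dec (s ≡ 0#) → Dec (t ≡ 0#) → s ≡ 0# × t ≡ 0#
      cases (yes s≡0) (yes t≡0) = s≡0 , t≡0
      cases (yes refl) (no t≢0) = contradiction (s·v≡𝟎⇒v≡𝟎 t≢0 (trans (sym (0·u⊕t·v≡t·v t p q)) eq)) (proj₂ Q)
      cases (no s≢0) t≟0 = contradiction t≟0 impossible
        where
        p≡ : p ≡ (s ⁻¹ * t) · q
        p≡ = begin
          p               ≡⟨ 1·v≡v p ⟨
          1# · p          ≡⟨ cong (_· p) (trans (*-comm (s ⁻¹) s) (⁻¹-inverseʳ s≢0)) ⟨
          (s ⁻¹ * s) · p  ≡⟨ ·-assoc (s ⁻¹) s p ⟨
          s ⁻¹ · s · p    ≡⟨ cong (s ⁻¹ ·_) (⊕≡𝟎⇒≡ eq) ⟩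
          s ⁻¹ · t · q    ≡⟨ ·-assoc (s ⁻¹) t q ⟩
          (s ⁻¹ * t) · q  ∎
        impossible : ¬ Dec (t ≡ 0#)
        impossible (yes t≡0) = proj₂ P (trans p≡ (trans
          (cong (_· q) (trans (cong (_*_ (s ⁻¹)) t≡0) (zeroʳ (s ⁻¹)))) (0·v≡𝟎 q)))
        impossible (no t≢0) = P≁Q (s ⁻¹ * t , *≢0 (⁻¹≢0 s≢0) t≢0 , p≡)

    pt-injective : ∀ {s t s′ t′} → pt s t ≡ pt s′ t′ → s ≡ s′ × t ≡ t′
    pt-injective {s} {t} {s′} {t′} eq =
      x+y≡0⇒x≡y (proj₁ (independent difference≡𝟎)) , x+y≡0⇒x≡y (proj₂ (independent difference≡𝟎))
      where
      open ≡-Reasoning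
      difference≡𝟎 : pt (s + s′) (t + t′) ≡ 𝟎
      difference≡𝟎 = begin
        pt (s + s′) (t + t′)  ≡⟨ ⊕-combination s t s′ t′ p q ⟨
        pt s t ⊕ pt s′ t′     ≡⟨ cong (_⊕ pt s′ t′) eq ⟩
        pt s′ t′ ⊕ pt s′ t′   ≡⟨ v⊕v≡𝟎 _ ⟩
        𝟎                     ∎

    point : ∀ s t → ¬ (s ≡ 0# × t ≡ 0#) → Point
    point s t nonzero = pt s t , nonzero ∘ independent

    point∈ℓ : ∀ s t nonzero → point s t nonzero ∈ pointsOf ℓ
    point∈ℓ s t _ = s , t , refl

  -- The cubic Φ on the quadric and on the orbits.

  Φ : Vec Carrier 6 → Carrier
  Φ (X₁ ∷ X₂ ∷ _ ∷ _ ∷ X₅ ∷ X₆ ∷ []) = X₁ * (X₅ * X₅) + (X₂ * X₂) * X₆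

  -- The hyperplane appears as X₃ = X₄, since -1 = 1.
  OnQuadric : Vec Carrier 6 → Set 𝕔
  OnQuadric (X₁ ∷ X₂ ∷ X₃ ∷ X₄ ∷ X₅ ∷ X₆ ∷ []) = X₃ ≡ X₄ × X₁ * X₆ + X₂ * X₅ + X₃ * X₄ ≡ 0#

  𝓠₄⇒OnQuadric : ∀ {X} → X ∈ 𝓠₄ → OnQuadric (coords X)
  𝓠₄⇒OnQuadric {(_ ∷ _ ∷ _ ∷ _ ∷ _ ∷ _ ∷ []) , _} (quadric , X₃+X₄≡0) = x+y≡0⇒x≡y X₃+X₄≡0 , quadric

  private
    Φ≡ : ∀ X₁ X₂ X₅ X₆ → X₁ * (X₅ * (X₅ * 1#)) + (X₂ * (X₂ * 1#)) * X₆ ≡ X₁ * (X₅ * X₅) + (X₂ * X₂) * X₆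
    Φ≡ = solve 4 (λ X₁ X₂ X₅ X₆ → X₁ :* (X₅ :* (X₅ :* con true)) :+ (X₂ :* (X₂ :* con true)) :* X₆
                             := X₁ :* (X₅ :* X₅) :+ (X₂ :* X₂) :* X₆) refl

  𝓨⇒Φ≡0 : ∀ {X} → X ∈ 𝓨 → Φ (coords X) ≡ 0#
  𝓨⇒Φ≡0 {(X₁ ∷ X₂ ∷ _ ∷ _ ∷ X₅ ∷ X₆ ∷ []) , _} (_ , eq) = trans (sym (Φ≡ X₁ X₂ X₅ X₆)) eq

  Φ≡0⇒𝓨 : ∀ {X} → X ∈ 𝓠₄ → Φ (coords X) ≡ 0# → X ∈ 𝓨
  Φ≡0⇒𝓨 {(X₁ ∷ X₂ ∷ _ ∷ _ ∷ X₅ ∷ X₆ ∷ []) , _} (_ , X∈Π) eq = X∈Π , trans (Φ≡ X₁ X₂ X₅ X₆) eq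

  -- Φ is bilinear in (X₁, X₆) and the squares (X₅², X₂²), and squaring is additive. So the s² t
  -- term takes its squares from the first vector and its linear factors from the second, and the s
  -- t² term the reverse.
  coefficient₁ coefficient₂ : Vec Carrier 6 → Vec Carrier 6 → Carrier
  coefficient₁ (p₁ ∷ p₂ ∷ _ ∷ _ ∷ p₅ ∷ p₆ ∷ []) (q₁ ∷ q₂ ∷ _ ∷ _ ∷ q₅ ∷ q₆ ∷ []) = q₁ * (p₅ * p₅) + (p₂ * p₂) * q₆
  coefficient₂ (p₁ ∷ p₂ ∷ _ ∷ _ ∷ p₅ ∷ p₆ ∷ []) (q₁ ∷ q₂ ∷ _ ∷ _ ∷ q₅ ∷ q₆ ∷ []) = p₁ * (q₅ * q₅) + (q₂ * q₂) * p₆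

  Φ-combination : ∀ u v s t → Φ (s · u ⊕ t · v) ≡
    Φ u * (s * (s * s)) + coefficient₁ u v * (s * s * t) + coefficient₂ u v * (s * (t * t)) + Φ v * (t * (t * t))
  Φ-combination (p₁ ∷ p₂ ∷ _ ∷ _ ∷ p₅ ∷ p₆ ∷ []) (q₁ ∷ q₂ ∷ _ ∷ _ ∷ q₅ ∷ q₆ ∷ []) s t =
    solve 10 (λ p₁ p₂ p₅ p₆ q₁ q₂ q₅ q₆ s t →
        (s :* p₁ :+ t :* q₁) :* ((s :* p₅ :+ t :* q₅) :* (s :* p₅ :+ t :* q₅))
        :+ ((s :* p₂ :+ t :* q₂) :* (s :* p₂ :+ t :* q₂)) :* (s :* p₆ :+ t :* q₆)
      := (p₁ :* (p₅ :* p₅) :+ (p₂ :* p₂) :* p₆) :* (s :* (s :* s))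
        :+ (q₁ :* (p₅ :* p₅) :+ (p₂ :* p₂) :* q₆) :* (s :* s :* t)
        :+ (p₁ :* (q₅ :* q₅) :+ (q₂ :* q₂) :* p₆) :* (s :* (t :* t))
        :+ (q₁ :* (q₅ :* q₅) :+ (q₂ :* q₂) :* q₆) :* (t :* (t :* t)))
      refl p₁ p₂ p₅ p₆ q₁ q₂ q₅ q₆ s t

  -- In Plücker coordinates the left-hand side is p₁₆ p₂₅², and p₁₆ = p₂₅ for two conjugate points of the quadric.
  discriminant-cube : ∀ u v → OnQuadric u → OnQuadric v → OnQuadric (1# · u ⊕ 1# · v) →
    ∃[ p ] Φ u * Φ v + coefficient₁ u v * coefficient₂ u v ≡ p * (p * p)
  discriminant-cube (p₁ ∷ p₂ ∷ p₃ ∷ p₄ ∷ p₅ ∷ p₆ ∷ []) (q₁ ∷ q₂ ∷ q₃ ∷ q₄ ∷ q₅ ∷ q₆ ∷ [])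
    (refl , Qp≡0) (refl , Qq≡0) (_ , Qp+q≡0) = p₂₅ , (begin
      Φ (p₁ ∷ p₂ ∷ p₃ ∷ p₃ ∷ p₅ ∷ p₆ ∷ []) * Φ (q₁ ∷ q₂ ∷ q₃ ∷ q₃ ∷ q₅ ∷ q₆ ∷ [])
        + (q₁ * (p₅ * p₅) + (p₂ * p₂) * q₆) * (p₁ * (q₅ * q₅) + (q₂ * q₂) * p₆)
        ≡⟨ solve 8 (λ p₁ p₂ p₅ p₆ q₁ q₂ q₅ q₆ →
             (p₁ :* (p₅ :* p₅) :+ (p₂ :* p₂) :* p₆) :* (q₁ :* (q₅ :* q₅) :+ (q₂ :* q₂) :* q₆)
             :+ (q₁ :* (p₅ :* p₅) :+ (p₂ :* p₂) :* q₆) :* (p₁ :* (q₅ :* q₅) :+ (q₂ :* q₂) :* p₆)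
             := (p₁ :* q₆ :+ p₆ :* q₁) :* ((p₂ :* q₅ :+ p₅ :* q₂) :* (p₂ :* q₅ :+ p₅ :* q₂)))
             refl p₁ p₂ p₅ p₆ q₁ q₂ q₅ q₆ ⟩
      (p₁ * q₆ + p₆ * q₁) * (p₂₅ * p₂₅)
        ≡⟨ cong (_* (p₂₅ * p₂₅)) (x+y≡0⇒x≡y conjugate) ⟩
      p₂₅ * (p₂₅ * p₂₅) ∎)
    where
    open ≡-Reasoning
    p₂₅ = p₂ * q₅ + p₅ * q₂
    conjugate : (p₁ * q₆ + p₆ * q₁) + p₂₅ ≡ 0#
    conjugate = begin
      (p₁ * q₆ + p₆ * q₁) + p₂₅
        ≡⟨ solve 10 (λ p₁ p₂ p₃ p₅ p₆ q₁ q₂ q₃ q₅ q₆ →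
             (p₁ :* q₆ :+ p₆ :* q₁) :+ (p₂ :* q₅ :+ p₅ :* q₂)
             := (p₁ :* p₆ :+ p₂ :* p₅ :+ p₃ :* p₃) :+ (q₁ :* q₆ :+ q₂ :* q₅ :+ q₃ :* q₃)
             :+ ((con true :* p₁ :+ con true :* q₁) :* (con true :* p₆ :+ con true :* q₆)
               :+ (con true :* p₂ :+ con true :* q₂) :* (con true :* p₅ :+ con true :* q₅)
               :+ (con true :* p₃ :+ con true :* q₃) :* (con true :* p₃ :+ con true :* q₃)))
             refl p₁ p₂ p₃ p₅ p₆ q₁ q₂ q₃ q₅ q₆ ⟩
      _ ≡⟨ cong₂ _+_ (cong₂ _+_ Qp≡0 Qq≡0) Qp+q≡0 ⟩
      (0# + 0#) + 0#
        ≡⟨ trans (+-identityʳ _) (+-identityʳ 0#) ⟩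
      0# ∎

  vec₆ : ∀ {x₁ x₂ x₃ x₄ x₅ x₆ y₁ y₂ y₃ y₄ y₅ y₆ : Carrier} →
         x₁ ≡ y₁ → x₂ ≡ y₂ → x₃ ≡ y₃ → x₄ ≡ y₄ → x₅ ≡ y₅ → x₆ ≡ y₆ →
         x₁ ∷ x₂ ∷ x₃ ∷ x₄ ∷ x₅ ∷ x₆ ∷ [] ≡ y₁ ∷ y₂ ∷ y₃ ∷ y₄ ∷ y₅ ∷ y₆ ∷ []
  vec₆ refl refl refl refl refl refl = refl

  -- Column 1 of `M̃` plus u times column 5.
  orbitVector : (a b c d u : Carrier) → Vec Carrier 6
  orbitVector a b c d u = (a * a) * (a * a) ∷ u * (b * b) ∷ m ∷ m ∷ u * (d * d) ∷ (c * c) * (c * c) ∷ []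
    where m = (a * c) * (a * c) + u * (b * d)

  M̃*R≡orbitVector : ∀ a b c d u → M̃ a b c d *ᵥ (U₁ ⊕ u · U₅) ≡ orbitVector a b c d u
  M̃*R≡orbitVector a b c d u = vec₆
    (solve 5 (λ a b c d u → row (a :^ 4) O (a :^ 2 :* b :^ 2) (a :^ 2 :* b :^ 2) O (b :^ 4) u
      := (a :* a) :* (a :* a)) refl a b c d u)
    (solve 5 (λ a b c d u → row O (a :^ 2) (a :* b) (a :* b) (b :^ 2) O u := u :* (b :* b)) refl a b c d u)
    (solve 5 (λ a b c d u → row (a :^ 2 :* c :^ 2) (a :* c) (b :^ 2 :* c :^ 2 :+ b :* c :+ I) (b :^ 2 :* c :^ 2 :+ b :* c) (b :* d) (b :^ 2 :* d :^ 2) u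
      := (a :* c) :* (a :* c) :+ u :* (b :* d)) refl a b c d u)
    (solve 5 (λ a b c d u → row (a :^ 2 :* c :^ 2) (a :* c) (b :^ 2 :* c :^ 2 :+ b :* c) (b :^ 2 :* c :^ 2 :+ b :* c :+ I) (b :* d) (b :^ 2 :* d :^ 2) u
      := (a :* c) :* (a :* c) :+ u :* (b :* d)) refl a b c d u)
    (solve 5 (λ a b c d u → row O (c :^ 2) (c :* d) (c :* d) (d :^ 2) O u := u :* (d :* d)) refl a b c d u)
    (solve 5 (λ a b c d u → row (c :^ 4) O (c :^ 2 :* d :^ 2) (c :^ 2 :* d :^ 2) O (d :^ 4) u
      := (c :* c) :* (c :* c)) refl a b c d u)
    where
    O I : Polynomial 5
    O = con false
    I = con true
    row : (e₁ e₂ e₃ e₄ e₅ e₆ u : Polynomial 5) → Polynomial 5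
    row e₁ e₂ e₃ e₄ e₅ e₆ u = e₁ :* (I :+ u :* O) :+ (e₂ :* (O :+ u :* O) :+ (e₃ :* (O :+ u :* O)
      :+ (e₄ :* (O :+ u :* O) :+ (e₅ :* (O :+ u :* I) :+ (e₆ :* (O :+ u :* O) :+ O)))))

  Φ-scale : ∀ s v → Φ (s · v) ≡ s * (s * s) * Φ v
  Φ-scale s (X₁ ∷ X₂ ∷ _ ∷ _ ∷ X₅ ∷ X₆ ∷ []) = solve 5 (λ s X₁ X₂ X₅ X₆ →
      (s :* X₁) :* ((s :* X₅) :* (s :* X₅)) :+ ((s :* X₂) :* (s :* X₂)) :* (s :* X₆)
      := s :* (s :* s) :* (X₁ :* (X₅ :* X₅) :+ (X₂ :* X₂) :* X₆)) refl s X₁ X₂ X₅ X₆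

  fourth : Carrier → Carrier
  fourth x = (x * x) * (x * x)

  fourth-injective : ∀ {x y} → fourth x ≡ fourth y → x ≡ y
  fourth-injective eq = square-injective (square-injective eq)

  -- By a⁴ d⁴ + b⁴ c⁴ = (a d + b c)⁴; so Φ is constant on the orbit vectors of determinant 1.
  Φ-orbitVector : ∀ a b c d u → Φ (orbitVector a b c d u) ≡ (u * u) * fourth (a * d + b * c)
  Φ-orbitVector a b c d u = solve 5 (λ a b c d u →
      ((a :* a) :* (a :* a)) :* ((u :* (d :* d)) :* (u :* (d :* d)))
        :+ ((u :* (b :* b)) :* (u :* (b :* b))) :* ((c :* c) :* (c :* c))
      := (u :* u) :* (((a :* d :+ b :* c) :* (a :* d :+ b :* c)) :* ((a :* d :+ b :* c) :* (a :* d :+ b :* c))))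
      refl a b c d u

  -- On the quadric an orbit vector is determined by its outer coordinates, which are arbitrary as all square roots exist.
  onQuadric⇒orbitVector : ∀ {u} → u ≢ 0# → ∀ Y → OnQuadric Y → Φ Y ≡ u * u →
    ∃[ a ] ∃[ b ] ∃[ c ] ∃[ d ] (a * d + b * c ≡ 1# × Y ≡ orbitVector a b c d u)
  onQuadric⇒orbitVector {u} u≢0 Y@(Y₁ ∷ Y₂ ∷ Y₃ ∷ _ ∷ Y₅ ∷ Y₆ ∷ []) (refl , quadric) ΦY≡u² =
    a , b , c , d , fourth-injective (*-cancelˡ (*≢0 u≢0 u≢0) (begin
      (u * u) * fourth (a * d + b * c)  ≡⟨ Φ-orbitVector a b c d u ⟨
      Φ (orbitVector a b c d u)         ≡⟨ ΦY≡ ⟨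
      Φ Y                               ≡⟨ ΦY≡u² ⟩
      u * u                             ≡⟨ solve 1 (λ u → u := u :* ((con true :* con true) :* (con true :* con true))) refl (u * u) ⟩
      (u * u) * fourth 1#               ∎)) ,
    vec₆ Y₁≡ Y₂≡ Y₃≡ Y₃≡ Y₅≡ Y₆≡
    where
    open ≡-Reasoning
    a = √ (√ Y₁)
    b = √ (u ⁻¹ * Y₂)
    c = √ (√ Y₆)
    d = √ (u ⁻¹ * Y₅)
    root : ∀ y → y ≡ fourth (√ (√ y))
    root y = sym (trans (cong (λ e → e * e) (√-square (√ y))) (√-square y))
    scaled : ∀ y → y ≡ u * (√ (u ⁻¹ * y) * √ (u ⁻¹ * y))
    scaled y = sym (trans (cong (_*_ u) (√-square (u ⁻¹ * y))) (a*b≡1⇒a*[b*x]≡x (⁻¹-inverseʳ u≢0) y))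
    Y₁≡ : Y₁ ≡ fourth a
    Y₁≡ = root Y₁
    Y₂≡ : Y₂ ≡ u * (b * b)
    Y₂≡ = scaled Y₂
    Y₅≡ : Y₅ ≡ u * (d * d)
    Y₅≡ = scaled Y₅
    Y₆≡ : Y₆ ≡ fourth c
    Y₆≡ = root Y₆
    Y₃≡ : Y₃ ≡ (a * c) * (a * c) + u * (b * d)
    Y₃≡ = square-injective (begin
      Y₃ * Y₃                ≡⟨ x+y≡0⇒x≡y quadric ⟨
      Y₁ * Y₆ + Y₂ * Y₅      ≡⟨ cong₂ _+_ (cong₂ _*_ Y₁≡ Y₆≡) (cong₂ _*_ Y₂≡ Y₅≡) ⟩
      fourth a * fourth c + u * (b * b) * (u * (d * d))
        ≡⟨ solve 5 (λ a b c d u → ((a :* a) :* (a :* a)) :* ((c :* c) :* (c :* c)) :+ u :* (b :* b) :* (u :* (d :* d))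
             := ((a :* c) :* (a :* c) :+ u :* (b :* d)) :* ((a :* c) :* (a :* c) :+ u :* (b :* d))) refl a b c d u ⟩
      ((a * c) * (a * c) + u * (b * d)) * ((a * c) * (a * c) + u * (b * d)) ∎)
    ΦY≡ : Φ Y ≡ Φ (orbitVector a b c d u)
    ΦY≡ = cong₂ _+_ (cong₂ _*_ Y₁≡ (cong₂ _*_ Y₅≡ Y₅≡)) (cong₂ _*_ (cong₂ _*_ Y₂≡ Y₂≡) Y₆≡)

  OnQuadric-scale : ∀ s v → OnQuadric v → OnQuadric (s · v)
  OnQuadric-scale s (X₁ ∷ X₂ ∷ X₃ ∷ _ ∷ X₅ ∷ X₆ ∷ []) (refl , quadric) = refl , trans
    (solve 6 (λ s X₁ X₂ X₃ X₅ X₆ → (s :* X₁) :* (s :* X₆) :+ (s :* X₂) :* (s :* X₅) :+ (s :* X₃) :* (s :* X₃)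
      := (s :* s) :* (X₁ :* X₆ :+ X₂ :* X₅ :+ X₃ :* X₃)) refl s X₁ X₂ X₃ X₅ X₆)
    (trans (cong (_*_ (s * s)) quadric) (zeroʳ (s * s)))

-- From indicator sums to sizes, and the signed root of q.

record Enumeration {a m} (D : Fin m → Set a) (size : ℕ) : Set a where
  field
    list       : Fin size → Fin m
    injective  : ∀ {i j} → list i ≡ list j → i ≡ j
    sound      : ∀ i → D (list i)
    complete   : ∀ j → D j → ∃[ i ] list i ≡ j

-- The link between the computed sums and the bijections that sizes require.
enumerate : ∀ {a m} {D : Fin m → Set a} (D? : ∀ j → Dec (D j)) →
            ∃[ k ] (Enumeration D k × + k ≡ ℤ∑.sum (λ j → 𝟙 (D? j)))
enumerate {m = ℕ.zero} D? = 0 , record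
  { list = λ () ; injective = λ { {()} } ; sound = λ () ; complete = λ () } , refl
enumerate {m = ℕ.suc m} {D} D? = extend (D? zero) (enumerate (D? ∘ suc))
  where
  extend : (D0? : Dec (D zero)) → ∃[ k ] (Enumeration (D ∘ suc) k × + k ≡ ℤ∑.sum (λ j → 𝟙 (D? (suc j)))) →
           ∃[ k ] (Enumeration D k × + k ≡ 𝟙 D0? ℤ.+ ℤ∑.sum (λ j → 𝟙 (D? (suc j))))
  extend (yes D0) (k , E , k≡) = ℕ.suc k , record
    { list      = λ { zero → zero ; (suc i) → suc (E.list i) }
    ; injective = λ { {zero} {zero} _ → refl ; {suc i} {suc j} eq → cong suc (E.injective (Fin.suc-injective eq)) }
    ; sound     = λ { zero → D0 ; (suc i) → E.sound i }
    ; complete  = λ { zero _ → zero , refl ; (suc j) Dj → suc (proj₁ (E.complete j Dj)) , cong suc (proj₂ (E.complete j Dj)) }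
    } , cong (λ i → 1ℤ ℤ.+ i) k≡
    where module E = Enumeration E
  extend (no ¬D0) (k , E , k≡) = k , record
    { list      = suc ∘ E.list
    ; injective = E.injective ∘ Fin.suc-injective
    ; sound     = E.sound
    ; complete  = λ { zero D0 → contradiction D0 ¬D0 ; (suc j) Dj → proj₁ (E.complete j Dj) , cong suc (proj₂ (E.complete j Dj)) }
    } , trans k≡ (sym (ℤ.+-identityˡ _))
    where module E = Enumeration E

-- The character sums determine three times a count; this yields the quotient that `HasSizeℚ` asks
-- for.
3*k≡i⇒k/1≡i/3 : ∀ {k i} → + 3 ℤ.* + k ≡ i → (+ k) ℚ./ 1 ≡ i ℚ./ 3
3*k≡i⇒k/1≡i/3 {k} {i} 3k≡i = ℚ.fromℚᵘ-cong {ℚᵘ.mkℚᵘ (+ k) 0} {ℚᵘ.mkℚᵘ i 2}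
  (ℚᵘ.*≡* (trans (ℤ.*-comm (+ k) (+ 3)) (trans 3k≡i (sym (ℤ.*-identityʳ i)))))

-- This is (-2)^m, and -2 is 1 modulo 3; the sign thus selects the root that lies in the residue
-- class of S.
signedRoot : ℕ → ℤ
signedRoot m = -1ℤ ℤ.^ m ℤ.* + (2 ℕ.^ m)

private
  module SignedRoot where
    step : ∀ e x → (-1ℤ ℤ.* e) ℤ.* (+ 2 ℤ.* x) ≡ (ℤ.- + 2) ℤ.* (e ℤ.* x)
    step = ℤ.solve-∀

    residue : ∀ j → (ℤ.- + 2) ℤ.* (1ℤ ℤ.+ + 3 ℤ.* j) ≡ 1ℤ ℤ.+ + 3 ℤ.* (-1ℤ ℤ.+ (ℤ.- + 2) ℤ.* j)
    residue = ℤ.solve-∀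

    squares : ∀ e x → (e ℤ.* x) ℤ.* (e ℤ.* x) ≡ (e ℤ.* e) ℤ.* (x ℤ.* x)
    squares = ℤ.solve-∀

    doubling : ∀ e x → + 2 ℤ.* (e ℤ.* x) ≡ e ℤ.* + 2 ℤ.* x
    doubling = ℤ.solve-∀

    signs : ∀ e → (-1ℤ ℤ.* e) ℤ.* (-1ℤ ℤ.* e) ≡ e ℤ.* e
    signs = ℤ.solve-∀

signedRoot≡1mod3 : ∀ m → ∃[ j ] signedRoot m ≡ 1ℤ ℤ.+ + 3 ℤ.* j
signedRoot≡1mod3 ℕ.zero = 0ℤ , refl
signedRoot≡1mod3 (ℕ.suc m) with j , σ≡ ← signedRoot≡1mod3 m = -1ℤ ℤ.+ (ℤ.- + 2) ℤ.* j , (begin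
    (-1ℤ ℤ.* e) ℤ.* + (2 ℕ.* 2 ℕ.^ m)        ≡⟨ cong (λ x → (-1ℤ ℤ.* e) ℤ.* x) (ℤ.pos-* 2 (2 ℕ.^ m)) ⟩
    (-1ℤ ℤ.* e) ℤ.* (+ 2 ℤ.* + (2 ℕ.^ m))    ≡⟨ SignedRoot.step e (+ (2 ℕ.^ m)) ⟩
    (ℤ.- + 2) ℤ.* signedRoot m               ≡⟨ cong (λ s → (ℤ.- + 2) ℤ.* s) σ≡ ⟩
    (ℤ.- + 2) ℤ.* (1ℤ ℤ.+ + 3 ℤ.* j)         ≡⟨ SignedRoot.residue j ⟩
    1ℤ ℤ.+ + 3 ℤ.* (-1ℤ ℤ.+ (ℤ.- + 2) ℤ.* j) ∎)
  where
  open ≡-Reasoning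
  e = -1ℤ ℤ.^ m

signedRoot² : ∀ m → signedRoot m ℤ.* signedRoot m ≡ + (2 ℕ.^ m ℕ.* 2 ℕ.^ m)
signedRoot² m = begin
    signedRoot m ℤ.* signedRoot m                           ≡⟨ SignedRoot.squares e (+ (2 ℕ.^ m)) ⟩
    (e ℤ.* e) ℤ.* (+ (2 ℕ.^ m) ℤ.* + (2 ℕ.^ m))             ≡⟨ cong₂ ℤ._*_ (sign² m) (sym (ℤ.pos-* (2 ℕ.^ m) (2 ℕ.^ m))) ⟩
    1ℤ ℤ.* + (2 ℕ.^ m ℕ.* 2 ℕ.^ m)                          ≡⟨ ℤ.*-identityˡ _ ⟩
    + (2 ℕ.^ m ℕ.* 2 ℕ.^ m)                                 ∎
  where
  open ≡-Reasoning
  e = -1ℤ ℤ.^ m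
  sign² : ∀ m → (-1ℤ ℤ.^ m) ℤ.* (-1ℤ ℤ.^ m) ≡ 1ℤ
  sign² ℕ.zero    = refl
  sign² (ℕ.suc m) = trans (SignedRoot.signs (-1ℤ ℤ.^ m)) (sign² m)

module HasSizeProperties {𝕔 : Level} {q : ℕ} (𝔽 : FiniteField 𝕔 q) where

  open Geometry 𝔽

  injection⇒≤ : ∀ {S k m} → HasSize S k → (e : Fin m → Σ Point S) →
                (∀ {i j} → coords (proj₁ (e i)) ∼ coords (proj₁ (e j)) → i ≡ j) → m ℕ.≤ k
  injection⇒≤ size e e-injective = Fin.injective⇒≤ {f = to⁻ ∘ e} λ {i} {j} eq → e-injective
    (∼-trans (∼-sym (to∘to⁻ (e i))) (subst (λ k → coords (proj₁ (to k)) ∼ coords (proj₁ (e j))) (sym eq) (to∘to⁻ (e j))))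
    where
    open Bijection size
    to∘to⁻ : ∀ y → coords (proj₁ (to (to⁻ y))) ∼ coords (proj₁ y)
    to∘to⁻ = proj₂ ∘ strictlySurjective

-- Orbits as classes of Φ modulo cubes, and the intersections with lines.

module Main {𝕔 : Level} (n : ℕ) (3≤n : 3 ℕ.≤ n) (𝔽 : FiniteField 𝕔 (2 ℕ.^ n))
  (ω : FiniteField.Carrier 𝔽) (ω-primitive : Geometry.IsPrimitive 𝔽 ω)
  (ζ : FiniteField.Carrier 𝔽) (ζ²+ζ≡1 : Character.℘ n 𝔽 ζ ≡ FiniteField.1# 𝔽)
  (σ : ℤ) (σ²≡q : σ ℤ.* σ ≡ + (2 ℕ.^ n)) (σ≡1mod3 : ∃ λ j → σ ≡ 1ℤ ℤ.+ + 3 ℤ.* j)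
  where

  open FiniteField 𝔽 using (Carrier; commutativeRing)
  open Geometry 𝔽
  open HasSizeProperties 𝔽
  open Counting n 𝔽 ω ω-primitive ζ ζ²+ζ≡1 σ σ²≡q σ≡1mod3
  open BinaryCubic n 𝔽 ζ ζ²+ζ≡1
  open NormalForm n 𝔽 ζ ζ²+ζ≡1
  open Vectors n 𝔽
  open Primitive 𝔽 ω ω-primitive using (ω^k≢0)
  open Solver₂ using (solve; _:=_; _:+_; _:*_; con)
  open Exp (CommutativeRing.semiring commutativeRing) using () renaming (_^_ to _↑_)

  private
    q : ℕ
    q = 2 ℕ.^ n

  parameter : ℕ → Carrier
  parameter i = ω ↑ (i ℕ.∸ 1)

  -- For an orbit vector v scaled by s one has u Φ(s v) = u s³ u² = (s u)³.
  orbit⇒Cubic : ∀ i {X} → X ∈ 𝓩 ω i → Cubic (parameter i * Φ (coords X))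
  orbit⇒Cubic i {X} (a , b , c , d , det≡1 , s , s≢0 , X≡) = subst Cubic (sym (begin
      u * Φ (coords X)
        ≡⟨ cong (λ v → u * Φ v) (trans X≡ (cong (s ·_) (M̃*R≡orbitVector a b c d u))) ⟩
      u * Φ (s · orbitVector a b c d u)
        ≡⟨ cong (_*_ u) (trans (Φ-scale s (orbitVector a b c d u)) (cong (_*_ (cube s)) (Φ-orbitVector a b c d u))) ⟩
      u * (cube s * ((u * u) * fourth (a * d + b * c)))
        ≡⟨ cong (λ e → u * (cube s * ((u * u) * fourth e))) det≡1 ⟩
      u * (cube s * ((u * u) * fourth 1#))
        ≡⟨ solve 2 (λ s u → u :* ((s :* (s :* s)) :* ((u :* u) :* ((con true :* con true) :* (con true :* con true))))
             := (s :* u) :* ((s :* u) :* (s :* u))) refl s u ⟩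
      cube (s * u) ∎)) (cube-Cubic (*≢0 s≢0 (ω^k≢0 (i ℕ.∸ 1))))
    where
    open ≡-Reasoning
    u = parameter i

  -- If u Φ(X) w³ = 1, the representative scaled by k = u w satisfies Φ = u², the value on orbit
  -- vectors, and therefore is an orbit vector itself.
  Cubic⇒orbit : ∀ i {X} → OnQuadric (coords X) → Cubic (parameter i * Φ (coords X)) → X ∈ 𝓩 ω i
  Cubic⇒orbit i {X} onQ (w , uΦw³≡1) = fromVector (onQuadric⇒orbitVector u≢0 (k · coords X) (OnQuadric-scale k (coords X) onQ) (begin
      Φ (k · coords X)              ≡⟨ Φ-scale k (coords X) ⟩
      cube k * Φ (coords X)
        ≡⟨ solve 3 (λ u w f → ((u :* w) :* ((u :* w) :* (u :* w))) :* f := (u :* u) :* ((u :* f) :* (w :* (w :* w))))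
             refl u w (Φ (coords X)) ⟩
      (u * u) * ((u * Φ (coords X)) * cube w)  ≡⟨ cong (_*_ (u * u)) uΦw³≡1 ⟩
      (u * u) * 1#                  ≡⟨ *-identityʳ (u * u) ⟩
      u * u                         ∎))
    where
    open ≡-Reasoning
    u = parameter i
    u≢0 : u ≢ 0#
    u≢0 = ω^k≢0 (i ℕ.∸ 1)
    k = u * w
    k≢0 : k ≢ 0#
    k≢0 = *≢0 u≢0 (Cubic-root≢0 uΦw³≡1)
    fromVector : ∃[ a ] ∃[ b ] ∃[ c ] ∃[ d ] (a * d + b * c ≡ 1# × k · coords X ≡ orbitVector a b c d u) → X ∈ 𝓩 ω i
    fromVector (a , b , c , d , det≡1 , kX≡) = a , b , c , d , det≡1 ,
      ∼-sym (k , k≢0 , trans (M̃*R≡orbitVector a b c d u) (sym kX≡))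

  module LineInQuadric (ℓ : Line) (ℓ⊆𝓠₄ : ∀ {X} → X ∈ pointsOf ℓ → X ∈ 𝓠₄) where

    open OnLine ℓ renaming (q to r)

    f : Form
    f = cubicForm (Φ p) (coefficient₁ p r) (coefficient₂ p r) (Φ r)

    Φ-pt : ∀ s t → Φ (pt s t) ≡ f s t
    Φ-pt = Φ-combination p r

    pt-onQuadric : ∀ s t → ¬ (s ≡ 0# × t ≡ 0#) → OnQuadric (pt s t)
    pt-onQuadric s t nonzero = 𝓠₄⇒OnQuadric {point s t nonzero} (ℓ⊆𝓠₄ {point s t nonzero} (point∈ℓ s t nonzero))

    discriminant : ∃[ k ] Φ p * Φ r + coefficient₁ p r * coefficient₂ p r ≡ cube k
    discriminant = discriminant-cube p r
      (subst OnQuadric (1·u⊕0·v≡u p r) (pt-onQuadric 1# 0# (1≢0 ∘ proj₁)))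
      (subst OnQuadric (trans (0·u⊕t·v≡t·v 1# p r) (1·v≡v r)) (pt-onQuadric 0# 1# (1≢0 ∘ proj₂)))
      -- The third point P + Q supplies the conjugacy of P and Q.
      (pt-onQuadric 1# 1# (1≢0 ∘ proj₁))

    module Parametrization {g : Form} (f≅g : f ≅ g) where

      open _≅_ f≅g

      -- One normalized pair per point of the line, with (0 : 1) first, in the order of the terms of
      -- `cubics`.
      homogeneous : Fin (ℕ.suc q) → Carrier × Carrier
      homogeneous zero    = 0# , 1#
      homogeneous (suc i) = 1# , elt i

      homogeneous≢0 : ∀ j → ¬ (proj₁ (homogeneous j) ≡ 0# × proj₂ (homogeneous j) ≡ 0#)
      homogeneous≢0 zero    = 1≢0 ∘ proj₂
      homogeneous≢0 (suc i) = 1≢0 ∘ proj₁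

      pt′ : Carrier → Carrier → Vec Carrier 6
      pt′ s t = pt (s * x + t * z) (s * y + t * w)

      point′ : ∀ s t → ¬ (s ≡ 0# × t ≡ 0#) → Point
      point′ s t nonzero = point (s * x + t * z) (s * y + t * w) (substitution-nonzero nonzero)

      Φ-pt′ : ∀ s t → Φ (pt′ s t) ≡ g s t
      Φ-pt′ s t = trans (Φ-pt _ _) (substitutes s t)

      pt′-injective : ∀ {s t s′ t′} → pt′ s t ≡ pt′ s′ t′ → s ≡ s′ × t ≡ t′
      pt′-injective eq = substitution-injective (proj₁ (pt-injective eq)) (proj₂ (pt-injective eq))

      ·-pt′ : ∀ k s t → k · pt′ s t ≡ pt′ (k * s) (k * t)
      ·-pt′ k s t = trans (combination k _ _ p r) (cong₂ pt (scale s t x z) (scale s t y w))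
        where
        scale : ∀ s t u v → k * (s * u + t * v) ≡ (k * s) * u + (k * t) * v
        scale = solve 5 (λ k s t u v → k :* (s :* u :+ t :* v) := (k :* s) :* u :+ (k :* t) :* v) refl k

      pt′-surjective : ∀ {X} → X ∈ pointsOf ℓ → ∃[ s ] ∃[ t ] coords X ≡ pt′ s t
      pt′-surjective (s , t , X≡) = (s * w + t * z) * det ⁻¹ , (s * y + t * x) * det ⁻¹ ,
        trans X≡ (cong₂ pt (sym (solve-x s t)) (sym (solve-y s t)))

      pt′00≡𝟎 : pt′ 0# 0# ≡ 𝟎
      pt′00≡𝟎 = trans (sym (cong₂ pt′ (zeroˡ 0#) (zeroˡ 0#))) (trans (sym (·-pt′ 0# 0# 0#)) (0·v≡𝟎 _))

      e : Fin (ℕ.suc q) → Point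
      e j = point′ (proj₁ (homogeneous j)) (proj₂ (homogeneous j)) (homogeneous≢0 j)

      e-injective : ∀ {i j} → coords (e i) ∼ coords (e j) → i ≡ j
      e-injective {i} {j} (k , k≢0 , ei≡kej) = compare i j (pt′-injective (trans ei≡kej (·-pt′ k _ _)))
        where
        compare : ∀ i j → (proj₁ (homogeneous i) ≡ k * proj₁ (homogeneous j)) × (proj₂ (homogeneous i) ≡ k * proj₂ (homogeneous j)) → i ≡ j
        compare zero    zero    _ = refl
        compare zero    (suc j) (0≡k1 , _) = contradiction (trans (sym (*-identityʳ k)) (sym 0≡k1)) k≢0
        compare (suc i) zero    (1≡k0 , _) = contradiction (trans 1≡k0 (zeroʳ k)) 1≢0
        compare (suc i) (suc j) (1≡k1 , eq) = cong suc (elt-injective (trans eq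
          (trans (cong (_* elt j) (trans (sym (*-identityʳ k)) (sym 1≡k1))) (*-identityˡ (elt j)))))

      e-surjective : ∀ {X} → X ∈ pointsOf ℓ → ∃[ j ] coords X ∼ coords (e j)
      e-surjective {X} X∈ℓ = locate (pt′-surjective {X} X∈ℓ)
        where
        locate : ∃[ s ] ∃[ t ] coords X ≡ pt′ s t → ∃[ j ] coords X ∼ coords (e j)
        locate (s , t , X≡) = cases (s ≟ 0#) (t ≟ 0#)
          where
          cases : Dec (s ≡ 0#) → Dec (t ≡ 0#) → ∃[ j ] coords X ∼ coords (e j)
          cases (yes refl) (yes refl) = contradiction (trans X≡ pt′00≡𝟎) (proj₂ X)
          cases (yes refl) (no t≢0)   = zero , t , t≢0 ,
            trans X≡ (trans (cong₂ pt′ (sym (zeroʳ t)) (sym (*-identityʳ t))) (sym (·-pt′ t 0# 1#)))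
          cases (no s≢0)   _          = suc (idx (s ⁻¹ * t)) , s , s≢0 ,
            trans X≡ (trans (cong₂ pt′ (sym (*-identityʳ s)) (sym (trans (cong (_*_ s) (elt-idx (s ⁻¹ * t)))
              (a*b≡1⇒a*[b*x]≡x (⁻¹-inverseʳ s≢0) t))))
              (sym (·-pt′ s 1# _)))

      e∈ℓ : ∀ j → e j ∈ pointsOf ℓ
      e∈ℓ j = point∈ℓ _ _ (substitution-nonzero (homogeneous≢0 j))

      -- Members of S come with arbitrary representatives, so completeness is required for every X
      -- proportional to a listed point and not only for the listed points.
      hasSize : ∀ {a} {S : PointSet} {D : Fin (ℕ.suc q) → Set a} {k} → Enumeration D k →
                (∀ {X} → X ∈ S → X ∈ pointsOf ℓ) → (∀ j → D j → e j ∈ S) →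
                (∀ {X} j → X ∈ S → coords X ∼ coords (e j) → D j) → HasSize S k
      hasSize {S = S} {D} {k} E S⊆ℓ sound′ complete′ = record
        { to        = to
        ; cong      = λ { refl → ∼-refl }
        ; bijective = E.injective ∘ e-injective , surjective
        }
        where
        module E = Enumeration E
        to : Fin k → Σ Point S
        to i = e (E.list i) , sound′ (E.list i) (E.sound i)
        surjective : (Y : Σ Point S) → ∃[ i ] (∀ {i′} → i′ ≡ i → coords (proj₁ (to i′)) ∼ coords (proj₁ Y))
        surjective (X , X∈S) = proj₁ listed , λ { refl →
            ∼-sym (subst (λ j → coords X ∼ coords (e j)) (sym (proj₂ listed)) (proj₂ located)) }
          where
          located : ∃[ j ] coords X ∼ coords (e j)
          located = e-surjective {X} (S⊆ℓ X∈S)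
          listed : ∃[ i ] E.list i ≡ proj₁ located
          listed = E.complete (proj₁ located) (complete′ {X} (proj₁ located) X∈S (proj₂ located))

    ∈𝓨 : ∀ {X} → X ∈ pointsOf ℓ → Φ (coords X) ≡ 0# → X ∈ pointsOf ℓ ∩ 𝓨
    ∈𝓨 {X} X∈ℓ ΦX≡0 = X∈ℓ , Φ≡0⇒𝓨 {X} (ℓ⊆𝓠₄ {X} X∈ℓ) ΦX≡0

    -- If f vanished identically, all q + 1 points of the line would lie in 𝓨.
    nonZeroValue : ∀ {k} → HasSize (pointsOf ℓ ∩ 𝓨) k → k ℕ.≤ q → ∃[ s ] ∃[ t ] f s t ≢ 0#
    nonZeroValue {k} size k≤q = decide (search (λ s → search (λ t → ¬? (f s t ≟ 0#))))
      where
      open Parametrization (≅-pointwise {f} (λ _ _ → refl))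
      decide : Dec (∃[ s ] ∃[ t ] f s t ≢ 0#) → ∃[ s ] ∃[ t ] f s t ≢ 0#
      decide (yes found) = found
      decide (no  none)  = contradiction (injection⇒≤ {pointsOf ℓ ∩ 𝓨} size
          (λ j → e j , ∈𝓨 {e j} (e∈ℓ j) (trans (Φ-pt′ _ _) (vanishes _ _))) e-injective) (ℕ.<⇒≱ (ℕ.s≤s k≤q))
        where
        vanishes : ∀ s t → f s t ≡ 0#
        vanishes s t = decidable-stable (f s t ≟ 0#) (λ fst≢0 → none (s , t , fst≢0))

    zero⇒nonEmpty : ∀ {k s t} → HasSize (pointsOf ℓ ∩ 𝓨) k → ¬ (s ≡ 0# × t ≡ 0#) → f s t ≡ 0# → Fin k
    zero⇒nonEmpty {k} {s} {t} size nonzero fst≡0 =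
      Bijection.to⁻ size (point s t nonzero , ∈𝓨 {point s t nonzero} (point∈ℓ s t nonzero) (trans (Φ-pt s t) fst≡0))

    FewZeros⇒∼ : (few : FewZeros f) → let open FewZeros few in
      ∀ {X} → X ∈ pointsOf ℓ ∩ 𝓨 → (coords X ∼ pt s₁ t₁) ⊎ (coords X ∼ pt s₂ t₂)
    FewZeros⇒∼ few {X} ((s , t , X≡) , X∈𝓨) = Sum.map (proportional s₁ t₁) (proportional s₂ t₂)
        (covers s t (trans (sym (Φ-pt s t)) (trans (cong Φ (sym X≡)) (𝓨⇒Φ≡0 {X} X∈𝓨))))
      where
      open FewZeros few
      proportional : ∀ s′ t′ → ∃[ k ] (s ≡ k * s′ × t ≡ k * t′) → coords X ∼ pt s′ t′
      proportional s′ t′ (k , s≡ , t≡) = k , (λ { refl → proj₂ X (trans X≡k (0·v≡𝟎 _)) }) , X≡k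
        where
        X≡k : coords X ≡ k · pt s′ t′
        X≡k = trans X≡ (trans (cong₂ pt s≡ t≡) (sym (combination k s′ t′ p r)))

    ¬FewZeros₀ : HasSize (pointsOf ℓ ∩ 𝓨) 0 → ¬ FewZeros f
    ¬FewZeros₀ size few = Fin.¬Fin0 (zero⇒nonEmpty size nonzero isZero)
      where open FewZeros few

    -- All common points of the line and 𝓨 would be proportional to one of two vectors, so two of
    -- the three would coincide.
    ¬FewZeros₃ : HasSize (pointsOf ℓ ∩ 𝓨) 3 → ¬ FewZeros f
    ¬FewZeros₃ size few = collide (Fin.pigeonhole (ℕ.s≤s (ℕ.s≤s (ℕ.s≤s ℕ.z≤n))) (proj₁ ∘ class))
      where
      open FewZeros few
      open Bijection size using (to; injective)
      representative : Fin 2 → Vec Carrier 6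
      representative zero    = pt s₁ t₁
      representative (suc _) = pt s₂ t₂
      class : ∀ i → ∃[ b ] coords (proj₁ (to i)) ∼ representative b
      class i = choose (FewZeros⇒∼ few {proj₁ (to i)} (proj₂ (to i)))
        where
        choose : (coords (proj₁ (to i)) ∼ pt s₁ t₁) ⊎ (coords (proj₁ (to i)) ∼ pt s₂ t₂) →
                 ∃[ b ] coords (proj₁ (to i)) ∼ representative b
        choose (inj₁ ∼₁) = zero , ∼₁
        choose (inj₂ ∼₂) = suc zero , ∼₂
      collide : ¬ (∃[ i ] ∃[ j ] (i Fin.< j × proj₁ (class i) ≡ proj₁ (class j)))
      collide (i , j , i<j , same) = Fin.<⇒≢ i<j (injective (∼-trans (proj₂ (class i))
        (∼-sym (subst (λ b → coords (proj₁ (to j)) ∼ representative b) (sym same) (proj₂ (class j))))))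

    module Diagonalized (α β : Carrier) (αβ-Cubic : Cubic (α * β)) (f≅ : f ≅ diagonal α β) where

      open Diagonal α β αβ-Cubic
      open Parametrization f≅
      open _≅_ f≅

      value : Fin (ℕ.suc q) → Carrier
      value j = diagonal α β (proj₁ (homogeneous j)) (proj₂ (homogeneous j))

      -- Membership in 𝓩ᵢ depends on the value of the diagonal form alone, so the common points are
      -- enumerated by the indices j whose value times u is a nonzero cube.
      hasSizeℚ : ∀ i {N} → + 3 ℤ.* cubics (parameter i) ≡ N → HasSizeℚ (pointsOf ℓ ∩ 𝓩 ω i) (N ℚ./ 3)
      hasSizeℚ i {N} 3cubics≡N = proj₁ enumeration ,
        hasSize {S = pointsOf ℓ ∩ 𝓩 ω i} (proj₁ (proj₂ enumeration)) proj₁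
          (λ j Dj → e∈ℓ j , Cubic⇒orbit i {e j} (𝓠₄⇒OnQuadric {e j} (ℓ⊆𝓠₄ {e j} (e∈ℓ j)))
            (subst (λ v → Cubic (u * v)) (sym (Φ-pt′ _ _)) Dj))
          (λ {X} j (_ , X∈𝓩) X∼ej → transport {X} j (orbit⇒Cubic i {X} X∈𝓩) X∼ej) ,
        3*k≡i⇒k/1≡i/3 {proj₁ enumeration} {N} (trans (cong (λ k → + 3 ℤ.* k) (trans (proj₂ (proj₂ enumeration)) total)) 3cubics≡N)
        where
        u = parameter i
        D? : ∀ j → Dec (Cubic (u * value j))
        D? j = cubic? (u * value j)
        enumeration = enumerate D?
        transport : ∀ {X} j → Cubic (u * Φ (coords X)) → coords X ∼ coords (e j) → Cubic (u * value j)
        -- Another representative multiplies the value by k³, which does not change its class modulo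
        -- cubes.
        transport {X} j uΦX∈ (k , k≢0 , X≡) = Cubic-cancelˡ (cube-Cubic k≢0) (subst Cubic (begin
          u * Φ (coords X)              ≡⟨ cong (λ v → u * Φ v) X≡ ⟩
          u * Φ (k · coords (e j))      ≡⟨ cong (_*_ u) (trans (Φ-scale k (coords (e j))) (cong (_*_ (cube k)) (Φ-pt′ _ _))) ⟩
          u * (cube k * value j)        ≡⟨ solve 3 (λ u k v → u :* (k :* v) := k :* (u :* v)) refl u (cube k) (value j) ⟩
          cube k * (u * value j)        ∎) uΦX∈)
          where open ≡-Reasoning
        total : ℤ∑.sum (λ j → 𝟙 (D? j)) ≡ cubics u
        total = cong₂ ℤ._+_
          (cong (λ v → 𝟙 (cubic? (u * v))) (solve 2 (λ a b → a :* (con false :* (con false :* con false)) :+ b :* (con true :* (con true :* con true)) := b) refl α β))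
          (trans (ℤ∑.sum-cong-≗ {q} (λ i → cong (λ v → 𝟙 (cubic? (u * v)))
              (solve 3 (λ a b t → a :* (con true :* (con true :* con true)) :+ b :* (t :* (t :* t)) := a :+ b :* (t :* (t :* t))) refl α β (elt i))))
            (sym (∑≡sum (λ t → 𝟙 (cubic? (u * (α + β * cube t)))))))

      -- From α s³ = β t³ with s and t nonzero, α² s³ = αβ t³ is a cube, hence so are α² and α.
      zero⇒α-Cubic : ∀ {s t} → ¬ (s ≡ 0# × t ≡ 0#) → diagonal α β s t ≡ 0# → Cubic α
      zero⇒α-Cubic {s} {t} nonzero eq = square-Cubic (Cubic-cancelˡ (cube-Cubic s≢0) (subst Cubic (begin
          α * β * cube t          ≡⟨ *-assoc α β (cube t) ⟩
          α * (β * cube t)        ≡⟨ cong (_*_ α) αs³≡βt³ ⟨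
          α * (α * cube s)        ≡⟨ solve 2 (λ a s → a :* (a :* s) := s :* (a :* a)) refl α (cube s) ⟩
          cube s * (α * α)        ∎) (Cubic-* αβ-Cubic (cube-Cubic t≢0))))
        where
        open ≡-Reasoning
        αs³≡βt³ : α * cube s ≡ β * cube t
        αs³≡βt³ = x+y≡0⇒x≡y eq
        other≡0 : ∀ {x y s t} → x ≢ 0# → y * cube t ≡ x * cube s → t ≡ 0# → s ≡ 0#
        other≡0 {x} {y} x≢0 eq refl = cube≡0 (*-cancelˡ x≢0
          (trans (sym eq) (trans (trans (cong (_*_ y) (zeroˡ _)) (zeroʳ y)) (sym (zeroʳ x)))))
        s≢0 : s ≢ 0#
        s≢0 s≡0 = nonzero (s≡0 , other≡0 β≢0 αs³≡βt³ s≡0)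
        t≢0 : t ≢ 0#
        t≢0 t≡0 = nonzero (other≡0 α≢0 (sym αs³≡βt³) t≡0 , t≡0)

      α-Cubic₃ : HasSize (pointsOf ℓ ∩ 𝓨) 3 → Cubic α
      α-Cubic₃ size = fromPoint (pt′-surjective {X} (proj₁ X∈))
        where
        open Bijection size using (to)
        X : Point
        X = proj₁ (to zero)
        X∈ : X ∈ pointsOf ℓ ∩ 𝓨
        X∈ = proj₂ (to zero)
        fromPoint : ∃[ s ] ∃[ t ] coords X ≡ pt′ s t → Cubic α
        fromPoint (s , t , X≡) = zero⇒α-Cubic
          (λ { (refl , refl) → proj₂ X (trans X≡ pt′00≡𝟎) })
          (trans (sym (Φ-pt′ s t)) (trans (cong Φ (sym X≡)) (𝓨⇒Φ≡0 {X} (proj₂ X∈))))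

      -- If α is a cube, so is β, and witnesses with α v³ = 1 = β w³ give the zero (v, w), a common
      -- point with 𝓨.
      α-nonCubic₀ : HasSize (pointsOf ℓ ∩ 𝓨) 0 → ¬ Cubic α
      α-nonCubic₀ size α∈@(v , αv³≡1) = Fin.¬Fin0 (zero⇒nonEmpty size
          (substitution-nonzero {v} {proj₁ β∈} (Cubic-root≢0 αv³≡1 ∘ proj₁))
          (trans (substitutes v (proj₁ β∈)) (trans (cong₂ _+_ αv³≡1 (proj₂ β∈)) 1+1≡0)))
        where
        β∈ : Cubic β
        β∈ = β-Cubic α∈

      parameter₁ : Cubic (parameter 1)
      parameter₁ = 1-Cubic

      parameter₂ : ¬ Cubic (parameter 2)
      parameter₂ = ω-nonCubic ∘ subst Cubic (*-identityʳ ω)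

      parameter₃ : ¬ Cubic (parameter 3)
      parameter₃ = ω-nonCubic ∘ square-Cubic ∘ subst Cubic (cong (_*_ ω) (*-identityʳ ω))

      sizes₃ : HasSize (pointsOf ℓ ∩ 𝓨) 3 →
        HasSizeℚ (pointsOf ℓ ∩ 𝓩 ω 1) ((+ q ℤ.- + 2 ℤ.* σ ℤ.- + 2) ℚ./ 3) ×
        HasSizeℚ (pointsOf ℓ ∩ 𝓩 ω 2) ((+ q ℤ.+ σ ℤ.- + 2) ℚ./ 3) ×
        HasSizeℚ (pointsOf ℓ ∩ 𝓩 ω 3) ((+ q ℤ.+ σ ℤ.- + 2) ℚ./ 3)
      sizes₃ size =
        hasSizeℚ 1 (cubics-split-Cubic α∈ parameter₁) ,
        hasSizeℚ 2 (cubics-split-nonCubic α∈ (ω^k≢0 1) parameter₂) ,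
        hasSizeℚ 3 (cubics-split-nonCubic α∈ (ω^k≢0 2) parameter₃)
        where
        α∈ : Cubic α
        α∈ = α-Cubic₃ size

      sizes₀ : HasSize (pointsOf ℓ ∩ 𝓨) 0 →
        HasSizeℚ (pointsOf ℓ ∩ 𝓩 ω 1) ((+ q ℤ.- + 2 ℤ.* σ ℤ.+ 1ℤ) ℚ./ 3) ×
        HasSizeℚ (pointsOf ℓ ∩ 𝓩 ω 2) ((+ q ℤ.+ σ ℤ.+ 1ℤ) ℚ./ 3) ×
        HasSizeℚ (pointsOf ℓ ∩ 𝓩 ω 3) ((+ q ℤ.+ σ ℤ.+ 1ℤ) ℚ./ 3)
      sizes₀ size =
        hasSizeℚ 1 (cubics-irreducible-Cubic α∉ parameter₁) ,
        hasSizeℚ 2 (cubics-irreducible-nonCubic α∉ (ω^k≢0 1) parameter₂) ,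
        hasSizeℚ 3 (cubics-irreducible-nonCubic α∉ (ω^k≢0 2) parameter₃)
        where
        α∉ : ¬ Cubic α
        α∉ = α-nonCubic₀ size

    diagonalized : ∀ {k} → HasSize (pointsOf ℓ ∩ 𝓨) k → k ℕ.≤ q → ¬ FewZeros f → Diagonalizable f
    diagonalized size k≤q many = diagonalize (proj₂ discriminant) (nonZeroValue size k≤q) many

  -- Ensures that a line with three points in 𝓨 is not contained in 𝓨.
  3≤q : 3 ℕ.≤ q
  3≤q = ℕ.≤-trans (ℕ.s≤s (ℕ.s≤s (ℕ.s≤s ℕ.z≤n))) (ℕ.^-monoʳ-≤ 2 3≤n)

  lines₃ : (ℓ : Line) → ℓ ∈ 𝓛 3 →
    HasSizeℚ (pointsOf ℓ ∩ 𝓩 ω 1) ((+ q ℤ.- + 2 ℤ.* σ ℤ.- + 2) ℚ./ 3) ×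
    HasSizeℚ (pointsOf ℓ ∩ 𝓩 ω 2) ((+ q ℤ.+ σ ℤ.- + 2) ℚ./ 3) ×
    HasSizeℚ (pointsOf ℓ ∩ 𝓩 ω 3) ((+ q ℤ.+ σ ℤ.- + 2) ℚ./ 3)
  lines₃ ℓ (ℓ⊆𝓠₄ , size) = conclude (diagonalized size 3≤q (¬FewZeros₃ size))
    where
    open LineInQuadric ℓ (λ {X} → ℓ⊆𝓠₄ {X})
    conclude : Diagonalizable f → _
    conclude (α , β , αβ∈ , f≅) = Diagonalized.sizes₃ α β αβ∈ f≅ size

  lines₀ : (ℓ : Line) → ℓ ∈ 𝓛 0 →
    HasSizeℚ (pointsOf ℓ ∩ 𝓩 ω 1) ((+ q ℤ.- + 2 ℤ.* σ ℤ.+ 1ℤ) ℚ./ 3) ×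
    HasSizeℚ (pointsOf ℓ ∩ 𝓩 ω 2) ((+ q ℤ.+ σ ℤ.+ 1ℤ) ℚ./ 3) ×
    HasSizeℚ (pointsOf ℓ ∩ 𝓩 ω 3) ((+ q ℤ.+ σ ℤ.+ 1ℤ) ℚ./ 3)
  lines₀ ℓ (ℓ⊆𝓠₄ , size) = conclude (diagonalized size ℕ.z≤n (¬FewZeros₀ size))
    where
    open LineInQuadric ℓ (λ {X} → ℓ⊆𝓠₄ {X})
    conclude : Diagonalizable f → _
    conclude (α , β , αβ∈ , f≅) = Diagonalized.sizes₀ α β αβ∈ f≅ size

proposition4p10 :
  {c : Level} (n : ℕ) → 3 ≤ n → 2 ^ n % 3 ≡ 1 →
  (𝔽 : FiniteField c (2 ^ n)) →
  let open FiniteField 𝔽 using (Carrier)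
      open Geometry 𝔽
      q  = + (2 ^ n)
      √q = + (2 ^ ⌊ n /2⌋)
      ε  = -1ℤ ℤ.^ ⌊ n /2⌋
  in
  (ω : Carrier) → IsPrimitive ω →
  ((ℓ : Line) → ℓ ∈ 𝓛 3 →
    HasSize  (pointsOf ℓ ∩ 𝓨) 3 ×
    HasSizeℚ (pointsOf ℓ ∩ 𝓩 ω 1) ((q ℤ.- ε ℤ.* + 2 ℤ.* √q ℤ.- + 2) ℚ./ 3) ×
    HasSizeℚ (pointsOf ℓ ∩ 𝓩 ω 2) ((q ℤ.+ ε ℤ.* √q ℤ.- + 2) ℚ./ 3) ×
    HasSizeℚ (pointsOf ℓ ∩ 𝓩 ω 3) ((q ℤ.+ ε ℤ.* √q ℤ.- + 2) ℚ./ 3)) ×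
  ((ℓ : Line) → ℓ ∈ 𝓛 0 →
    HasSizeℚ (pointsOf ℓ ∩ 𝓩 ω 1) ((q ℤ.- ε ℤ.* + 2 ℤ.* √q ℤ.+ + 1) ℚ./ 3) ×
    HasSizeℚ (pointsOf ℓ ∩ 𝓩 ω 2) ((q ℤ.+ ε ℤ.* √q ℤ.+ + 1) ℚ./ 3) ×
    HasSizeℚ (pointsOf ℓ ∩ 𝓩 ω 3) ((q ℤ.+ ε ℤ.* √q ℤ.+ + 1) ℚ./ 3))
proposition4p10 n 3≤n q%3≡1 𝔽 ω ω-primitive =
  (λ ℓ ℓ∈𝓛₃ → let z₁ , z₂ , z₃ = lines₃ ℓ ℓ∈𝓛₃ in proj₂ ℓ∈𝓛₃ ,
    -- σ unfolds to ε √q, so only the doubled term of the first count has to be rearranged.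
    subst (λ i → HasSizeℚ (pointsOf ℓ ∩ 𝓩 ω 1) ((+ (2 ^ n) ℤ.- i ℤ.- + 2) ℚ./ 3)) 2σ≡ z₁ , z₂ , z₃) ,
  (λ ℓ ℓ∈𝓛₀ → let z₁ , z₂ , z₃ = lines₀ ℓ ℓ∈𝓛₀ in
    subst (λ i → HasSizeℚ (pointsOf ℓ ∩ 𝓩 ω 1) ((+ (2 ^ n) ℤ.- i ℤ.+ + 1) ℚ./ 3)) 2σ≡ z₁ , z₂ , z₃)
  where
  open Geometry 𝔽 using (HasSizeℚ; pointsOf; 𝓩)
  m = ⌊ n /2⌋
  2σ≡ : + 2 ℤ.* signedRoot m ≡ -1ℤ ℤ.^ m ℤ.* + 2 ℤ.* + (2 ^ m)
  2σ≡ = SignedRoot.doubling (-1ℤ ℤ.^ m) (+ (2 ^ m))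
  root = Primitive.cubeRootOfUnity 𝔽 ω ω-primitive q%3≡1
  -- The congruence q ≡ 1 (mod 3) enters twice: it provides ζ, and it makes n even, so that the
  -- signed root squares to q.
  open Main n 3≤n 𝔽 ω ω-primitive
    (proj₁ root) (Character.cubeRoot⇒℘≡1 n 𝔽 (proj₁ (proj₂ root)) (proj₂ (proj₂ root)))
    (signedRoot m) (trans (signedRoot² m) (cong +_ (√q*√q≡q n q%3≡1))) (signedRoot≡1mod3 m)
    using (lines₃; lines₀)
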